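{- Let $p$ be a prime, $q=p^e$, $m,k\ge1$, and let $D\subseteq[0,k(q^m-1)]$ with $D\ne\{0\}$. Let $\mathcal{T}_D=\{\boldsymbol{t}=(t_1,\dots,t_k)\in[0,q^m-1]^k:|\boldsymbol{t}|\in D\}$. Let $f\in\mathbb{F}_{q^m}[x_1,\dots,x_k]$ be a polynomial with $\mathrm{Deg}(f)\subseteq D$. Then $\nu_p\big(N(f=y^q-y)\big)$ is at least the minimum of $\frac{1}{p-1}\sum_{\boldsymbol{t}\in\mathcal{T}_D}S_p(r_{\boldsymbol{t}})$ over all $\boldsymbol{r}=(r_{\boldsymbol{t}})_{\boldsymbol{t}\in\mathcal{T}_D}\in[0,q^m-1]^{\mathcal{T}_D}$ such that $\sum_{\boldsymbol{t}\in\mathcal{T}_D}r_{\boldsymbol{t}}\equiv0\pmod{q-1}$ and, for each $1\le i\le k$, $\sum_{\boldsymbol{t}\in\mathcal{T}_D}r_{\boldsymbol{t}}t_i$ is a positive multiple of $q^m-1$. Moreover, there exists a polynomial $f$ with $\mathrm{Deg}(f)\subseteq D$ for which $\nu_p(N(f=y^q-y))$ equals this minimum.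
   Context: $N(f=y^q-y)$ denotes the number of $(x_1,\dots,x_k,y)\in\mathbb{F}_{q^m}^{k+1}$ with $f(x_1,\dots,x_k)=y^q-y$. If $f=f_{d_1}+\cdots+f_{d_t}$ with $f_{d_i}$ the nonzero homogeneous component of degree $d_i$, then $\mathrm{Deg}(f)=\{d_1,\dots,d_t\}$. $|\boldsymbol{t}|=t_1+\cdots+t_k$; $[a,b]=\{i\in\mathbb{Z}:a\le i\le b\}$. $S_p(a)$ is the sum of base-$p$ digits of $a$; $\nu_p$ is the $p$-adic valuation. -}

module Defs where

open import Algebra.Bundles using (CommutativeRing)
import Algebra.Properties.CommutativeMonoid.Sum as Sum
import Algebra.Properties.Semiring.Exp as Exp
open import Data.Digit using (toDigits)
open import Data.Fin.Base using (Fin; toℕ)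
open import Data.Fin.Properties using (any?)
open import Data.Fin.Subset using (Subset; _∈_)
open import Data.Fin.Subset.Properties using (_∈?_)
open import Data.Integer.Base using (+_)
open import Data.List.Base as List
  using (List; []; _∷_; length; filter; allFin; upTo; cartesianProduct; cartesianProductWith)
open import Data.List.Extrema.Nat using (max)
open import Data.Maybe.Base as Maybe using ()
open import Data.Nat.Base as ℕ
  using (ℕ; zero; suc; _∸_; _<_; NonZero; NonTrivial; >-nonZero; nonTrivial⇒n>1)
open import Data.Nat.Divisibility using (_∣_; _∣?_)
open import Data.Nat.ListAction using (sum)
import Data.Nat.Properties as ℕ
open import Data.Product.Base using (∃; _×_; _,_; proj₁)
open import Data.Rational.Base as ℚ using (ℚ; _/_)
open import Data.Vec.Base as Vec using (Vec; []; _∷_)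
import Data.Vec.Properties as Vec
open import Function.Bundles using (Inverse)
open import Function.Properties.Inverse using (Inverse⇒Injection)
open import Level using (Level; _⊔_) renaming (suc to lsuc)
open import Relation.Binary.Definitions using (Decidable)
open import Relation.Binary.PropositionalEquality using (_≡_; setoid)
open import Relation.Nullary using (¬_; Dec)
open import Relation.Nullary.Construct.Add.Supremum using (_⁺; [_]; ⊤⁺)
open import Relation.Nullary.Decidable using (_×-dec_; fromWitness; via-injection)
open import Relation.Unary using (Pred)

private
  variable
    a ℓ : Level
    A : Set a

tuples : List A → (k : ℕ) → List (Vec A k)
tuples xs zero    = [] ∷ []
tuples xs (suc k) = cartesianProductWith _∷_ xs (tuples xs k)

record IsMinimum {A : Set} (P : Pred A ℓ) (g : A → ℚ) (μ : ℚ) : Set ℓ where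
  field
    attained   : ∃ λ x → P x × g x ≡ μ
    lowerBound : ∀ x → P x → μ ℚ.≤ g x

-- ν p 0 = ∞; otherwise the largest v with p ^ v ∣ n.  For p ≥ 2 such a v
-- satisfies v < p ^ v ≤ n, so searching below n loses nothing.
ν : (p n : ℕ) → ℕ ⁺
ν p zero      = ⊤⁺
ν p n@(suc _) = [ max 0 (filter (λ v → p ℕ.^ v ∣? n) (upTo n)) ]

toℚ⁺ : ℕ ⁺ → ℚ ⁺
toℚ⁺ = Maybe.map (λ n → + n / 1)

digitSum : (p : ℕ) .{{_ : NonTrivial p}} → ℕ → ℕ
digitSum p n =
  sum (List.map toℕ (proj₁ (toDigits p {fromWitness (nonTrivial⇒n>1 p)} n)))

-- A polynomial is a list of terms (coefficient , exponents).  Exponent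
-- vectors may repeat and coefficients may vanish, so being zero is decided
-- on the collected coefficients `coeff`, not on the list.
module Polynomials {c ℓ} (R : CommutativeRing c ℓ) (k : ℕ) where
  open CommutativeRing R
  open Exp semiring using (_^_)

  Poly : Set c
  Poly = List (Carrier × Vec ℕ k)

  coeff : Poly → Vec ℕ k → Carrier
  coeff f t = List.foldr _+_ 0# (List.map proj₁
    (filter (λ (_ , s) → Vec.≡-dec ℕ._≟_ s t) f))

  IsZero : Poly → Set ℓ
  IsZero f = ∀ t → coeff f t ≈ 0#

  homogeneousComponent : ℕ → Poly → Poly
  homogeneousComponent d = filter (λ (_ , t) → Vec.sum t ℕ.≟ d)

  Deg : Poly → Pred ℕ ℓ
  Deg f d = ¬ IsZero (homogeneousComponent d f)

  eval : Poly → Vec Carrier k → Carrier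
  eval f xs = List.foldr _+_ 0# (List.map
    (λ (a , t) → a * Vec.foldr′ _*_ 1# (Vec.zipWith _^_ xs t)) f)

record FiniteField (n : ℕ) c ℓ : Set (lsuc (c ⊔ ℓ)) where
  field
    commutativeRing : CommutativeRing c ℓ
  open CommutativeRing commutativeRing public hiding (setoid)
  open CommutativeRing commutativeRing using () renaming (setoid to ≈-setoid)
  field
    1≉0         : ¬ 1# ≈ 0#
    inverse     : ∀ x → ¬ x ≈ 0# → ∃ λ y → x * y ≈ 1#
    enumeration : Inverse ≈-setoid (setoid (Fin n))

  elements : List Carrier
  elements = List.map (Inverse.from enumeration) (allFin n)

  _≟_ : Decidable _≈_
  _≟_ = via-injection (Inverse⇒Injection enumeration) Data.Fin.Properties._≟_

module Counting {n c ℓ} (F : FiniteField n c ℓ) (k : ℕ) where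
  open FiniteField F
  open Exp semiring using (_^_)
  open Polynomials commutativeRing k public

  N : (q : ℕ) → Poly → ℕ
  N q f = length (filter (λ (xs , y) → eval f xs ≟ (y ^ q - y))
    (cartesianProduct (tuples elements k) elements))

-- A set D ⊆ [0 , b], given as a `Subset`, viewed as a set of naturals.
⟦_⟧ : ∀ {b} → Subset (suc b) → Pred ℕ _
⟦ D ⟧ d = ∃ λ i → i ∈ D × toℕ i ≡ d

_∈⟦_⟧? : ∀ {b} d (D : Subset (suc b)) → Dec (⟦ D ⟧ d)
d ∈⟦ D ⟧? = any? (λ i → (i ∈? D) ×-dec (toℕ i ℕ.≟ d))

∣_∣₁ : ∀ {Q k} → Vec (Fin Q) k → ℕ
∣ t ∣₁ = Vec.sum (Vec.map toℕ t)

-- Fin Q is the interval [0 , Q - 1].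
module Optimisation (q Q k : ℕ) {b : ℕ} (D : Subset (suc b)) where
  open Sum ℕ.+-0-commutativeMonoid using (sum-syntax)

  -- Each element of 𝒯 occurs exactly once in the list, so families
  -- indexed by 𝒯 are functions on the positions of this list.
  𝒯 : List (Vec (Fin Q) k)
  𝒯 = filter (λ t → ∣ t ∣₁ ∈⟦ D ⟧?) (tuples (allFin Q) k)

  Family : Set
  Family = Fin (length 𝒯) → Fin Q

  weighted : Family → Fin k → ℕ
  weighted r i = ∑[ j < length 𝒯 ] (toℕ (r j) ℕ.* toℕ (Vec.lookup (List.lookup 𝒯 j) i))

  record Admissible (r : Family) : Set where
    field
      total      : (q ∸ 1) ∣ (∑[ j < length 𝒯 ] toℕ (r j))
      coordinate : ∀ i → 0 < weighted r i × (Q ∸ 1) ∣ weighted r i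

  cost : (p : ℕ) .{{_ : NonTrivial p}} → Family → ℚ
  cost p r = (+ (∑[ j < length 𝒯 ] digitSum p (toℕ (r j)))) / (p ∸ 1)
    where instance
      p∸1≢0 : NonZero (p ∸ 1)
      p∸1≢0 = >-nonZero (ℕ.m<n⇒0<n∸m (nonTrivial⇒n>1 p))

{-# OPTIONS --safe #-}
module Submission where

-- Additive characters turn N into Σ_{λ ∈ 𝔽_q} Σ_x ψ(λ f(x)) with ψ(u) = ζ^{Tr u}, ζ^p = 1.  Expanding each
-- ψ(λ a x^t) in powers of Teichmüller representatives gives coefficients c(r) which are Gauss sums, of valuation
-- S_p(r) with respect to π = ζ − 1 by Stickelberger's theorem; the sums over λ and x then keep exactly the terms
-- subject to the stated congruences.  A vanishing coordinate sum contributes the factor Q, which pays for an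
-- additional term with r = Q − 1.  As the term of r carries the monomial ∏ T(a_t)^{r_t} in the coefficients
-- of f, no cancellation between different r can occur for all f at once, so the bound is attained.
-- The ring containing ζ and the T(a) is a ring of commuting operators on integer-valued functions, localised at
-- the kernel of its map to the residue field; that kernel is principal thanks to the element Σ_x Tr(a/x) T(x).
open import Algebra.Bundles using (CommutativeMonoid; CommutativeRing)
import Data.Fin.Base
open import Data.Fin.Subset using (Nonempty; Subset; ⁅_⁆)
import Data.Nat.Base as ℕ
open import Data.Nat.Primality using (Prime; prime⇒nonTrivial; prime⇒nonZero)
open import Defs using (FiniteField)
open import Level using (_⊔_) renaming (suc to lsuc)
open import Relation.Binary.PropositionalEquality as ≡ using (_≡_; _≢_)
open import Relation.Nullary using (Dec; contradiction; no; yes; ¬_; ¬?)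

-- The exponents of f are arbitrary naturals, whereas `𝒯` only allows entries up to Q - 1. Reducing
-- positive exponents to [1, Q - 1] preserves f as a function but lowers its degree, possibly out of
-- D. Hence comparing a term of the expansion with an admissible family is a problem of its own:
-- exponent vectors must be replaced by vectors over [0, Q - 1] of the same total degree, keeping
-- all congruences and leaving no coordinate sum zero. Terms that thereby become equal are merged by
-- adding their r modulo Q - 1, and subadditivity of digit sums keeps the cost from growing. The
-- additional terms with r = Q - 1 use a monomial of positive degree in D, which is where D ≠ {0}
-- enters. Cancellation in O is available for π and for elements of nonzero residue. Valuations are
-- therefore equations w x = π^s y with a unit w, and factors such as Q and powers of Q - 1 are
-- carried along until they cancel. Since p has valuation p - 1, a π-adic bound K amounts to the
-- p-adic bound K / (p - 1).

-- Normalisation of ring expressions with integer coefficients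

module Solver {c ℓ} (R : CommutativeRing c ℓ) where

  open import Algebra.Bundles.Raw using (RawRing)
  import Algebra.Properties.Semiring.Mult as Mult
  import Algebra.Properties.Ring as RingProperties
  import Algebra.Properties.CommutativeSemigroup as Interchange
  open import Algebra.Solver.Ring.AlmostCommutativeRing
    using (fromCommutativeRing; _-Raw-AlmostCommutative⟶_)
  open import Data.Maybe.Base using (Maybe; just; nothing)
  import Data.Nat.Base as ℕ
  open ℕ using (ℕ)
  import Data.Nat.Properties as ℕ
  open import Data.Product.Base using (_×_; _,_)
  open import Relation.Binary.PropositionalEquality using (_≡_)

  open CommutativeRing R
  open Mult semiring using (×-homo-+; ×1-homo-*; ×-congˡ) renaming (_×_ to _·_)
  open RingProperties ring using (-0#≈0#; -‿involutive; -‿+-comm; -‿distribˡ-*; -‿distribʳ-*)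
  open Interchange +-commutativeSemigroup using (interchange)
  open import Relation.Binary.Reasoning.Setoid setoid

  private
    -- The pair (a , b) denotes the integer a − b.
    reduce : ℕ × ℕ → ℕ × ℕ
    reduce (ℕ.suc a , ℕ.suc b) = reduce (a , b)
    reduce x                   = x

    -- Integers, so that terms of opposite sign cancel in normal forms. Reducing after each
    -- operation makes the computed values 0 and 1 literally (0 , 0) and (1 , 0), which `⟦_⟧` treats
    -- separately.
    differences : RawRing _ _
    differences = record
      { Carrier = ℕ × ℕ
      ; _≈_     = _≡_
      ; _+_     = λ (a , b) (c , d) → reduce (a ℕ.+ c , b ℕ.+ d)
      ; _*_     = λ (a , b) (c , d) → reduce (a ℕ.* c ℕ.+ b ℕ.* d , a ℕ.* d ℕ.+ b ℕ.* c)
      ; -_      = λ (a , b) → b , a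
      ; 0#      = 0 , 0
      ; 1#      = 1 , 0
      }

    ⌊_⌋ : ℕ → Carrier
    ⌊ n ⌋ = n · 1#

    difference : ℕ × ℕ → Carrier
    difference (a , b) = ⌊ a ⌋ - ⌊ b ⌋

    -- The constants 0 and 1 of the solver have to evaluate to 0# and 1# judgementally.
    ⟦_⟧ : ℕ × ℕ → Carrier
    ⟦ 0 , 0 ⟧ = 0#
    ⟦ 1 , 0 ⟧ = 1#
    ⟦ a , b ⟧ = difference (a , b)

    0-difference : 0# ≈ difference (0 , 0)
    0-difference = sym (-‿inverseʳ 0#)

    1-difference : 1# ≈ difference (1 , 0)
    1-difference = sym (trans (+-cong (+-identityʳ 1#) -0#≈0#) (+-identityʳ 1#))

    ⟦⟧≈difference : ∀ x → ⟦ x ⟧ ≈ difference x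
    ⟦⟧≈difference (0 , 0)                           = 0-difference
    ⟦⟧≈difference (0 , ℕ.suc _)                     = refl
    ⟦⟧≈difference (1 , 0)                           = 1-difference
    ⟦⟧≈difference (1 , ℕ.suc _)                     = refl
    ⟦⟧≈difference (ℕ.suc (ℕ.suc _) , _)             = refl

    reduce-correct : ∀ x → ⟦ reduce x ⟧ ≈ difference x
    reduce-correct (ℕ.suc a , ℕ.suc b) = begin
      ⟦ reduce (a , b) ⟧                   ≈⟨ reduce-correct (a , b) ⟩
      ⌊ a ⌋ - ⌊ b ⌋                        ≈⟨ +-identityˡ _ ⟨
      0# + (⌊ a ⌋ - ⌊ b ⌋)                 ≈⟨ +-congʳ (-‿inverseʳ 1#) ⟨
      (1# - 1#) + (⌊ a ⌋ - ⌊ b ⌋)          ≈⟨ interchange _ _ _ _ ⟩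
      ⌊ ℕ.suc a ⌋ + (- 1# + - ⌊ b ⌋)       ≈⟨ +-congˡ (-‿+-comm _ _) ⟩
      ⌊ ℕ.suc a ⌋ - ⌊ ℕ.suc b ⌋            ∎
    reduce-correct (ℕ.zero , b)           = ⟦⟧≈difference (ℕ.zero , b)
    reduce-correct (ℕ.suc a , ℕ.zero)     = ⟦⟧≈difference (ℕ.suc a , ℕ.zero)

    product : ∀ x y z w → (x - y) * (z - w) ≈ (x * z + y * w) - (x * w + y * z)
    product x y z w = begin
      (x - y) * (z - w)                        ≈⟨ distribʳ _ _ _ ⟩
      x * (z - w) + - y * (z - w)              ≈⟨ +-cong (distribˡ _ _ _) (distribˡ _ _ _) ⟩
      (x * z + x * - w) + (- y * z + - y * - w)
        ≈⟨ +-cong (+-congˡ (sym (-‿distribʳ-* x w))) (+-cong (sym (-‿distribˡ-* y z)) neg²) ⟩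
      (x * z + - (x * w)) + (- (y * z) + y * w) ≈⟨ +-congˡ (+-comm _ _) ⟩
      (x * z + - (x * w)) + (y * w + - (y * z)) ≈⟨ interchange _ _ _ _ ⟩
      (x * z + y * w) + (- (x * w) + - (y * z)) ≈⟨ +-congˡ (-‿+-comm _ _) ⟩
      (x * z + y * w) - (x * w + y * z)        ∎
      where
      neg² : - y * - w ≈ y * w
      neg² = trans (sym (-‿distribˡ-* y (- w)))
        (trans (-‿cong (sym (-‿distribʳ-* y w))) (-‿involutive _))

    homomorphism : differences -Raw-AlmostCommutative⟶ fromCommutativeRing R
    homomorphism = record
      { ⟦_⟧    = ⟦_⟧
      ; +-homo = λ x@(a , b) y@(c , d) → begin
          ⟦ reduce (a ℕ.+ c , b ℕ.+ d) ⟧ ≈⟨ reduce-correct (a ℕ.+ c , b ℕ.+ d) ⟩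
          ⌊ a ℕ.+ c ⌋ - ⌊ b ℕ.+ d ⌋
            ≈⟨ +-cong (×-homo-+ 1# a c) (trans (-‿cong (×-homo-+ 1# b d)) (sym (-‿+-comm _ _))) ⟩
          (⌊ a ⌋ + ⌊ c ⌋) + (- ⌊ b ⌋ + - ⌊ d ⌋) ≈⟨ interchange _ _ _ _ ⟩
          difference x + difference y ≈⟨ +-cong (⟦⟧≈difference x) (⟦⟧≈difference y) ⟨
          ⟦ x ⟧ + ⟦ y ⟧ ∎
      ; *-homo = λ x@(a , b) y@(c , d) → begin
          ⟦ reduce (a ℕ.* c ℕ.+ b ℕ.* d , a ℕ.* d ℕ.+ b ℕ.* c) ⟧
            ≈⟨ reduce-correct (a ℕ.* c ℕ.+ b ℕ.* d , a ℕ.* d ℕ.+ b ℕ.* c) ⟩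
          ⌊ a ℕ.* c ℕ.+ b ℕ.* d ⌋ - ⌊ a ℕ.* d ℕ.+ b ℕ.* c ⌋
            ≈⟨ +-cong (products a c b d) (-‿cong (products a d b c)) ⟩
          (⌊ a ⌋ * ⌊ c ⌋ + ⌊ b ⌋ * ⌊ d ⌋) - (⌊ a ⌋ * ⌊ d ⌋ + ⌊ b ⌋ * ⌊ c ⌋)
            ≈⟨ product _ _ _ _ ⟨
          difference x * difference y ≈⟨ *-cong (⟦⟧≈difference x) (⟦⟧≈difference y) ⟨
          ⟦ x ⟧ * ⟦ y ⟧ ∎
      ; -‿homo = λ x@(a , b) → begin
          ⟦ b , a ⟧               ≈⟨ ⟦⟧≈difference (b , a) ⟩
          ⌊ b ⌋ - ⌊ a ⌋           ≈⟨ +-congʳ (-‿involutive _) ⟨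
          - - ⌊ b ⌋ + - ⌊ a ⌋     ≈⟨ +-comm _ _ ⟩
          - ⌊ a ⌋ + - - ⌊ b ⌋     ≈⟨ -‿+-comm _ _ ⟩
          - difference x          ≈⟨ -‿cong (⟦⟧≈difference x) ⟨
          - ⟦ x ⟧ ∎
      ; 0-homo = refl
      ; 1-homo = refl
      }
      where
      products : ∀ a c b d → ⌊ a ℕ.* c ℕ.+ b ℕ.* d ⌋ ≈ ⌊ a ⌋ * ⌊ c ⌋ + ⌊ b ⌋ * ⌊ d ⌋
      products a c b d = trans (×-homo-+ 1# (a ℕ.* c) (b ℕ.* d)) (+-cong (×1-homo-* a c) (×1-homo-* b d))

    equal? : ∀ x y → Maybe (⟦ x ⟧ ≈ ⟦ y ⟧)
    equal? x@(a , b) y@(c , d) with a ℕ.+ d ℕ.≟ c ℕ.+ b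
    ... | no _   = nothing
    ... | yes ad = just (begin
      ⟦ x ⟧                               ≈⟨ ⟦⟧≈difference x ⟩
      ⌊ a ⌋ - ⌊ b ⌋                       ≈⟨ shift a b d ⟩
      ⌊ a ℕ.+ d ⌋ - (⌊ b ⌋ + ⌊ d ⌋)       ≈⟨ +-cong (×-congˡ ad) (-‿cong (+-comm _ _)) ⟩
      ⌊ c ℕ.+ b ⌋ - (⌊ d ⌋ + ⌊ b ⌋)       ≈⟨ shift c d b ⟨
      ⌊ c ⌋ - ⌊ d ⌋                       ≈⟨ ⟦⟧≈difference y ⟨
      ⟦ y ⟧                               ∎)
      where
      shift : ∀ a b d → ⌊ a ⌋ - ⌊ b ⌋ ≈ ⌊ a ℕ.+ d ⌋ - (⌊ b ⌋ + ⌊ d ⌋)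
      shift a b d = begin
        ⌊ a ⌋ - ⌊ b ⌋                           ≈⟨ +-identityʳ _ ⟨
        (⌊ a ⌋ - ⌊ b ⌋) + 0#                    ≈⟨ +-congˡ (-‿inverseʳ ⌊ d ⌋) ⟨
        (⌊ a ⌋ - ⌊ b ⌋) + (⌊ d ⌋ - ⌊ d ⌋)       ≈⟨ interchange _ _ _ _ ⟩
        (⌊ a ⌋ + ⌊ d ⌋) + (- ⌊ b ⌋ + - ⌊ d ⌋)   ≈⟨ +-cong (sym (×-homo-+ 1# a d)) (-‿+-comm _ _) ⟩
        ⌊ a ℕ.+ d ⌋ - (⌊ b ⌋ + ⌊ d ⌋)           ∎

  open import Algebra.Solver.Ring differences (fromCommutativeRing R) homomorphism equal? public
    using (solve; _:=_; _:+_; _:*_; _:-_; :-_; con; Polynomial)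

  :0 :1 : ∀ {n} → Polynomial n
  :0 = con (0 , 0)
  :1 = con (1 , 0)

-- Finite sums and products

-- Big operators by recursion on n rather than as a fold: then ∑ f ≟ ∑ g is
-- solved by unification, which the fold of the standard library prevents.
module BigOperator {a ℓ} (M : CommutativeMonoid a ℓ) where

  import Algebra.Properties.CommutativeMonoid.Sum as Sum
  open import Data.Fin.Base using (Fin; zero; suc; punchIn)
  open import Data.Fin.Permutation using (Permutation; _⟨$⟩ʳ_)
  open import Data.Nat.Base using (zero; suc)

  open CommutativeMonoid M
  private module M = Sum M
  open import Relation.Binary.Reasoning.Setoid setoid

  big : ∀ n → (Fin n → Carrier) → Carrier
  big zero    f = ε
  big (suc n) f = f zero ∙ big n (λ i → f (suc i))

  big≡sum : ∀ n f → big n f ≡ M.sum f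
  big≡sum zero    f = ≡.refl
  big≡sum (suc n) f = ≡.cong (f zero ∙_) (big≡sum n _)

  big-cong : ∀ n {f g} → (∀ i → f i ≈ g i) → big n f ≈ big n g
  big-cong zero    fg = refl
  big-cong (suc n) fg = ∙-cong (fg zero) (big-cong n (λ i → fg (suc i)))

  big-ε : ∀ n {f} → (∀ i → f i ≈ ε) → big n f ≈ ε
  big-ε zero    f≈ε = refl
  big-ε (suc n) f≈ε = trans (∙-cong (f≈ε zero) (big-ε n (λ i → f≈ε (suc i)))) (identityˡ ε)

  big-∙ : ∀ n f g → big n (λ i → f i ∙ g i) ≈ big n f ∙ big n g
  big-∙ n f g = begin
    big n (λ i → f i ∙ g i)   ≡⟨ big≡sum n _ ⟩
    M.sum (λ i → f i ∙ g i)   ≈⟨ M.∑-distrib-+ f g ⟩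
    M.sum f ∙ M.sum g         ≡⟨ ≡.cong₂ _∙_ (big≡sum n f) (big≡sum n g) ⟨
    big n f ∙ big n g         ∎

  big-comm : ∀ m n (f : Fin m → Fin n → Carrier) →
    big m (λ i → big n (f i)) ≈ big n (λ j → big m (λ i → f i j))
  big-comm zero    n f = sym (big-ε n (λ _ → refl))
  big-comm (suc m) n f = trans (∙-congˡ (big-comm m n _)) (sym (big-∙ n _ _))

  big-permute : ∀ n f (π : Permutation n n) → big n f ≈ big n (λ i → f (π ⟨$⟩ʳ i))
  big-permute n f π = begin
    big n f                    ≡⟨ big≡sum n f ⟩
    M.sum f                    ≈⟨ M.sum-permute f π ⟩
    M.sum (λ i → f (π ⟨$⟩ʳ i)) ≡⟨ big≡sum n _ ⟨
    big n (λ i → f (π ⟨$⟩ʳ i)) ∎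

  big-remove : ∀ n i f → big (suc n) f ≈ f i ∙ big n (λ j → f (punchIn i j))
  big-remove n i f = begin
    big (suc n) f                            ≡⟨ big≡sum (suc n) f ⟩
    M.sum f                                  ≈⟨ M.sum-remove {i = i} f ⟩
    f i ∙ M.sum (λ j → f (punchIn i j))      ≡⟨ ≡.cong (f i ∙_) (big≡sum n _) ⟨
    f i ∙ big n (λ j → f (punchIn i j))      ∎

module Sums {c ℓ} (R : CommutativeRing c ℓ) where

  import Algebra.Properties.Semiring.Mult as Mult
  import Algebra.Properties.CommutativeSemiring.Exp as Exp
  open import Data.Bool.Base using (if_then_else_)
  open import Data.Fin.Base using (Fin; zero; suc; toℕ; punchIn)
  import Data.Fin.Properties as Fin
  import Data.Nat.Base as ℕ
  open ℕ using (ℕ; zero; suc)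
  open import Data.Vec.Base using (Vec; []; _∷_; lookup)
  import Data.Nat.Properties as ℕ
  open import Relation.Nullary using (Dec; does; yes; no; ¬_; contradiction)

  open CommutativeRing R hiding (zero)
  open Mult semiring public using (_×_; ×-homo-+; ×1-homo-*; ×-congˡ; ×-congʳ; ×-assocˡ; ×-comm-*; ×-assoc-*)
  open Exp commutativeSemiring public using (_^_; ^-congˡ; ^-congʳ; ^-homo-*; ^-assocʳ; ^-distrib-*)
  open import Algebra.Properties.CommutativeSemigroup +-commutativeSemigroup using (x∙yz≈y∙xz)
  open import Relation.Binary.Reasoning.Setoid setoid

  open BigOperator +-commutativeMonoid public renaming
    ( big to ∑; big≡sum to ∑≡sum; big-cong to ∑-cong; big-ε to ∑-zero; big-∙ to ∑-+
    ; big-comm to ∑-comm; big-permute to ∑-permute; big-remove to ∑-remove)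

  open BigOperator *-commutativeMonoid public renaming
    ( big to ∏; big≡sum to ∏≡product; big-cong to ∏-cong; big-ε to ∏-one; big-∙ to ∏-*
    ; big-comm to ∏-comm; big-permute to ∏-permute; big-remove to ∏-remove)

  ∑-*ˡ : ∀ n x f → x * ∑ n f ≈ ∑ n (λ i → x * f i)
  ∑-*ˡ zero    x f = zeroʳ x
  ∑-*ˡ (suc n) x f = trans (distribˡ x _ _) (+-congˡ (∑-*ˡ n x _))

  ∑-*ʳ : ∀ n f x → ∑ n f * x ≈ ∑ n (λ i → f i * x)
  ∑-*ʳ zero    f x = zeroˡ x
  ∑-*ʳ (suc n) f x = trans (distribʳ x _ _) (+-congˡ (∑-*ʳ n _ x))

  ∑-const : ∀ n x → ∑ n (λ _ → x) ≈ n × x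
  ∑-const zero    x = refl
  ∑-const (suc n) x = +-congˡ (∑-const n x)

  ∏-const : ∀ n x → ∏ n (λ _ → x) ≈ x ^ n
  ∏-const zero    x = refl
  ∏-const (suc n) x = *-congˡ (∏-const n x)

  ∑-rotate : ∀ n (f : ℕ → Carrier) → f 0 + ∑ n (λ i → f (suc (toℕ i))) ≈ f n + ∑ n (λ i → f (toℕ i))
  ∑-rotate zero    f = refl
  ∑-rotate (suc n) f = begin
    f 0 + (f 1 + ∑ n (λ i → f (suc (suc (toℕ i)))))   ≈⟨ +-congˡ (∑-rotate n (λ i → f (suc i))) ⟩
    f 0 + (f (suc n) + ∑ n (λ i → f (suc (toℕ i))))   ≈⟨ x∙yz≈y∙xz (f 0) _ _ ⟩
    f (suc n) + (f 0 + ∑ n (λ i → f (suc (toℕ i))))   ∎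

  1^ : ∀ n → 1# ^ n ≈ 1#
  1^ zero    = refl
  1^ (suc n) = trans (*-identityˡ _) (1^ n)

  0^ : ∀ n → .{{ℕ.NonZero n}} → 0# ^ n ≈ 0#
  0^ (suc n) = zeroˡ _

  ∏-^ : ∀ n f k → ∏ n f ^ k ≈ ∏ n (λ i → f i ^ k)
  ∏-^ zero    f k = 1^ k
  ∏-^ (suc n) f k = trans (^-distrib-* _ _ k) (*-congˡ (∏-^ n _ k))

  ∏-zero : ∀ n {f} i → f i ≈ 0# → ∏ n f ≈ 0#
  ∏-zero (suc n) zero    fi≈0 = trans (*-congʳ fi≈0) (zeroˡ _)
  ∏-zero (suc n) (suc i) fi≈0 = trans (*-congˡ (∏-zero n i fi≈0)) (zeroʳ _)

  [_] : ∀ {a} {A : Set a} → Dec A → Carrier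
  [ A? ] = if does A? then 1# else 0#

  [_]-yes : ∀ {a} {A : Set a} (A? : Dec A) → A → [ A? ] ≈ 1#
  [ yes _ ]-yes _ = refl
  [ no ¬a ]-yes a = contradiction a ¬a

  [_]-no : ∀ {a} {A : Set a} (A? : Dec A) → ¬ A → [ A? ] ≈ 0#
  [ yes a ]-no ¬a = contradiction a ¬a
  [ no _ ]-no  _  = refl

  indicator-cong : ∀ {a b} {A : Set a} {B : Set b} (A? : Dec A) (B? : Dec B) → (A → B) → (B → A) → [ A? ] ≈ [ B? ]
  indicator-cong (yes a) B? A⇒B B⇒A = sym ([ B? ]-yes (A⇒B a))
  indicator-cong (no ¬a) B? A⇒B B⇒A = sym ([ B? ]-no (λ b → ¬a (B⇒A b)))

  ∑-δ : ∀ n j (f : Fin n → Carrier) → ∑ n (λ i → [ i Fin.≟ j ] * f i) ≈ f j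
  ∑-δ (suc n) j f = begin
    ∑ (suc n) (λ i → [ i Fin.≟ j ] * f i)  ≈⟨ ∑-remove n j (λ i → [ i Fin.≟ j ] * f i) ⟩
    [ j Fin.≟ j ] * f j + ∑ n rest
      ≈⟨ +-cong (*-congʳ ([ j Fin.≟ j ]-yes ≡.refl)) (∑-zero n rest≈0) ⟩
    1# * f j + 0#                          ≈⟨ trans (+-identityʳ _) (*-identityˡ _) ⟩
    f j                                    ∎
    where
    rest : Fin n → Carrier
    rest i = [ punchIn j i Fin.≟ j ] * f (punchIn j i)

    rest≈0 : ∀ i → rest i ≈ 0#
    rest≈0 i = trans (*-congʳ ([ punchIn j i Fin.≟ j ]-no (Fin.punchInᵢ≢i j i))) (zeroˡ _)

  module _ {a} {A : Set a} n (g : Fin n → A) where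

    ∑ᵛ : ∀ k → (Vec A k → Carrier) → Carrier
    ∑ᵛ zero    f = f []
    ∑ᵛ (suc k) f = ∑ n (λ i → ∑ᵛ k (λ v → f (g i ∷ v)))

    ∑ᵛ-cong : ∀ k {f h : Vec A k → Carrier} → (∀ v → f v ≈ h v) → ∑ᵛ k f ≈ ∑ᵛ k h
    ∑ᵛ-cong zero    fh = fh []
    ∑ᵛ-cong (suc k) fh = ∑-cong n (λ i → ∑ᵛ-cong k (λ v → fh (g i ∷ v)))

    ∑ᵛ-*ˡ : ∀ k x (f : Vec A k → Carrier) → x * ∑ᵛ k f ≈ ∑ᵛ k (λ v → x * f v)
    ∑ᵛ-*ˡ zero    x f = refl
    ∑ᵛ-*ˡ (suc k) x f = trans (∑-*ˡ n x _) (∑-cong n (λ i → ∑ᵛ-*ˡ k x _))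

    ∑ᵛ-∑ : ∀ k m (f : Vec A k → Fin m → Carrier) →
      ∑ᵛ k (λ v → ∑ m (f v)) ≈ ∑ m (λ j → ∑ᵛ k (λ v → f v j))
    ∑ᵛ-∑ zero    m f = refl
    ∑ᵛ-∑ (suc k) m f = trans (∑-cong n (λ i → ∑ᵛ-∑ k m _)) (∑-comm n m _)

    ∑ᵛ-∏ : ∀ k (h : Fin k → A → Carrier) →
      ∑ᵛ k (λ v → ∏ k (λ i → h i (lookup v i))) ≈ ∏ k (λ i → ∑ n (λ j → h i (g j)))
    ∑ᵛ-∏ zero    h = refl
    ∑ᵛ-∏ (suc k) h = begin
      ∑ n (λ j → ∑ᵛ k (λ v → h zero (g j) * ∏ k (λ i → h (suc i) (lookup v i))))
        ≈⟨ ∑-cong n (λ j → sym (∑ᵛ-*ˡ k (h zero (g j)) _)) ⟩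
      ∑ n (λ j → h zero (g j) * ∑ᵛ k (λ v → ∏ k (λ i → h (suc i) (lookup v i))))
        ≈⟨ ∑-*ʳ n _ _ ⟨
      ∑ n (λ j → h zero (g j)) * ∑ᵛ k (λ v → ∏ k (λ i → h (suc i) (lookup v i)))
        ≈⟨ *-congˡ (∑ᵛ-∏ k (λ i → h (suc i))) ⟩
      ∏ (suc k) (λ i → ∑ n (λ j → h i (g j))) ∎

  ∑ᵛ-comm : ∀ {a b} {A : Set a} {B : Set b} n (g : Fin n → A) m (h : Fin m → B) k l
    (f : Vec A k → Vec B l → Carrier) →
    ∑ᵛ n g k (λ v → ∑ᵛ m h l (f v)) ≈ ∑ᵛ m h l (λ w → ∑ᵛ n g k (λ v → f v w))
  ∑ᵛ-comm n g m h k zero    f = refl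
  ∑ᵛ-comm n g m h k (suc l) f =
    trans (∑ᵛ-∑ n g k m _) (∑-cong m (λ j → ∑ᵛ-comm n g m h k l _))

-- Binomial expansion with a prime exponent

module PrimeBinomial where

  open import Algebra.Bundles using (CommutativeRing)
  import Algebra.Properties.CommutativeSemiring.Binomial as Binomial
  open import Data.Fin.Base using (Fin; zero; suc; toℕ; fromℕ)
  open import Data.Fin.Properties using (toℕ-fromℕ)
  import Data.Nat.Base as ℕ
  open ℕ using (ℕ; zero; suc; _∸_; _!; _<_; s≤s; z<s)
  open import Data.Nat.Combinatorics using (_C_; nCk≡n!/k![n-k]!; [n∸k]!k!∣n!; nC1≡n; nCn≡1)
  open import Data.Nat.Divisibility using (_∣_; _∤_; divides; m∣m*n; ∣⇒≤)
  open import Data.Nat.DivMod using (m/n*n≡m)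
  open import Data.Nat.Primality using (Prime; euclidsLemma; prime⇒nonTrivial)
  import Data.Nat.Properties as ℕ
  open import Data.Product.Base using (∃; _,_; proj₁; proj₂)
  open import Data.Sum.Base using (inj₁; inj₂)

  prime∤! : ∀ {p} → Prime p → ∀ k → k < p → p ∤ k !
  prime∤! pr zero    k<p p∣1 = ℕ.<⇒≱ (ℕ.nonTrivial⇒n>1 _ {{prime⇒nonTrivial pr}}) (∣⇒≤ p∣1)
  prime∤! pr (suc k) k<p p∣k! with euclidsLemma (suc k) (k !) pr p∣k!
  ... | inj₁ p∣1+k = ℕ.<⇒≱ k<p (∣⇒≤ p∣1+k)
  ... | inj₂ p∣k!′ = prime∤! pr k (ℕ.<-trans (ℕ.n<1+n k) k<p) p∣k!′

  prime∣C : ∀ {p k} → Prime p → 0 < k → k < p → p ∣ p C k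
  prime∣C {p@(suc p-1)} {k@(suc k-1)} pr _ k<p
    with euclidsLemma (p C k) _ pr (≡.subst (p ∣_) (≡.sym p!≡) (m∣m*n (p-1 !)))
    where
    instance _ = (k ℕ.!* (p ∸ k) !≢0)
    p!≡ : (p C k) ℕ.* (k ! ℕ.* (p ∸ k) !) ≡ p !
    p!≡ = ≡.trans (≡.cong (ℕ._* (k ! ℕ.* (p ∸ k) !)) (nCk≡n!/k![n-k]! (ℕ.<⇒≤ k<p)))
      (m/n*n≡m (≡.subst (_∣ p !) (ℕ.*-comm ((p ∸ k) !) (k !)) ([n∸k]!k!∣n! (ℕ.<⇒≤ k<p))))
  ... | inj₁ p∣C = p∣C
  ... | inj₂ p∣k![p-k]! with euclidsLemma (k !) ((p ∸ k) !) pr p∣k![p-k]!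
  ...   | inj₁ p∣k!     = contradiction p∣k! (prime∤! pr k k<p)
  ...   | inj₂ p∣[p-k]! = contradiction p∣[p-k]! (prime∤! pr (p ∸ k) (s≤s (ℕ.m∸n≤m p-1 k-1)))

  module _ {c ℓ} (R : CommutativeRing c ℓ) where

    open CommutativeRing R hiding (zero)
    open Sums R
    open Binomial commutativeSemiring using (binomialExpansion; binomialTerm; theorem)
    open Solver R
    open import Relation.Binary.Reasoning.Setoid setoid

    ×1-* : ∀ n x → n × x ≈ (n × 1#) * x
    ×1-* n x = sym (trans (×-assoc-* n 1# x) (×-congʳ n (*-identityˡ x)))

    private
      -- Collects the middle binomial terms, all divisible by d y = p x², into a single multiple.
      all-but-last : ∀ (d y : Carrier) n (g : Fin (suc n) → Carrier) →
        (∀ i → toℕ i < n → ∃ λ c → g i ≈ d * (y * c)) →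
        ∃ λ c → ∑ (suc n) g ≈ d * (y * c) + g (fromℕ n)
      all-but-last d y zero    g _ = 0# ,
        solve 3 (λ d y z → z :+ :0 := d :* (y :* :0) :+ z) refl d y (g zero)
      all-but-last d y (suc n) g multiple
        with multiple zero z<s | all-but-last d y n (λ i → g (suc i)) (λ i i<n → multiple (suc i) (s≤s i<n))
      ... | c₀ , g₀≈ | c , rest≈ = c₀ + c , trans (+-cong g₀≈ rest≈)
        (solve 5 (λ d y c₀ c z → d :* (y :* c₀) :+ (d :* (y :* c) :+ z) := d :* (y :* (c₀ :+ c)) :+ z)
          refl d y c₀ c _)

    opaque
      -- The linear term is split off with coefficient exactly p: for x = π and (1 + π)^p = 1,
      -- cancelling π leaves p times 1 + π c, which has residue 1. In characteristic p the whole
      -- middle part vanishes, which gives additivity of the Frobenius map.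
      prime-binomial : ∀ {p} → Prime p → ∀ x →
        ∃ λ c → (x + 1#) ^ p ≈ 1# + (p × 1#) * (x + x * x * c) + x ^ p
      prime-binomial {0} pr = contradiction (prime⇒nonTrivial pr) λ ()
      prime-binomial {1} pr = contradiction (prime⇒nonTrivial pr) λ ()
      prime-binomial {p@(suc (suc n))} pr x = cofactor , (begin
        (x + 1#) ^ p                            ≈⟨ theorem p x 1# ⟩
        binomialExpansion x 1# p                ≡⟨ ∑≡sum (suc p) (binomialTerm x 1# p) ⟨
        ∑ (suc p) (binomialTerm x 1# p)         ≈⟨ ∑-cong (suc p) term≈ ⟩
        ∑ (suc p) term                          ≈⟨ +-cong (*-congʳ (+-identityʳ 1#))
                                                     (+-cong (*-cong (×-congˡ (nC1≡n p)) (*-identityʳ x)) rest≈) ⟩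
        1# * 1# + ((p × 1#) * x + ((p × 1#) * (x * x * cofactor) + term (suc (suc (fromℕ n)))))
                                                ≈⟨ +-congˡ (+-congˡ (+-congˡ last≈)) ⟩
        1# * 1# + ((p × 1#) * x + ((p × 1#) * (x * x * cofactor) + x ^ p))
          ≈⟨ solve 4 (λ P x c z → :1 :* :1 :+ (P :* x :+ (P :* (x :* x :* c) :+ z)) := :1 :+ P :* (x :+ x :* x :* c) :+ z)
               refl (p × 1#) x cofactor (x ^ p) ⟩
        1# + (p × 1#) * (x + x * x * cofactor) + x ^ p ∎)
        where
        term : Fin (suc p) → Carrier
        term k = ((p C toℕ k) × 1#) * x ^ toℕ k

        term≈ : ∀ k → binomialTerm x 1# p k ≈ term k
        term≈ k = trans (×-congʳ (p C toℕ k) (trans (*-congˡ (1^ (p ∸ toℕ k))) (*-identityʳ _))) (×1-* (p C toℕ k) _)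

        multiple : ∀ i → toℕ i < n → ∃ λ c → term (suc (suc i)) ≈ (p × 1#) * (x * x * c)
        multiple i i<n with prime∣C {p} {suc (suc (toℕ i))} pr z<s (s≤s (s≤s i<n))
        ... | divides d pC≡ = (d × 1#) * x ^ toℕ i , (begin
          ((p C suc (suc (toℕ i))) × 1#) * (x * (x * x ^ toℕ i))
            ≈⟨ *-congʳ (trans (×-congˡ pC≡) (×1-homo-* d p)) ⟩
          ((d × 1#) * (p × 1#)) * (x * (x * x ^ toℕ i))
            ≈⟨ solve 4 (λ d p x y → (d :* p) :* (x :* (x :* y)) := p :* (x :* x :* (d :* y))) refl _ _ x _ ⟩
          (p × 1#) * (x * x * ((d × 1#) * x ^ toℕ i)) ∎)

        rest : ∃ λ c → ∑ (suc n) (λ i → term (suc (suc i))) ≈ (p × 1#) * (x * x * c) + term (suc (suc (fromℕ n)))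
        rest = all-but-last (p × 1#) (x * x) n (λ i → term (suc (suc i))) multiple
        cofactor : Carrier
        cofactor = proj₁ rest

        rest≈ : ∑ (suc n) (λ i → term (suc (suc i))) ≈ (p × 1#) * (x * x * cofactor) + term (suc (suc (fromℕ n)))
        rest≈ = proj₂ rest

        last≈ : term (suc (suc (fromℕ n))) ≈ x ^ p
        last≈ rewrite toℕ-fromℕ n = trans (*-congʳ (trans (×-congˡ (nCn≡1 p)) (+-identityʳ 1#))) (*-identityˡ _)

-- Sums and products over a finite field

module FieldSum {c ℓ c′ ℓ′} {n} (F : FiniteField n c ℓ) (R : CommutativeRing c′ ℓ′) where

  open import Data.Fin.Base using (Fin)
  import Data.Fin.Properties as Fin
  open import Data.Fin.Permutation using (Permutation; permutation)
  open import Function.Bundles using (Inverse)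

  private module F = FiniteField F
  open F using () renaming (Carrier to K; _≈_ to _∼_; _≟_ to _≟K_)
  open Inverse F.enumeration using (to; from; to-cong; strictlyInverseˡ; strictlyInverseʳ)
  open CommutativeRing R hiding (zero)
  open Sums R
  open import Relation.Binary.Reasoning.Setoid setoid

  Respects : (K → Carrier) → Set _
  Respects f = ∀ {x y} → x ∼ y → f x ≈ f y

  -- Opaque, so that unification treats ∑F as injective even when n is a successor.
  opaque
    ∑F : (K → Carrier) → Carrier
    ∑F f = ∑ n (λ i → f (from i))

    ∑F-cong : ∀ {f g : K → Carrier} → (∀ x → f x ≈ g x) → ∑F f ≈ ∑F g
    ∑F-cong fg = ∑-cong n (λ i → fg (from i))

    ∑F-+ : ∀ f g → ∑F (λ x → f x + g x) ≈ ∑F f + ∑F g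
    ∑F-+ f g = ∑-+ n (λ i → f (from i)) (λ i → g (from i))

    ∑F-*ˡ : ∀ a f → a * ∑F f ≈ ∑F (λ x → a * f x)
    ∑F-*ˡ a f = ∑-*ˡ n a (λ i → f (from i))

    ∑F-*ʳ : ∀ f a → ∑F f * a ≈ ∑F (λ x → f x * a)
    ∑F-*ʳ f a = ∑-*ʳ n (λ i → f (from i)) a

    ∑F-const : ∀ a → ∑F (λ _ → a) ≈ n × a
    ∑F-const a = ∑-const n a

    ∑F-zero : ∀ {f} → (∀ x → f x ≈ 0#) → ∑F f ≈ 0#
    ∑F-zero f≈0 = ∑-zero n (λ i → f≈0 (from i))

    ∑F-comm : ∀ (f : K → K → Carrier) → ∑F (λ x → ∑F (f x)) ≈ ∑F (λ y → ∑F (λ x → f x y))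
    ∑F-comm f = ∑-comm n n (λ i j → f (from i) (from j))

    ∑F-∑ : ∀ m (f : K → Fin m → Carrier) → ∑F (λ x → ∑ m (f x)) ≈ ∑ m (λ j → ∑F (λ x → f x j))
    ∑F-∑ m f = ∑-comm n m (λ i j → f (from i) j)

    ∏F : (K → Carrier) → Carrier
    ∏F f = ∏ n (λ i → f (from i))

    ∏F-cong : ∀ {f g : K → Carrier} → (∀ x → f x ≈ g x) → ∏F f ≈ ∏F g
    ∏F-cong fg = ∏-cong n (λ i → fg (from i))

    ∏F-* : ∀ f g → ∏F (λ x → f x * g x) ≈ ∏F f * ∏F g
    ∏F-* f g = ∏-* n (λ i → f (from i)) (λ i → g (from i))

    ∑F≈∑ : ∀ f → ∑F f ≈ ∑ n (λ i → f (from i))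
    ∑F≈∑ f = refl

    ∏F≈∏ : ∀ f → ∏F f ≈ ∏ n (λ i → f (from i))
    ∏F≈∏ f = refl

  module _ (σ τ : K → K) (σ-cong : ∀ {x y} → x ∼ y → σ x ∼ σ y) (τ-cong : ∀ {x y} → x ∼ y → τ x ∼ τ y)
    (σ∘τ : ∀ x → σ (τ x) ∼ x) (τ∘σ : ∀ x → τ (σ x) ∼ x) where

    private
      π : Permutation n n
      π = permutation (λ i → to (σ (from i))) (λ i → to (τ (from i)))
        (λ i → ≡.trans (to-cong (F.trans (σ-cong (strictlyInverseʳ _)) (σ∘τ _))) (strictlyInverseˡ i))
        (λ i → ≡.trans (to-cong (F.trans (τ-cong (strictlyInverseʳ _)) (τ∘σ _))) (strictlyInverseˡ i))

    ∑F-permute : ∀ f → Respects f → ∑F f ≈ ∑F (λ x → f (σ x))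
    ∑F-permute f f-cong = trans (∑F≈∑ f) (trans (trans (∑-permute n _ π) (∑-cong n (λ i → f-cong (strictlyInverseʳ _)))) (sym (∑F≈∑ _)))

    ∏F-permute : ∀ f → Respects f → ∏F f ≈ ∏F (λ x → f (σ x))
    ∏F-permute f f-cong = trans (∏F≈∏ f) (trans (trans (∏-permute n _ π) (∏-cong n (λ i → f-cong (strictlyInverseʳ _)))) (sym (∏F≈∏ _)))

  ∑F-δ : ∀ a f → Respects f → ∑F (λ x → [ x ≟K a ] * f x) ≈ f a
  ∑F-δ a f f-cong = begin
    ∑F (λ x → [ x ≟K a ] * f x)                         ≈⟨ trans (∑F≈∑ _) (∑-cong n (λ i → *-congʳ (indicator i))) ⟩
    ∑ n (λ i → [ i Fin.≟ to a ] * f (from i))           ≈⟨ ∑-δ n (to a) (λ i → f (from i)) ⟩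
    f (from (to a))                                     ≈⟨ f-cong (strictlyInverseʳ a) ⟩
    f a                                                 ∎
    where
    indicator : ∀ i → [ from i ≟K a ] ≈ [ i Fin.≟ to a ]
    indicator i = indicator-cong (from i ≟K a) (i Fin.≟ to a)
      (λ fi≈a → ≡.trans (≡.sym (strictlyInverseˡ i)) (to-cong fi≈a))
      (λ i≡a → F.trans (F.reflexive (≡.cong from i≡a)) (strictlyInverseʳ a))

-- Finite fields: Fermat's theorem, inverses, bounds on roots

module FieldTheory {c ℓ M} (F : FiniteField (ℕ.suc M) c ℓ) where

  import Algebra.Properties.Group as Group
  open import Data.Fin.Base using (Fin; zero; suc; punchIn)
  import Data.Fin.Properties as Fin
  open import Data.List.Base using (List; []; _∷_; length; replicate)
  open import Data.List.Properties using (length-replicate)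
  open ℕ using (ℕ; zero; suc; NonZero; _∸_; _<_; _≤_; z≤n; s≤s; z<s)
  open import Data.Nat.Divisibility using (_∣_; m%n≡0⇒n∣m)
  open import Data.Nat.DivMod using (_%_; _/_; m≡m%n+[m/n]*n; m%n<n)
  import Data.Nat.Properties as ℕ
  open import Data.Product.Base using (∃; _,_) renaming (_×_ to _∧_)
  open import Function.Bundles using (Inverse)

  open FiniteField F hiding (zero)
  open Inverse enumeration using (to; from; to-cong; strictlyInverseʳ; strictlyInverseˡ)
  open Sums commutativeRing
  open FieldSum F commutativeRing
  open Solver commutativeRing
  open import Algebra.Properties.Ring ring using (x[y-z]≈xy-xz)
  open Group +-group using (x∙y⁻¹≈ε⇒x≈y) renaming (∙-cancelˡ to +-cancelˡ)
  open import Relation.Binary.Reasoning.Setoid (CommutativeRing.setoid commutativeRing)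

  Q : ℕ
  Q = suc M

  no-zero-divisors : ∀ {x y} → x * y ≈ 0# → x ≉ 0# → y ≈ 0#
  no-zero-divisors {x} {y} xy≈0 x≉0 with inverse x x≉0
  ... | x⁻¹ , xx⁻¹≈1 = begin
    y               ≈⟨ *-identityˡ y ⟨
    1# * y          ≈⟨ *-congʳ xx⁻¹≈1 ⟨
    x * x⁻¹ * y     ≈⟨ solve 3 (λ x z y → x :* z :* y := z :* (x :* y)) refl x x⁻¹ y ⟩
    x⁻¹ * (x * y)   ≈⟨ *-congˡ xy≈0 ⟩
    x⁻¹ * 0#        ≈⟨ zeroʳ x⁻¹ ⟩
    0#              ∎

  *-≉0 : ∀ {x y} → x ≉ 0# → y ≉ 0# → x * y ≉ 0#
  *-≉0 x≉0 y≉0 xy≈0 = y≉0 (no-zero-divisors xy≈0 x≉0)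

  ^-≉0 : ∀ {x} n → x ≉ 0# → x ^ n ≉ 0#
  ^-≉0 zero    x≉0 = 1≉0
  ^-≉0 (suc n) x≉0 = *-≉0 x≉0 (^-≉0 n x≉0)

  -≉0 : ∀ {x} → x ≉ 0# → - x ≉ 0#
  -≉0 {x} x≉0 -x≈0 = x≉0 (trans (solve 1 (λ x → x := :- (:- x)) refl x) (trans (-‿cong -x≈0) (solve 0 (:- :0 := :0) refl)))

  *-cancelˡ : ∀ {x y z} → x ≉ 0# → x * y ≈ x * z → y ≈ z
  *-cancelˡ {x} {y} {z} x≉0 xy≈xz = x∙y⁻¹≈ε⇒x≈y y z (no-zero-divisors
    (trans (x[y-z]≈xy-xz x y z) (trans (+-congʳ xy≈xz) (-‿inverseʳ _))) x≉0)

  0<M : 0 < M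
  0<M = positive (to 1#) (to 0#) λ eq →
    1≉0 (trans (sym (strictlyInverseʳ 1#)) (trans (reflexive (≡.cong from eq)) (strictlyInverseʳ 0#)))
    where
    positive : ∀ {M} (i j : Fin (suc M)) → ¬ i ≡ j → 0 < M
    positive {zero}  zero zero i≢j = contradiction ≡.refl i≢j
    positive {suc _} _    _    _   = z<s

  instance
    M≢0 : NonZero M
    M≢0 = ℕ.>-nonZero 0<M

  -- Translating the summation variable by 1 does not change the sum of all elements.
  Q×1≈0 : Q × 1# ≈ 0#
  Q×1≈0 = +-cancelˡ (∑F (λ x → x)) _ _ (begin
    ∑F (λ x → x) + Q × 1#               ≈⟨ +-congˡ (∑F-const 1#) ⟨
    ∑F (λ x → x) + ∑F (λ _ → 1#)        ≈⟨ ∑F-+ (λ x → x) (λ _ → 1#) ⟨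
    ∑F (λ x → x + 1#)                   ≈⟨ ∑F-permute (_+ 1#) (_- 1#) +-congʳ +-congʳ
                                             (solve 1 (λ x → x :- :1 :+ :1 := x) refl)
                                             (solve 1 (λ x → x :+ :1 :- :1 := x) refl) (λ x → x) (λ x≈y → x≈y) ⟨
    ∑F (λ x → x)                        ≈⟨ +-identityʳ _ ⟨
    ∑F (λ x → x) + 0#                   ∎)

  M×1≈-1 : M × 1# ≈ - 1#
  M×1≈-1 = +-cancelˡ 1# _ _ (trans Q×1≈0 (sym (-‿inverseʳ 1#)))

  inverse-cancels : ∀ {a b} → a * b ≈ 1# → ∀ x → a * (b * x) ≈ x
  inverse-cancels ab≈1 x = trans (sym (*-assoc _ _ x)) (trans (*-congʳ ab≈1) (*-identityˡ x))

  -- Multiplication by a permutes the nonzero elements, so it fixes their product.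
  fermat : ∀ {a} → a ≉ 0# → a ^ M ≈ 1#
  fermat {a} a≉0 with inverse a a≉0
  ... | b , ab≈1 = *-cancelˡ Π≉0 (begin
    Π * a ^ M                                                ≈⟨ *-congˡ unit-factors ⟨
    Π * ∏F (λ x → unless0 x a)                       ≈⟨ ∏F-* (λ x → unless0 x x) (λ x → unless0 x a) ⟨
    ∏F (λ x → unless0 x x * unless0 x a)                     ≈⟨ ∏F-cong scaled ⟨
    ∏F (λ x → unless0 (a * x) (a * x))            ≈⟨ ∏F-permute (a *_) (b *_) *-congˡ *-congˡ
                                                                  (inverse-cancels ab≈1) (inverse-cancels (trans (*-comm b a) ab≈1))
                                                                  (λ x → unless0 x x) (λ x≈y → unless0-cong x≈y x≈y) ⟨
    Π                                                        ≈⟨ *-identityʳ Π ⟨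
    Π * 1#                                                   ∎)
    where
    -- The factor at zero is replaced by 1, so that the product of the nonzero elements can be taken
    -- over the whole field and permuted there.
    unless0 : Carrier → Carrier → Carrier
    unless0 x y with x ≟ 0#
    ... | yes _ = 1#
    ... | no  _ = y

    unless0-cong : ∀ {x x′ y y′} → x ≈ x′ → y ≈ y′ → unless0 x y ≈ unless0 x′ y′
    unless0-cong {x} {x′} x≈x′ y≈y′ with x ≟ 0# | x′ ≟ 0#
    ... | yes _   | yes _    = refl
    ... | no _    | no _     = y≈y′
    ... | yes x≈0 | no x′≉0  = contradiction (trans (sym x≈x′) x≈0) x′≉0
    ... | no x≉0  | yes x′≈0 = contradiction (trans x≈x′ x′≈0) x≉0

    unless0-≉0 : ∀ x → unless0 x x ≉ 0#
    unless0-≉0 x with x ≟ 0#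
    ... | yes _  = 1≉0
    ... | no x≉0 = x≉0

    ∏-≉0 : ∀ n (f : Fin n → Carrier) → (∀ i → f i ≉ 0#) → ∏ n f ≉ 0#
    ∏-≉0 zero    f f≉0 = 1≉0
    ∏-≉0 (suc n) f f≉0 = *-≉0 (f≉0 zero) (∏-≉0 n _ (λ i → f≉0 (suc i)))

    Π = ∏F (λ x → unless0 x x)
    Π≉0 : Π ≉ 0#
    Π≉0 Π≈0 = ∏-≉0 Q (λ i → unless0 (from i) (from i)) (λ i → unless0-≉0 (from i)) (trans (sym (∏F≈∏ _)) Π≈0)

    scaled : ∀ x → unless0 (a * x) (a * x) ≈ unless0 x x * unless0 x a
    scaled x with (a * x) ≟ 0# | x ≟ 0#
    ... | yes _    | yes _   = sym (*-identityˡ 1#)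
    ... | no _     | no _    = *-comm a x
    ... | yes ax≈0 | no x≉0  = contradiction ax≈0 (*-≉0 a≉0 x≉0)
    ... | no ax≉0  | yes x≈0 = contradiction (trans (*-congˡ x≈0) (zeroʳ a)) ax≉0

    unit-factors : ∏F (λ x → unless0 x a) ≈ a ^ M
    unit-factors = begin
      ∏F (λ x → unless0 x a)            ≈⟨ trans (∏F≈∏ _) (∏-remove M i₀ (λ i → unless0 (from i) a)) ⟩
      unless0 (from i₀) a * ∏ M (λ j → unless0 (from (punchIn i₀ j)) a)
        ≈⟨ *-cong (unless0-cong (strictlyInverseʳ 0#) refl) (∏-cong M rest) ⟩
      unless0 0# a * ∏ M (λ _ → a)              ≈⟨ *-cong at-zero (∏-const M a) ⟩
      1# * a ^ M                                ≈⟨ *-identityˡ _ ⟩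
      a ^ M                                     ∎
      where
      i₀ = to 0#
      at-zero : unless0 0# a ≈ 1#
      at-zero with 0# ≟ 0#
      ... | yes _  = refl
      ... | no 0≉0 = contradiction refl 0≉0
      rest : ∀ j → unless0 (from (punchIn i₀ j)) a ≈ a
      rest j with from (punchIn i₀ j) ≟ 0#
      ... | no _   = refl
      ... | yes f≈0 = contradiction (≡.trans (≡.sym (strictlyInverseˡ _)) (to-cong f≈0)) (Fin.punchInᵢ≢i i₀ j)

  fermat′ : ∀ a → a ^ Q ≈ a
  fermat′ a with a ≟ 0#
  ... | yes a≈0 = trans (*-congʳ a≈0) (trans (zeroˡ _) (sym a≈0))
  ... | no a≉0  = trans (*-congˡ (fermat a≉0)) (*-identityʳ a)

  ^-periodic : ∀ {a} → a ≉ 0# → ∀ n j → a ^ (n ℕ.+ j ℕ.* M) ≈ a ^ n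
  ^-periodic {a} a≉0 n j = begin
    a ^ (n ℕ.+ j ℕ.* M)   ≈⟨ ^-homo-* a n (j ℕ.* M) ⟩
    a ^ n * a ^ (j ℕ.* M) ≈⟨ *-congˡ (trans (^-congʳ a (ℕ.*-comm j M)) (sym (^-assocʳ a M j))) ⟩
    a ^ n * (a ^ M) ^ j   ≈⟨ *-congˡ (trans (^-congˡ j (fermat a≉0)) (1^ j)) ⟩
    a ^ n * 1#            ≈⟨ *-identityʳ _ ⟩
    a ^ n                 ∎

  -- The inverse, with inv 0 = 0 even in the field of two elements, where x ^ (Q - 2) would fail.
  ι : ℕ
  ι = M ℕ.+ (M ∸ 1)

  inv : Carrier → Carrier
  inv x = x ^ ι

  inv-cong : ∀ {x y} → x ≈ y → inv x ≈ inv y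
  inv-cong = ^-congˡ ι

  suc-ι : suc ι ≡ 2 ℕ.* M
  suc-ι = ≡.trans (≡.sym (ℕ.+-suc M (M ∸ 1)))
    (≡.cong (M ℕ.+_) (≡.trans (ℕ.suc-pred M) (≡.sym (ℕ.+-identityʳ M))))

  inverseʳ : ∀ {x} → x ≉ 0# → x * inv x ≈ 1#
  inverseʳ {x} x≉0 = trans (^-congʳ x suc-ι) (^-periodic x≉0 0 2)

  instance
    ι≢0 : NonZero ι
    ι≢0 = ℕ.>-nonZero (ℕ.<-≤-trans 0<M (ℕ.m≤m+n M (M ∸ 1)))

  inv-0 : ∀ {x} → x ≈ 0# → inv x ≈ 0#
  inv-0 x≈0 = trans (inv-cong x≈0) (0^ ι)

  inv-≉0 : ∀ {x} → x ≉ 0# → inv x ≉ 0#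
  inv-≉0 = ^-≉0 ι

  inv-* : ∀ x y → inv (x * y) ≈ inv x * inv y
  inv-* x y = ^-distrib-* x y ι

  inv-involutive : ∀ x → inv (inv x) ≈ x
  inv-involutive x with x ≟ 0#
  ... | yes x≈0 = trans (inv-0 (inv-0 x≈0)) (sym x≈0)
  ... | no x≉0  = *-cancelˡ (inv-≉0 x≉0)
    (trans (inverseʳ (inv-≉0 x≉0)) (trans (sym (inverseʳ x≉0)) (*-comm x (inv x))))

  -- A list of coefficients as a₀ , a₁ , … , a_{d-1} stands for the monic a₀ + a₁ x + … + x ^ d.
  evalMonic : List Carrier → Carrier → Carrier
  evalMonic []       x = 1#
  evalMonic (a ∷ as) x = a + x * evalMonic as x

  -- Horner's scheme: the values at r of the tails of the coefficient list are the coefficients of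
  -- the quotient, which is monic again.
  divide : ∀ a as r → ∃ λ bs → length bs ≡ length as ∧
    (∀ x → evalMonic (a ∷ as) x ≈ evalMonic (a ∷ as) r + (x - r) * evalMonic bs x)
  divide a []        r = [] , ≡.refl ,
    λ x → solve 3 (λ a r x → a :+ x :* :1 := a :+ r :* :1 :+ (x :- r) :* :1) refl a r x
  divide a (a′ ∷ as) r with divide a′ as r
  ... | bs , len , eq = evalMonic (a′ ∷ as) r ∷ bs , ≡.cong suc len , λ x →
    trans (+-congˡ (*-congˡ (eq x)))
      (solve 5 (λ a x r v w → a :+ x :* (v :+ (x :- r) :* w) := a :+ r :* v :+ (x :- r) :* (v :+ x :* w))
        refl a x r (evalMonic (a′ ∷ as) r) (evalMonic bs x))

  root-bound : ∀ as {n} (r : Fin n → Carrier) → (∀ {i j} → r i ≈ r j → i ≡ j) →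
    (∀ i → evalMonic as (r i) ≈ 0#) → n ≤ length as
  root-bound as       {zero}  r inj root = z≤n
  root-bound []       {suc n} r inj root = contradiction (root zero) 1≉0
  root-bound (a ∷ as) {suc n} r inj root with divide a as (r zero)
  ... | bs , len , eq = s≤s (≡.subst (n ≤_) len (root-bound bs (λ i → r (suc i))
    (λ rᵢ≈rⱼ → Fin.suc-injective (inj rᵢ≈rⱼ)) λ i → no-zero-divisors (vanish i) (distinct i)))
    where
    vanish : ∀ i → (r (suc i) - r zero) * evalMonic bs (r (suc i)) ≈ 0#
    vanish i = begin
      (r (suc i) - r zero) * evalMonic bs (r (suc i))   ≈⟨ +-identityˡ _ ⟨
      0# + (r (suc i) - r zero) * evalMonic bs (r (suc i)) ≈⟨ +-congʳ (root zero) ⟨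
      evalMonic (a ∷ as) (r zero) + (r (suc i) - r zero) * evalMonic bs (r (suc i)) ≈⟨ eq (r (suc i)) ⟨
      evalMonic (a ∷ as) (r (suc i))                    ≈⟨ root (suc i) ⟩
      0#                                                ∎
    distinct : ∀ i → (r (suc i) - r zero) ≉ 0#
    distinct i rᵢ-r₀≈0 = Fin.0≢1+n (≡.sym (inj (x∙y⁻¹≈ε⇒x≈y _ _ rᵢ-r₀≈0)))

  -- The polynomial is x^(n+2) - x, so that 0 counts as a root and no element has to be set apart.
  -- Applied to all elements of the field, and to the multiples of 1 together with one further
  -- element.
  power-bound : ∀ n {k} (r : Fin k → Carrier) → (∀ {i j} → r i ≈ r j → i ≡ j) →
    (∀ i → r i ^ (2 ℕ.+ n) ≈ r i) → k ≤ 2 ℕ.+ n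
  power-bound n {k} r inj root = ≡.subst (k ≤_) (≡.cong (λ l → suc (suc l)) (length-replicate n))
    (root-bound (0# ∷ - 1# ∷ replicate n 0#) r inj λ i → begin
      0# + r i * (- 1# + r i * evalMonic (replicate n 0#) (r i)) ≈⟨ +-congˡ (*-congˡ (+-congˡ (*-congˡ (zeros n (r i))))) ⟩
      0# + r i * (- 1# + r i * r i ^ n)  ≈⟨ solve 2 (λ x y → :0 :+ x :* (:- :1 :+ x :* y) := x :* (x :* y) :- x) refl (r i) (r i ^ n) ⟩
      r i ^ (2 ℕ.+ n) - r i              ≈⟨ trans (+-congʳ (root i)) (-‿inverseʳ _) ⟩
      0#                                 ∎)
    where
    zeros : ∀ n x → evalMonic (replicate n 0#) x ≈ x ^ n
    zeros zero    x = refl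
    zeros (suc n) x = trans (+-identityˡ _) (*-congˡ (zeros n x))

  from-injective : ∀ {i j} → from i ≈ from j → i ≡ j
  from-injective {i} {j} fi≈fj = ≡.trans (≡.sym (strictlyInverseˡ i)) (≡.trans (to-cong fi≈fj) (strictlyInverseˡ j))

  -- Takes the place of a generator of the multiplicative group: if the n-th power of every nonzero
  -- element were 1, then all Q elements would be roots of x^(n+1) - x, whose degree is less than Q.
  non-root : ∀ n → 0 < n → n < M → ∃ λ x → x ≉ 0# ∧ x ^ n ≉ 1#
  non-root (suc n) _ n<M = moved (Fin.¬∀⟶∃¬ Q (λ i → from i ^ (2 ℕ.+ n) ≈ from i)
    (λ i → (from i ^ (2 ℕ.+ n)) ≟ from i)
    (λ root → ℕ.<⇒≱ (s≤s n<M) (power-bound n from from-injective root)))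
    where
    moved : (∃ λ i → from i ^ (2 ℕ.+ n) ≉ from i) → ∃ λ x → x ≉ 0# ∧ x ^ suc n ≉ 1#
    moved (i , x^≉x) = from i ,
      (λ x≈0 → x^≉x (trans (*-congʳ x≈0) (trans (zeroˡ _) (sym x≈0)))) ,
      (λ x^≈1 → x^≉x (trans (*-congˡ x^≈1) (*-identityʳ _)))

  non-root′ : ∀ n → ¬ M ∣ n → ∃ λ x → x ≉ 0# ∧ x ^ n ≉ 1#
  non-root′ n M∤n with non-root (n % M) (ℕ.n≢0⇒n>0 (λ eq → M∤n (m%n≡0⇒n∣m n M eq))) (m%n<n n M)
  ... | x , x≉0 , x^≉1 = x , x≉0 , λ x^≈1 → x^≉1 (begin
    x ^ (n % M)                         ≈⟨ ^-periodic x≉0 (n % M) (n / M) ⟨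
    x ^ (n % M ℕ.+ n / M ℕ.* M)         ≡⟨ ≡.cong (x ^_) (m≡m%n+[m/n]*n n M) ⟨
    x ^ n                               ≈⟨ x^≈1 ⟩
    1#                                  ∎)

-- Power sums of a multiplicative map

module CharacterSum {c ℓ c′ ℓ′ M} (F : FiniteField (ℕ.suc M) c ℓ) (R : CommutativeRing c′ ℓ′) where

  open import Data.Nat.Base using (ℕ; zero; suc; NonZero)
  open import Data.Nat.Divisibility using (_∣_; divides)
  open import Data.Product.Base using (_,_)

  private
    module F = FiniteField F
    module S = Sums F.commutativeRing
    open F using () renaming (Carrier to K; _≈_ to _∼_; _≟_ to _≟K_)
  open FieldTheory F using (Q; ^-periodic; inverseʳ; inv; inverse-cancels; non-root′; M≢0)
  open CommutativeRing R hiding (zero)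
  open Sums R
  open FieldSum F R
  open Solver R
  open import Relation.Binary.Reasoning.Setoid setoid

  -- Kept abstract for two uses: T is the identity of the field when traces are studied, and the
  -- Teichmüller lift in the ramified ring. The hypothesis `cancel` stands in for the absence of
  -- zero divisors.
  module _ (T : K → Carrier) (T-cong : ∀ {x y} → x ∼ y → T x ≈ T y)
    (T-* : ∀ x y → T (x F.* y) ≈ T x * T y) (T-1 : T F.1# ≈ 1#) (T-0 : T F.0# ≈ 0#)
    (cancel : ∀ {x y} → ¬ x ∼ F.1# → (T x - 1#) * y ≈ 0# → y ≈ 0#) where

    T-^ : ∀ x n → T (x S.^ n) ≈ T x ^ n
    T-^ x zero    = T-1
    T-^ x (suc n) = trans (T-* x _) (*-congˡ (T-^ x n))

    power-sum : ℕ → Carrier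
    power-sum n = ∑F (λ x → T x ^ n)

    power-sum-0 : power-sum 0 ≈ Q × 1#
    power-sum-0 = ∑F-const 1#

    M×1≈Q×1-1 : M × 1# ≈ Q × 1# - 1#
    M×1≈Q×1-1 = solve 1 (λ m → m := :1 :+ m :- :1) refl (M × 1#)

    power-sum-∣ : ∀ n → .{{NonZero n}} → M ∣ n → power-sum n ≈ M × 1#
    power-sum-∣ n@(suc _) (divides j n≡jM) = begin
      ∑F (λ x → T x ^ n)                            ≈⟨ ∑F-cong value ⟩
      ∑F (λ x → 1# + [ x ≟K F.0# ] * - 1#)          ≈⟨ ∑F-+ _ _ ⟩
      ∑F (λ _ → 1#) + ∑F (λ x → [ x ≟K F.0# ] * - 1#) ≈⟨ +-cong (∑F-const 1#) (∑F-δ F.0# (λ _ → - 1#) (λ _ → refl)) ⟩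
      Q × 1# - 1#                                   ≈⟨ M×1≈Q×1-1 ⟨
      M × 1#                                        ∎
      where
      value : ∀ x → T x ^ n ≈ 1# + [ x ≟K F.0# ] * - 1#
      value x with x ≟K F.0#
      ... | yes x≈0 = begin
        T x ^ n                          ≈⟨ ^-congˡ n (trans (T-cong x≈0) T-0) ⟩
        0# ^ n                           ≈⟨ 0^ n ⟩
        0#                               ≈⟨ solve 0 (:0 := :1 :+ :1 :* :- :1) refl ⟩
        1# + 1# * - 1#                   ≈⟨ +-congˡ (*-congʳ ([ x ≟K F.0# ]-yes x≈0)) ⟨
        1# + [ x ≟K F.0# ] * - 1#        ∎
      ... | no x≉0  = begin
        T x ^ n                 ≈⟨ T-^ x n ⟨
        T (x S.^ n)             ≈⟨ T-cong (F.trans (F.reflexive (≡.cong (x S.^_) n≡jM)) (^-periodic x≉0 0 j)) ⟩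
        T F.1#                  ≈⟨ T-1 ⟩
        1#                      ≈⟨ solve 0 (:1 := :1 :+ :0 :* :- :1) refl ⟩
        1# + 0# * - 1#          ≈⟨ +-congˡ (*-congʳ ([ x ≟K F.0# ]-no x≉0)) ⟨
        1# + [ x ≟K F.0# ] * - 1# ∎

    -- Substituting x ↦ g x multiplies the sum by T (g ^ n), which differs from 1 for suitable g.
    power-sum-∤ : ∀ n → ¬ M ∣ n → power-sum n ≈ 0#
    power-sum-∤ n M∤n = vanish (non-root′ n M∤n)
      where
      open import Data.Product.Base using (∃; _×_)
      vanish : (∃ λ g → ¬ g ∼ F.0# × ¬ g S.^ n ∼ F.1#) → power-sum n ≈ 0#
      vanish (g , g≉0 , g^≉1) = cancel g^≉1 (begin
        (T (g S.^ n) - 1#) * power-sum n                ≈⟨ solve 2 (λ t s → (t :- :1) :* s := t :* s :- s) refl _ _ ⟩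
        T (g S.^ n) * power-sum n - power-sum n         ≈⟨ +-congʳ (∑F-*ˡ _ _) ⟩
        ∑F (λ x → T (g S.^ n) * T x ^ n) - power-sum n  ≈⟨ +-congʳ (∑F-cong λ x → trans (*-congʳ (T-^ g n))
                                                             (trans (sym (^-distrib-* (T g) (T x) n)) (^-congˡ n (sym (T-* g x))))) ⟩
        ∑F (λ x → T (g F.* x) ^ n) - power-sum n        ≈⟨ +-congʳ (sym (∑F-permute (g F.*_) (inv g F.*_) F.*-congˡ F.*-congˡ
                                                             (inverse-cancels (inverseʳ g≉0)) (inverse-cancels (F.trans (F.*-comm _ _) (inverseʳ g≉0)))
                                                             (λ x → T x ^ n) (λ x∼y → ^-congˡ n (T-cong x∼y)))) ⟩
        power-sum n - power-sum n                       ≈⟨ -‿inverseʳ _ ⟩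
        0#                                              ∎)

-- Characteristic, Frobenius map and absolute trace

module Trace {c ℓ M} (F : FiniteField (ℕ.suc M) c ℓ) (p : ℕ.ℕ) (pr : Prime p) (E : ℕ.ℕ)
  (Q≡p^E : ℕ.suc M ≡ p ℕ.^ E) where

  open import Data.Fin.Base using (Fin; zero; suc; toℕ)
  import Data.Fin.Properties as Fin
  open ℕ using (ℕ; zero; suc; NonZero; _∸_; _<_; _≤_; s≤s)
  open import Data.Nat.Coprimality using (coprime-Bézout; prime⇒coprime)
  open import Data.Nat.Divisibility using (_∣_; divides; m%n≡0⇒n∣m; ∣⇒≤; ∣m+n∣m⇒∣n)
  open import Data.Nat.DivMod using (_%_; _/_; m≡m%n+[m/n]*n; m%n<n; [m+kn]%n≡m%n; m<n⇒m%n≡m)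
  open import Data.Nat.GCD using (module Bézout)
  import Data.Nat.Properties as ℕ
  open import Data.Product.Base using (∃; _,_; proj₁; proj₂)
  open import Data.Sum.Base using (inj₁; inj₂)
  open import Function.Bundles using (Inverse)

  open FiniteField F hiding (zero)
  open Inverse enumeration using (to; from; strictlyInverseʳ)
  open Sums commutativeRing
  open FieldSum F commutativeRing
  open FieldTheory F
  open Solver commutativeRing
  open PrimeBinomial using (prime-binomial)
  open import Algebra.Properties.Group +-group using (x∙y⁻¹≈ε⇒x≈y) renaming (∙-cancelˡ to +-cancelˡ)
  open import Relation.Binary.Reasoning.Setoid (CommutativeRing.setoid commutativeRing)

  instance
    p≢0 : NonZero p
    p≢0 = prime⇒nonZero pr

  1<p : 1 < p
  1<p = ℕ.nonTrivial⇒n>1 p {{prime⇒nonTrivial pr}}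

  -- Q · 1 = (p · 1)^E vanishes, and a field has no nilpotent elements besides 0.
  p×1≈0 : p × 1# ≈ 0#
  p×1≈0 = root E (trans (sym (×1-^ E)) (trans (×-congˡ (≡.sym Q≡p^E)) Q×1≈0))
    where
    ×1-^ : ∀ n → (p ℕ.^ n) × 1# ≈ (p × 1#) ^ n
    ×1-^ zero    = +-identityʳ 1#
    ×1-^ (suc n) = trans (×1-homo-* p (p ℕ.^ n)) (*-congˡ (×1-^ n))
    root : ∀ n → (p × 1#) ^ n ≈ 0# → p × 1# ≈ 0#
    root n p^n≈0 with (p × 1#) ≟ 0#
    ... | yes p≈0 = p≈0
    ... | no p≉0  = contradiction p^n≈0 (^-≉0 n p≉0)

  multiple×1≈0 : ∀ {n} → p ∣ n → n × 1# ≈ 0#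
  multiple×1≈0 (divides j ≡.refl) = trans (×1-homo-* j p) (trans (*-congˡ p×1≈0) (zeroʳ _))

  -- A nonzero remainder of n modulo p would be coprime to p; as both annihilate 1, Bézout's
  -- identity would give 1 = 0.
  ×1≈0⇒∣ : ∀ n → n × 1# ≈ 0# → p ∣ n
  ×1≈0⇒∣ n n≈0 = m%n≡0⇒n∣m n p (remainder (n % p) ≡.refl)
    where
    r≈0 : (n % p) × 1# ≈ 0#
    r≈0 = begin
      (n % p) × 1#                          ≈⟨ +-identityʳ _ ⟨
      (n % p) × 1# + 0#                     ≈⟨ +-congˡ (multiple×1≈0 (divides (n / p) ≡.refl)) ⟨
      (n % p) × 1# + (n / p ℕ.* p) × 1#     ≈⟨ ×-homo-+ 1# (n % p) _ ⟨
      (n % p ℕ.+ n / p ℕ.* p) × 1#          ≈⟨ ×-congˡ (≡.sym (m≡m%n+[m/n]*n n p)) ⟩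
      n × 1#                                ≈⟨ n≈0 ⟩
      0#                                    ∎
    1≈0 : ∀ {a b} → 1 ℕ.+ a ≡ b → a × 1# ≈ 0# → b × 1# ≈ 0# → 1# ≈ 0#
    1≈0 eq a≈0 b≈0 = trans (sym (+-identityʳ 1#)) (trans (+-congˡ (sym a≈0)) (trans (×-congˡ eq) b≈0))
    times : ∀ a {b} → b × 1# ≈ 0# → (a ℕ.* b) × 1# ≈ 0#
    times a b≈0 = trans (×1-homo-* a _) (trans (*-congˡ b≈0) (zeroʳ _))
    remainder : ∀ r → n % p ≡ r → r ≡ 0
    remainder zero    _  = ≡.refl
    remainder (suc r) eq with coprime-Bézout (prime⇒coprime pr (≡.subst (_< p) eq (m%n<n n p)))
    ... | Bézout.+- x y 1+yr≡xp = contradiction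
      (1≈0 1+yr≡xp (times y (trans (×-congˡ (≡.sym eq)) r≈0)) (times x p×1≈0)) 1≉0
    ... | Bézout.-+ x y 1+xp≡yr = contradiction
      (1≈0 1+xp≡yr (times x p×1≈0) (times y (trans (×-congˡ (≡.sym eq)) r≈0))) 1≉0

  private
    ×1-injective-≤ : ∀ m n → m ≤ n → m × 1# ≈ n × 1# → n % p ≡ m % p
    ×1-injective-≤ m n m≤n m≈n with ×1≈0⇒∣ (n ∸ m) (+-cancelˡ (m × 1#) _ _ (begin
      m × 1# + (n ∸ m) × 1#    ≈⟨ ×-homo-+ 1# m (n ∸ m) ⟨
      (m ℕ.+ (n ∸ m)) × 1#     ≈⟨ ×-congˡ (ℕ.m+[n∸m]≡n m≤n) ⟩
      n × 1#                   ≈⟨ m≈n ⟨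
      m × 1#                   ≈⟨ +-identityʳ _ ⟨
      m × 1# + 0#              ∎))
    ... | divides j eq = ≡.trans (≡.cong (_% p) (≡.trans (≡.sym (ℕ.m+[n∸m]≡n m≤n)) (≡.cong (m ℕ.+_) eq)))
                           ([m+kn]%n≡m%n m j p)

  ×1-injective : ∀ m n → m × 1# ≈ n × 1# → m % p ≡ n % p
  ×1-injective m n m≈n with ℕ.≤-total m n
  ... | inj₁ m≤n = ≡.sym (×1-injective-≤ m n m≤n m≈n)
  ... | inj₂ n≤m = ×1-injective-≤ n m n≤m (sym m≈n)

  -- Reduced to prime-binomial for x / y.
  frobenius : ∀ x y → (x + y) ^ p ≈ x ^ p + y ^ p
  frobenius x y with y ≟ 0#
  ... | yes y≈0 = begin
    (x + y) ^ p       ≈⟨ ^-congˡ p (trans (+-congˡ y≈0) (+-identityʳ x)) ⟩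
    x ^ p             ≈⟨ +-identityʳ _ ⟨
    x ^ p + 0#        ≈⟨ +-congˡ (trans (^-congˡ p y≈0) (0^ p)) ⟨
    x ^ p + y ^ p     ∎
  ... | no y≉0 = begin
    (x + y) ^ p                         ≈⟨ ^-congˡ p (trans (+-congʳ x≈) (solve 2 (λ z y → z :* y :+ y := (z :+ :1) :* y) refl z y)) ⟩
    ((z + 1#) * y) ^ p                  ≈⟨ ^-distrib-* (z + 1#) y p ⟩
    (z + 1#) ^ p * y ^ p                ≈⟨ *-congʳ (proj₂ (prime-binomial commutativeRing pr z)) ⟩
    (1# + p × 1# * _ + z ^ p) * y ^ p   ≈⟨ *-congʳ (+-congʳ (+-congˡ (trans (*-congʳ p×1≈0) (zeroˡ _)))) ⟩
    (1# + 0# + z ^ p) * y ^ p           ≈⟨ solve 2 (λ z y → (:1 :+ :0 :+ z) :* y := z :* y :+ y) refl (z ^ p) (y ^ p) ⟩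
    z ^ p * y ^ p + y ^ p               ≈⟨ +-congʳ (sym (^-distrib-* z y p)) ⟩
    (z * y) ^ p + y ^ p                 ≈⟨ +-congʳ (^-congˡ p x≈) ⟨
    x ^ p + y ^ p                       ∎
    where
    z = x * inv y
    x≈ : x ≈ z * y
    x≈ = trans (sym (*-identityʳ x)) (trans (*-congˡ (trans (sym (inverseʳ y≉0)) (*-comm _ _))) (sym (*-assoc _ _ _)))

  frobenius^ : ∀ i x y → (x + y) ^ (p ℕ.^ i) ≈ x ^ (p ℕ.^ i) + y ^ (p ℕ.^ i)
  frobenius^ zero    x y = trans (*-identityʳ _) (sym (+-cong (*-identityʳ x) (*-identityʳ y)))
  frobenius^ (suc i) x y = begin
    (x + y) ^ (p ℕ.* p ℕ.^ i)                       ≈⟨ ^-assocʳ (x + y) p _ ⟨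
    ((x + y) ^ p) ^ (p ℕ.^ i)                       ≈⟨ ^-congˡ (p ℕ.^ i) (frobenius x y) ⟩
    (x ^ p + y ^ p) ^ (p ℕ.^ i)                     ≈⟨ frobenius^ i _ _ ⟩
    (x ^ p) ^ (p ℕ.^ i) + (y ^ p) ^ (p ℕ.^ i)       ≈⟨ +-cong (^-assocʳ x p _) (^-assocʳ y p _) ⟩
    x ^ (p ℕ.^ suc i) + y ^ (p ℕ.^ suc i)           ∎

  frobenius-∑ : ∀ n (f : Fin n → Carrier) → ∑ n f ^ p ≈ ∑ n (λ i → f i ^ p)
  frobenius-∑ zero    f = 0^ p
  frobenius-∑ (suc n) f = trans (frobenius _ _) (+-congˡ (frobenius-∑ n _))

  ×1-frobenius : ∀ n → (n × 1#) ^ p ≈ n × 1#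
  ×1-frobenius zero    = 0^ p
  ×1-frobenius (suc n) = trans (frobenius 1# _) (+-cong (1^ p) (×1-frobenius n))

  conjugate : Carrier → ℕ → Carrier
  conjugate u i = u ^ (p ℕ.^ i)

  Tr : Carrier → Carrier
  Tr u = ∑ E (λ i → conjugate u (toℕ i))

  Tr-cong : ∀ {x y} → x ≈ y → Tr x ≈ Tr y
  Tr-cong x≈y = ∑-cong E (λ i → ^-congˡ (p ℕ.^ toℕ i) x≈y)

  Tr-+ : ∀ x y → Tr (x + y) ≈ Tr x + Tr y
  Tr-+ x y = trans (∑-cong E (λ i → frobenius^ (toℕ i) x y))
    (∑-+ E (λ i → conjugate x (toℕ i)) (λ i → conjugate y (toℕ i)))

  Tr-* : ∀ a x → a ^ p ≈ a → Tr (a * x) ≈ a * Tr x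
  Tr-* a x a^p≈a = trans (∑-cong E (λ i → trans (^-distrib-* a x (p ℕ.^ toℕ i)) (*-congʳ (fixed (toℕ i)))))
    (sym (∑-*ˡ E a (λ i → conjugate x (toℕ i))))
    where
    fixed : ∀ i → a ^ (p ℕ.^ i) ≈ a
    fixed zero    = *-identityʳ a
    fixed (suc i) = trans (sym (^-assocʳ a p _)) (trans (^-congˡ (p ℕ.^ i) a^p≈a) (fixed i))

  -- The p-th power moves each conjugate to the next one, and the last returns to x because x^Q = x.
  Tr-frobenius : ∀ x → Tr (x ^ p) ≈ Tr x
  Tr-frobenius x = begin
    ∑ E (λ i → (x ^ p) ^ (p ℕ.^ toℕ i))       ≈⟨ ∑-cong E (λ i → ^-assocʳ x p _) ⟩
    ∑ E (λ i → conjugate x (suc (toℕ i)))     ≈⟨ +-cancelˡ (x ^ 1) _ _ (trans (∑-rotate E (conjugate x))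
                                                   (trans (+-congʳ x^Q≈x) (+-congʳ (sym (*-identityʳ x))))) ⟩
    Tr x                                      ∎
    where
    x^Q≈x : conjugate x E ≈ x
    x^Q≈x = trans (^-congʳ x (≡.sym Q≡p^E)) (fermat′ x)

  Tr-fixed : ∀ x → Tr x ^ p ≈ Tr x
  Tr-fixed x = trans (frobenius-∑ E (λ i → conjugate x (toℕ i)))
    (trans (∑-cong E (λ i → trans (^-assocʳ x (p ℕ.^ toℕ i) p)
      (trans (^-congʳ x (ℕ.*-comm (p ℕ.^ toℕ i) p)) (sym (^-assocʳ x p _))))) (Tr-frobenius x))

  -- An x outside the p distinct multiples of 1 would be a further root of x^p - x. Finding the
  -- multiple is a finite search, so the trace can be turned into an exponent of ζ.
  prime-field : ∀ x → x ^ p ≈ x → ∃ λ (i : Fin p) → toℕ i × 1# ≈ x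
  prime-field x x^p≈x with Fin.any? (λ i → (toℕ {p} i × 1#) ≟ x)
  ... | yes i = i
  ... | no ∄i = contradiction (bound p 1<p pr roots roots-injective roots-fixed) ℕ.1+n≰n
    where
    roots : Fin (suc p) → Carrier
    roots zero    = x
    roots (suc i) = toℕ i × 1#
    roots-injective : ∀ {i j} → roots i ≈ roots j → i ≡ j
    roots-injective {zero}  {zero}  _   = ≡.refl
    roots-injective {zero}  {suc j} x≈j = contradiction (j , sym x≈j) ∄i
    roots-injective {suc i} {zero}  i≈x = contradiction (i , i≈x) ∄i
    roots-injective {suc i} {suc j} i≈j = ≡.cong suc (Fin.toℕ-injective
      (≡.trans (≡.sym (m<n⇒m%n≡m (Fin.toℕ<n i))) (≡.trans (×1-injective _ _ i≈j) (m<n⇒m%n≡m (Fin.toℕ<n j)))))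
    roots-fixed : ∀ i → roots i ^ p ≈ roots i
    roots-fixed zero    = x^p≈x
    roots-fixed (suc i) = ×1-frobenius (toℕ i)
    bound : ∀ p → 1 < p → Prime p → ∀ {k} (r : Fin k → Carrier) → (∀ {i j} → r i ≈ r j → i ≡ j) →
      (∀ i → r i ^ p ≈ r i) → k ≤ p
    bound (suc (suc n)) _ _ = power-bound n
    bound 1 (s≤s ()) _

  opaque
    tr : Carrier → ℕ
    tr x = toℕ (proj₁ (prime-field (Tr x) (Tr-fixed x)))

    tr<p : ∀ x → tr x < p
    tr<p x = Fin.toℕ<n (proj₁ (prime-field (Tr x) (Tr-fixed x)))

    tr×1 : ∀ x → tr x × 1# ≈ Tr x
    tr×1 x = proj₂ (prime-field (Tr x) (Tr-fixed x))

  tr-unique : ∀ n x → n × 1# ≈ Tr x → n % p ≡ tr x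
  tr-unique n x n≈ = ≡.trans (×1-injective n (tr x) (trans n≈ (sym (tr×1 x)))) (m<n⇒m%n≡m (tr<p x))

  tr-cong : ∀ {x y} → Tr x ≈ Tr y → tr x ≡ tr y
  tr-cong {x} {y} eq = ≡.trans (≡.sym (m<n⇒m%n≡m (tr<p x))) (tr-unique (tr x) y (trans (tr×1 x) eq))

  tr-zero : ∀ {x} → x ≈ 0# → tr x ≡ 0
  tr-zero {x} x≈0 = ≡.sym (≡.trans (≡.sym (m<n⇒m%n≡m (ℕ.<⇒≤ 1<p))) (tr-unique 0 x (sym (begin
    Tr x            ≈⟨ Tr-cong (trans x≈0 (sym (zeroˡ 0#))) ⟩
    Tr (0# * 0#)    ≈⟨ Tr-* 0# 0# (0^ p) ⟩
    0# * Tr 0#      ≈⟨ zeroˡ _ ⟩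
    0#              ∎))))

  tr-+ : ∀ x y → (tr x ℕ.+ tr y) % p ≡ tr (x + y)
  tr-+ x y = tr-unique _ _ (trans (×-homo-+ 1# (tr x) (tr y))
    (trans (+-cong (tr×1 x) (tr×1 y)) (sym (Tr-+ x y))))

  open CharacterSum F commutativeRing using (power-sum-∣; power-sum-∤)

  private
    T-cancel : ∀ {x y} → x ≉ 1# → (x - 1#) * y ≈ 0# → y ≈ 0#
    T-cancel x≉1 eq = no-zero-divisors eq (λ x-1≈0 → x≉1 (x∙y⁻¹≈ε⇒x≈y _ _ x-1≈0))

  ∑-power-∣ : ∀ n → .{{NonZero n}} → M ∣ n → ∑F (λ x → x ^ n) ≈ - 1#
  ∑-power-∣ n M∣n = trans (power-sum-∣ (λ x → x) (λ eq → eq) (λ _ _ → refl) refl refl T-cancel n M∣n) M×1≈-1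

  ∑-power-∤ : ∀ n → ¬ M ∣ n → ∑F (λ x → x ^ n) ≈ 0#
  ∑-power-∤ = power-sum-∤ (λ x → x) (λ eq → eq) (λ _ _ → refl) refl refl T-cancel

  1≤E : 1 ≤ E
  1≤E = ℕ.n≢0⇒n>0 λ E≡0 → ℕ.≢-nonZero⁻¹ M
    (ℕ.suc-injective (≡.trans Q≡p^E (≡.cong (p ℕ.^_) E≡0)))

  -- Only the conjugate u itself contributes.
  ∑-Tr-inv : ∑F (λ u → Tr u * inv u) ≈ - 1#
  ∑-Tr-inv = begin
    ∑F (λ u → Tr u * inv u)                                 ≈⟨ ∑F-cong (λ u → trans (∑-*ʳ E _ (inv u))
                                                                 (∑-cong E (λ i → sym (^-homo-* u (p ℕ.^ toℕ i) ι)))) ⟩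
    ∑F (λ u → ∑ E (λ i → u ^ (p ℕ.^ toℕ i ℕ.+ ι)))          ≈⟨ ∑F-∑ E (λ u i → u ^ (p ℕ.^ toℕ i ℕ.+ ι)) ⟩
    ∑ E (λ i → ∑F (λ u → u ^ (p ℕ.^ toℕ i ℕ.+ ι)))          ≈⟨ first-only E 1≤E ℕ.≤-refl ⟩
    - 1#                                                    ∎
    where
    power : ℕ → Carrier
    power i = ∑F (λ u → u ^ (p ℕ.^ i ℕ.+ ι))
    power-0 : power 0 ≈ - 1#
    power-0 = ∑-power-∣ (suc ι) (divides 2 suc-ι)
    power-suc : ∀ i → suc i < E → power (suc i) ≈ 0#
    power-suc i 1+i<E = ∑-power-∤ _ not-multiple
      where
      r = p ℕ.^ suc i ∸ 1
      1<p^ : 1 < p ℕ.^ suc i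
      1<p^ = ℕ.≤-trans 1<p (ℕ.m≤m*n p (p ℕ.^ i) {{ℕ.m^n≢0 p i}})
      r<M : r < M
      r<M = ℕ.∸-monoˡ-< (≡.subst (p ℕ.^ suc i <_) (≡.sym Q≡p^E) (ℕ.^-monoʳ-< p 1<p 1+i<E)) (ℕ.<⇒≤ 1<p^)
      -- As ι = 2 M - 1, the exponent is congruent modulo M to p^(i+1) - 1, which lies strictly
      -- between 0 and M for i + 1 < E.
      split : p ℕ.^ suc i ℕ.+ ι ≡ r ℕ.+ 2 ℕ.* M
      split = ≡.trans (≡.cong (ℕ._+ ι) (≡.sym (ℕ.m+[n∸m]≡n (ℕ.<⇒≤ 1<p^))))
        (≡.trans (≡.sym (ℕ.+-suc r ι)) (≡.cong (r ℕ.+_) suc-ι))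
      not-multiple : ¬ M ∣ p ℕ.^ suc i ℕ.+ ι
      not-multiple M∣ = ℕ.<⇒≱ r<M (∣⇒≤ {{ℕ.>-nonZero (ℕ.m<n⇒0<n∸m 1<p^)}}
        (∣m+n∣m⇒∣n (≡.subst (M ∣_) (≡.trans split (ℕ.+-comm r _)) M∣) (divides 2 ≡.refl)))
    first-only : ∀ n → 1 ≤ n → n ≤ E → ∑ n (λ i → power (toℕ i)) ≈ - 1#
    first-only (suc n) _ 1+n≤E = trans (+-cong power-0 (∑-zero n (λ i → power-suc (toℕ i)
      (ℕ.≤-trans (s≤s (Fin.toℕ<n i)) 1+n≤E)))) (+-identityʳ _)

  -- Were the trace identically zero, the sum of Tr u / u would be 0 instead of -1. A nonzero value
  -- t of the trace lies in the prime field, hence so does 1 / t, and the trace is linear over it.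
  ∃tr≡1 : ∃ λ y → tr y ≡ 1
  ∃tr≡1 = scaled (Fin.¬∀⟶∃¬ Q (λ i → Tr (from i) ≈ 0#) (λ i → Tr (from i) ≟ 0#) λ all0 →
      1≉0 (trans (solve 0 (:1 := :- (:- :1)) refl) (trans (-‿cong (trans (sym ∑-Tr-inv)
        (∑F-zero λ u → trans (*-congʳ (trans (Tr-cong (sym (strictlyInverseʳ u))) (all0 (to u)))) (zeroˡ _))))
        (solve 0 (:- :0 := :0) refl))))
    where
    scaled : (∃ λ i → Tr (from i) ≉ 0#) → ∃ λ y → tr y ≡ 1
    scaled (i , t≉0) = inv t * from i , ≡.sym (≡.trans (≡.sym (m<n⇒m%n≡m 1<p)) (tr-unique 1 _ (begin
      1 × 1#                ≈⟨ +-identityʳ 1# ⟩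
      1#                    ≈⟨ inverseʳ t≉0 ⟨
      t * inv t             ≈⟨ *-comm _ _ ⟩
      inv t * t             ≈⟨ Tr-* (inv t) (from i) inv-fixed ⟨
      Tr (inv t * from i)   ∎)))
      where
      t = Tr (from i)
      inv-fixed : inv t ^ p ≈ inv t
      inv-fixed = trans (^-assocʳ t ι p) (trans (^-congʳ t (ℕ.*-comm ι p))
        (trans (sym (^-assocʳ t p ι)) (inv-cong (Tr-fixed (from i)))))

-- Localisation of a commutative ring

-- Equality up to multiplication by an element of a multiplicative set.
module Localisation {c ℓ s} (R : CommutativeRing c ℓ)
  (S : CommutativeRing.Carrier R → Set s) (S-1 : S (CommutativeRing.1# R))
  (S-* : ∀ {x y} → S x → S y → S (CommutativeRing._*_ R x y)) where

  open import Data.Product.Base using (_,_)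
  open CommutativeRing R
  open Solver R
  open import Relation.Binary.Reasoning.Setoid setoid

  -- The carrier is unchanged and only equality is coarsened: elements of S become cancellable
  -- without being given inverses, so that no fractions have to be formed.
  record _≋_ (x y : Carrier) : Set (c ⊔ ℓ ⊔ s) where
    constructor multiplier
    field
      w    : Carrier
      w∈S  : S w
      w*≈  : w * x ≈ w * y

  ≈⇒≋ : ∀ {x y} → x ≈ y → x ≋ y
  ≈⇒≋ x≈y = multiplier 1# S-1 (*-congˡ x≈y)

  ≋-cancel : ∀ {w x y} → S w → (w * x) ≋ (w * y) → x ≋ y
  ≋-cancel {w} w∈S (multiplier v v∈S eq) = multiplier (v * w) (S-* v∈S w∈S)
    (trans (*-assoc v w _) (trans eq (sym (*-assoc v w _))))

  ≋-sym : ∀ {x y} → x ≋ y → y ≋ x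
  ≋-sym (multiplier w w∈S eq) = multiplier w w∈S (sym eq)

  ≋-trans : ∀ {x y z} → x ≋ y → y ≋ z → x ≋ z
  ≋-trans {x} {y} {z} (multiplier v v∈S vx≈vy) (multiplier w w∈S wy≈wz) = multiplier (v * w) (S-* v∈S w∈S) (begin
    v * w * x     ≈⟨ solve 3 (λ v w x → v :* w :* x := w :* (v :* x)) refl v w x ⟩
    w * (v * x)   ≈⟨ *-congˡ vx≈vy ⟩
    w * (v * y)   ≈⟨ solve 3 (λ v w y → w :* (v :* y) := v :* (w :* y)) refl v w y ⟩
    v * (w * y)   ≈⟨ *-congˡ wy≈wz ⟩
    v * (w * z)   ≈⟨ *-assoc v w z ⟨
    v * w * z     ∎)

  ≋-+ : ∀ {x x′ y y′} → x ≋ x′ → y ≋ y′ → (x + y) ≋ (x′ + y′)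
  ≋-+ {x} {x′} {y} {y′} (multiplier v v∈S vx≈vx′) (multiplier w w∈S wy≈wy′) = multiplier (v * w) (S-* v∈S w∈S) (begin
    v * w * (x + y)                 ≈⟨ solve 4 (λ v w x y → v :* w :* (x :+ y) := w :* (v :* x) :+ v :* (w :* y)) refl v w x y ⟩
    w * (v * x) + v * (w * y)       ≈⟨ +-cong (*-congˡ vx≈vx′) (*-congˡ wy≈wy′) ⟩
    w * (v * x′) + v * (w * y′)     ≈⟨ solve 4 (λ v w x y → v :* w :* (x :+ y) := w :* (v :* x) :+ v :* (w :* y)) refl v w x′ y′ ⟨
    v * w * (x′ + y′)               ∎)

  ≋-* : ∀ {x x′ y y′} → x ≋ x′ → y ≋ y′ → (x * y) ≋ (x′ * y′)
  ≋-* {x} {x′} {y} {y′} (multiplier v v∈S vx≈vx′) (multiplier w w∈S wy≈wy′) = multiplier (v * w) (S-* v∈S w∈S) (begin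
    v * w * (x * y)           ≈⟨ solve 4 (λ v w x y → v :* w :* (x :* y) := (v :* x) :* (w :* y)) refl v w x y ⟩
    (v * x) * (w * y)         ≈⟨ *-cong vx≈vx′ wy≈wy′ ⟩
    (v * x′) * (w * y′)       ≈⟨ solve 4 (λ v w x y → v :* w :* (x :* y) := (v :* x) :* (w :* y)) refl v w x′ y′ ⟨
    v * w * (x′ * y′)         ∎)

  ≋-neg : ∀ {x x′} → x ≋ x′ → (- x) ≋ (- x′)
  ≋-neg {x} {x′} (multiplier v v∈S vx≈vx′) = multiplier v v∈S (begin
    v * - x       ≈⟨ solve 2 (λ v x → v :* :- x := :- (v :* x)) refl v x ⟩
    - (v * x)     ≈⟨ -‿cong vx≈vx′ ⟩
    - (v * x′)    ≈⟨ solve 2 (λ v x → v :* :- x := :- (v :* x)) refl v x′ ⟨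
    v * - x′      ∎)

  localised : CommutativeRing c (c ⊔ ℓ ⊔ s)
  localised = record
    { Carrier = Carrier
    ; _≈_ = _≋_
    ; _+_ = _+_
    ; _*_ = _*_
    ; -_ = -_
    ; 0# = 0#
    ; 1# = 1#
    ; isCommutativeRing = record
      { isRing = record
        { +-isAbelianGroup = record
          { isGroup = record
            { isMonoid = record
              { isSemigroup = record
                { isMagma = record
                  { isEquivalence = record { refl = ≈⇒≋ refl ; sym = ≋-sym ; trans = ≋-trans }
                  ; ∙-cong = ≋-+
                  }
                ; assoc = λ x y z → ≈⇒≋ (+-assoc x y z)
                }
              ; identity = (λ x → ≈⇒≋ (+-identityˡ x)) , (λ x → ≈⇒≋ (+-identityʳ x))
              }
            ; inverse = (λ x → ≈⇒≋ (-‿inverseˡ x)) , (λ x → ≈⇒≋ (-‿inverseʳ x))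
            ; ⁻¹-cong = ≋-neg
            }
          ; comm = λ x y → ≈⇒≋ (+-comm x y)
          }
        ; *-cong = ≋-*
        ; *-assoc = λ x y z → ≈⇒≋ (*-assoc x y z)
        ; *-identity = (λ x → ≈⇒≋ (*-identityˡ x)) , (λ x → ≈⇒≋ (*-identityʳ x))
        ; distrib = (λ x y z → ≈⇒≋ (distribˡ x y z)) , (λ x y z → ≈⇒≋ (distribʳ x y z))
        }
      ; *-comm = λ x y → ≈⇒≋ (*-comm x y)
      }
    }

-- A ring containing a p-th root of unity and multiplicative representatives

-- The ring generated by the commuting operators T a and Z on functions f : K → ℕ → ℤ with
-- f x n + … + f x (n + p − 1) = 0, where (T a f) x n = f (a x) n and (Z f) x n = f x (n + 1).
-- It contains multiplicative representatives T a of the elements of K and the p-th root of unity Z.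
module ShiftRing {c ℓ M} (F : FiniteField (ℕ.suc M) c ℓ) (p : ℕ.ℕ) (pr : Prime p) (E : ℕ.ℕ)
  (Q≡p^E : ℕ.suc M ≡ p ℕ.^ E) where

  open import Data.Fin.Base using (Fin; zero; suc; toℕ)
  import Data.Integer.Properties as ℤ
  open import Data.Integer.Base as ℤ using (ℤ; +_; 0ℤ; 1ℤ)
  open ℕ using (ℕ; zero; suc; _<_)
  open import Data.Nat.DivMod using (_%_; _/_; m≡m%n+[m/n]*n; m<n⇒m%n≡m; [m+n]%n≡m%n; [m+kn]%n≡m%n; n%n≡0)
  import Data.Nat.Properties as ℕ
  import Data.Fin.Properties as Fin
  open import Data.Product.Base using (_,_; proj₁; proj₂)
  open import Data.Sum.Base using (inj₁; inj₂)

  private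
    module F = FiniteField F
    module SZ = Sums ℤ.+-*-commutativeRing
  open F using () renaming (Carrier to K; _≈_ to _∼_; _≟_ to _≟K_)
  open FieldTheory F using (inv; inverseʳ)
  open Trace F p pr E Q≡p^E
  open Solver ℤ.+-*-commutativeRing
  open ≡.≡-Reasoning

  -- Elements are expressions and not operators, so that the residue map `ε` and later inductions
  -- are by recursion on their form; that `ε` respects equality of operators then becomes a theorem,
  -- `ε-cong`.
  data Expr : Set c where
    T           : K → Expr
    Z :0′ :1′   : Expr
    _⊕_ _⊗_     : Expr → Expr → Expr
    ⊖_          : Expr → Expr

  infixl 6 _⊕_
  infixl 7 _⊗_
  infix  8 ⊖_
  infix  4 _≈_

  Functions : Set c
  Functions = K → ℕ → ℤ

  _≗₂_ : Functions → Functions → Set c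
  f ≗₂ g = ∀ x n → f x n ≡ g x n

  act : Expr → Functions → Functions
  act (T a)   f x n = f (a F.* x) n
  act Z       f x n = f x (suc n)
  act :0′     f x n = 0ℤ
  act :1′     f x n = f x n
  act (d ⊕ e) f x n = act d f x n ℤ.+ act e f x n
  act (d ⊗ e) f x n = act d (act e f) x n
  act (⊖ e)   f x n = ℤ.- act e f x n

  -- The condition `window` says that 1 + Z + ... + Z^(p-1) acts as zero. With Z^p = 1 alone, Z - 1
  -- would be a zero divisor.
  record Periodic (f : Functions) : Set (c ⊔ ℓ) where
    field
      respects : ∀ {x y} n → x ∼ y → f x n ≡ f y n
      window   : ∀ x n → SZ.∑ p (λ i → f x (toℕ i ℕ.+ n)) ≡ 0ℤ

  open Periodic

  act-cong : ∀ e {f g} → f ≗₂ g → act e f ≗₂ act e g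
  act-cong (T a)   fg x n = fg (a F.* x) n
  act-cong Z       fg x n = fg x (suc n)
  act-cong :0′     fg x n = ≡.refl
  act-cong :1′     fg x n = fg x n
  act-cong (d ⊕ e) fg x n = ≡.cong₂ ℤ._+_ (act-cong d fg x n) (act-cong e fg x n)
  act-cong (d ⊗ e) fg x n = act-cong d (act-cong e fg) x n
  act-cong (⊖ e)   fg x n = ≡.cong ℤ.-_ (act-cong e fg x n)

  act-+ : ∀ e f g → act e (λ x n → f x n ℤ.+ g x n) ≗₂ λ x n → act e f x n ℤ.+ act e g x n
  act-+ (T a)   f g x n = ≡.refl
  act-+ Z       f g x n = ≡.refl
  act-+ :0′     f g x n = ≡.refl
  act-+ :1′     f g x n = ≡.refl
  act-+ (d ⊕ e) f g x n = ≡.trans (≡.cong₂ ℤ._+_ (act-+ d f g x n) (act-+ e f g x n))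
    (solve 4 (λ a b c d → (a :+ b) :+ (c :+ d) := (a :+ c) :+ (b :+ d)) ≡.refl (act d f x n) (act d g x n) (act e f x n) (act e g x n))
  act-+ (d ⊗ e) f g x n = ≡.trans (act-cong d (act-+ e f g) x n) (act-+ d (act e f) (act e g) x n)
  act-+ (⊖ e)   f g x n = ≡.trans (≡.cong ℤ.-_ (act-+ e f g x n)) (ℤ.neg-distrib-+ (act e f x n) (act e g x n))

  act-neg : ∀ e f → act e (λ x n → ℤ.- f x n) ≗₂ λ x n → ℤ.- act e f x n
  act-neg (T a)   f x n = ≡.refl
  act-neg Z       f x n = ≡.refl
  act-neg :0′     f x n = ≡.refl
  act-neg :1′     f x n = ≡.refl
  act-neg (d ⊕ e) f x n = ≡.trans (≡.cong₂ ℤ._+_ (act-neg d f x n) (act-neg e f x n))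
    (≡.sym (ℤ.neg-distrib-+ (act d f x n) (act e f x n)))
  act-neg (d ⊗ e) f x n = ≡.trans (act-cong d (act-neg e f) x n) (act-neg d (act e f) x n)
  act-neg (⊖ e)   f x n = ≡.cong ℤ.-_ (act-neg e f x n)

  act-0 : ∀ e → act e (λ _ _ → 0ℤ) ≗₂ λ _ _ → 0ℤ
  act-0 (T a)   x n = ≡.refl
  act-0 Z       x n = ≡.refl
  act-0 :0′     x n = ≡.refl
  act-0 :1′     x n = ≡.refl
  act-0 (d ⊕ e) x n = ≡.cong₂ ℤ._+_ (act-0 d x n) (act-0 e x n)
  act-0 (d ⊗ e) x n = ≡.trans (act-cong d (act-0 e) x n) (act-0 d x n)
  act-0 (⊖ e)   x n = ≡.cong ℤ.-_ (act-0 e x n)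

  act-periodic : ∀ e {f} → Periodic f → Periodic (act e f)
  act-periodic (T a) per = record
    { respects = λ n x∼y → respects per n (F.*-congˡ x∼y)
    ; window   = λ x n → window per (a F.* x) n
    }
  act-periodic Z {f} per = record
    { respects = λ n x∼y → respects per (suc n) x∼y
    ; window   = λ x n → ≡.trans (SZ.∑-cong p (λ i → ≡.cong (f x) (≡.sym (ℕ.+-suc (toℕ i) n)))) (window per x (suc n))
    }
  act-periodic :0′ per = record
    { respects = λ _ _ → ≡.refl ; window = λ x n → SZ.∑-zero p (λ _ → ≡.refl) }
  act-periodic :1′ per = record
    { respects = λ n x∼y → respects per n x∼y ; window = λ x n → window per x n }
  act-periodic (d ⊕ e) {f} per = record
    { respects = λ n x∼y → ≡.cong₂ ℤ._+_ (respects dp n x∼y) (respects ep n x∼y)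
    ; window   = λ x n → ≡.trans (SZ.∑-+ p (λ i → act d f x (toℕ i ℕ.+ n)) (λ i → act e f x (toℕ i ℕ.+ n)))
                           (≡.cong₂ ℤ._+_ (window dp x n) (window ep x n))
    }
    where dp = act-periodic d per ; ep = act-periodic e per
  act-periodic (d ⊗ e) per = act-periodic d (act-periodic e per)
  act-periodic (⊖ e) {f} per = record
    { respects = λ n x∼y → ≡.cong ℤ.-_ (respects ep n x∼y)
    ; window   = λ x n → ≡.trans (SZ.∑-cong p (λ i → ≡.sym (ℤ.-1*i≡-i (act e f x (toℕ i ℕ.+ n)))))
                   (≡.trans (≡.sym (SZ.∑-*ˡ p (ℤ.- 1ℤ) (λ i → act e f x (toℕ i ℕ.+ n))))
                     (≡.cong (ℤ.- 1ℤ ℤ.*_) (window ep x n)))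
    }
    where ep = act-periodic e per

  act-T-comm : ∀ a e {f} → Periodic f → act (T a) (act e f) ≗₂ act e (act (T a) f)
  act-T-comm a (T b)   per x n = respects per n (F.trans (F.sym (F.*-assoc b a x))
    (F.trans (F.*-congʳ (F.*-comm b a)) (F.*-assoc a b x)))
  act-T-comm a Z       per x n = ≡.refl
  act-T-comm a :0′     per x n = ≡.refl
  act-T-comm a :1′     per x n = ≡.refl
  act-T-comm a (d ⊕ e) per x n = ≡.cong₂ ℤ._+_ (act-T-comm a d per x n) (act-T-comm a e per x n)
  act-T-comm a (d ⊗ e) per x n = ≡.trans (act-T-comm a d (act-periodic e per) x n)
    (act-cong d (act-T-comm a e per) x n)
  act-T-comm a (⊖ e)   per x n = ≡.cong ℤ.-_ (act-T-comm a e per x n)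

  act-Z-comm : ∀ e f → act Z (act e f) ≗₂ act e (act Z f)
  act-Z-comm (T b)   f x n = ≡.refl
  act-Z-comm Z       f x n = ≡.refl
  act-Z-comm :0′     f x n = ≡.refl
  act-Z-comm :1′     f x n = ≡.refl
  act-Z-comm (d ⊕ e) f x n = ≡.cong₂ ℤ._+_ (act-Z-comm d f x n) (act-Z-comm e f x n)
  act-Z-comm (d ⊗ e) f x n = ≡.trans (act-Z-comm d (act e f) x n) (act-cong d (act-Z-comm e f) x n)
  act-Z-comm (⊖ e)   f x n = ≡.cong ℤ.-_ (act-Z-comm e f x n)

  act-comm : ∀ d e {f} → Periodic f → act d (act e f) ≗₂ act e (act d f)
  act-comm (T a)     e per x n = act-T-comm a e per x n
  act-comm Z         e {f} per x n = act-Z-comm e f x n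
  act-comm :0′       e per x n = ≡.sym (act-0 e x n)
  act-comm :1′       e per x n = ≡.refl
  act-comm (d₁ ⊕ d₂) e {f} per x n = ≡.trans (≡.cong₂ ℤ._+_ (act-comm d₁ e per x n) (act-comm d₂ e per x n))
    (≡.sym (act-+ e (act d₁ f) (act d₂ f) x n))
  act-comm (d₁ ⊗ d₂) e per x n = ≡.trans (act-cong d₁ (act-comm d₂ e per) x n)
    (act-comm d₁ e (act-periodic d₂ per) x n)
  act-comm (⊖ d)     e {f} per x n = ≡.trans (≡.cong ℤ.-_ (act-comm d e per x n)) (≡.sym (act-neg e (act d f) x n))

  record _≈_ (d e : Expr) : Set (c ⊔ ℓ) where
    constructor equal
    field
      agree : ∀ {f} → Periodic f → act d f ≗₂ act e f

  open _≈_

  shiftRing : CommutativeRing c (c ⊔ ℓ)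
  shiftRing = record
    { Carrier = Expr
    ; _≈_ = _≈_
    ; _+_ = _⊕_
    ; _*_ = _⊗_
    ; -_ = ⊖_
    ; 0# = :0′
    ; 1# = :1′
    ; isCommutativeRing = record
      { isRing = record
        { +-isAbelianGroup = record
          { isGroup = record
            { isMonoid = record
              { isSemigroup = record
                { isMagma = record
                  { isEquivalence = record
                    { refl  = equal λ _ _ _ → ≡.refl
                    ; sym   = λ d≈e → equal λ per x n → ≡.sym (agree d≈e per x n)
                    ; trans = λ d≈e e≈g → equal λ per x n → ≡.trans (agree d≈e per x n) (agree e≈g per x n)
                    }
                  ; ∙-cong = λ d≈d′ e≈e′ → equal λ per x n → ≡.cong₂ ℤ._+_ (agree d≈d′ per x n) (agree e≈e′ per x n)
                  }
                ; assoc = λ d e g → equal λ {f} _ x n → ℤ.+-assoc (act d f x n) (act e f x n) (act g f x n)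
                }
              ; identity = (λ d → equal λ {f} _ x n → ℤ.+-identityˡ (act d f x n)) ,
                           (λ d → equal λ {f} _ x n → ℤ.+-identityʳ (act d f x n))
              }
            ; inverse = (λ d → equal λ {f} _ x n → ℤ.+-inverseˡ (act d f x n)) ,
                        (λ d → equal λ {f} _ x n → ℤ.+-inverseʳ (act d f x n))
            ; ⁻¹-cong = λ d≈e → equal λ per x n → ≡.cong ℤ.-_ (agree d≈e per x n)
            }
          ; comm = λ d e → equal λ {f} _ x n → ℤ.+-comm (act d f x n) (act e f x n)
          }
        ; *-cong = λ {d} {d′} {e} {e′} d≈d′ e≈e′ → equal λ per x n →
            ≡.trans (agree d≈d′ (act-periodic e per) x n) (act-cong d′ (agree e≈e′ per) x n)
        ; *-assoc = λ d e g → equal λ _ _ _ → ≡.refl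
        ; *-identity = (λ d → equal λ _ _ _ → ≡.refl) , (λ d → equal λ _ _ _ → ≡.refl)
        ; distrib = (λ d e g → equal λ {f} _ → act-+ d (act e f) (act g f)) , (λ d e g → equal λ _ _ _ → ≡.refl)
        }
      ; *-comm = λ d e → equal (act-comm d e)
      }
    }

  open CommutativeRing shiftRing using (_-_; refl; sym; trans)
  open Sums shiftRing using (_^_; _×_)

  T-cong : ∀ {x y} → x ∼ y → T x ≈ T y
  T-cong x∼y = equal λ per x n → respects per n (F.*-congʳ x∼y)

  T-* : ∀ x y → T (x F.* y) ≈ T x ⊗ T y
  T-* x y = equal λ per z n → respects per n (F.trans (F.*-congʳ (F.*-comm x y)) (F.*-assoc y x z))

  T-1 : T F.1# ≈ :1′
  T-1 = equal λ per x n → respects per n (F.*-identityˡ x)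

  -- Follows by comparing the windows at n and n + 1.
  period : ∀ {f} → Periodic f → ∀ x n → f x (p ℕ.+ n) ≡ f x n
  period {f} per x n = ≡.sym (begin
    f x n                                                           ≡⟨ ℤ.+-identityʳ _ ⟨
    f x n ℤ.+ 0ℤ                                                    ≡⟨ ≡.cong (ℤ._+_ (f x n)) (≡.trans (SZ.∑-cong p (λ i → ≡.cong (f x) (≡.sym (ℕ.+-suc (toℕ i) n)))) (window per x (suc n))) ⟨
    f x n ℤ.+ SZ.∑ p (λ i → f x (suc (toℕ i) ℕ.+ n))                ≡⟨ SZ.∑-rotate p (λ i → f x (i ℕ.+ n)) ⟩
    f x (p ℕ.+ n) ℤ.+ SZ.∑ p (λ i → f x (toℕ i ℕ.+ n))              ≡⟨ ≡.cong (ℤ._+_ (f x (p ℕ.+ n))) (window per x n) ⟩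
    f x (p ℕ.+ n) ℤ.+ 0ℤ                                            ≡⟨ ℤ.+-identityʳ _ ⟩
    f x (p ℕ.+ n)                                                   ∎)

  Z^p≈1 : Z ^ p ≈ :1′
  Z^p≈1 = equal λ {f} per x n → ≡.trans (iterate p f x n) (period per x n)
    where
    iterate : ∀ k f x n → act (Z ^ k) f x n ≡ f x (k ℕ.+ n)
    iterate zero    f x n = ≡.refl
    iterate (suc k) f x n = ≡.trans (iterate k f x (suc n)) (≡.cong (f x) (ℕ.+-suc k n))

  π : Expr
  π = Z - :1′

  ×≡* : ∀ n z → n SZ.× z ≡ + n ℤ.* z
  ×≡* zero    z = ≡.sym (ℤ.*-zeroˡ z)
  ×≡* (suc n) z = ≡.trans (≡.cong (ℤ._+_ z) (×≡* n z)) (≡.sym (ℤ.suc-* (+ n) z))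

  -- A periodic function killed by π is constant in n, so p times it is a window.
  π-cancel : ∀ {d e} → π ⊗ d ≈ π ⊗ e → d ≈ e
  π-cancel {d} {e} πd≈πe = equal λ {f} per x n →
    ℤ.i-j≡0⇒i≡j _ _ (killed (λ x n → act d f x n ℤ.- act e f x n) (act-periodic (d - e) per)
      (λ x n → step {act d f x (suc n)} {act d f x n} {act e f x (suc n)} {act e f x n} (agree πd≈πe per x n)) x n)
    where
    step : ∀ {a b c d} → a ℤ.+ ℤ.- b ≡ c ℤ.+ ℤ.- d → a ℤ.- c ≡ b ℤ.- d
    step {a} {b} {c} {d} eq = ≡.trans
      (solve 3 (λ a b c → a :- c := (a :- b) :+ (b :- c)) ≡.refl a b c)
      (≡.trans (≡.cong (ℤ._+ (b ℤ.- c)) eq) (solve 3 (λ b c d → (c :- d) :+ (b :- c) := b :- d) ≡.refl b c d))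
    killed : ∀ f → Periodic f → (∀ x n → f x (suc n) ≡ f x n) → ∀ x n → f x n ≡ 0ℤ
    killed f per const x n with ℤ.i*j≡0⇒i≡0∨j≡0 (+ p) (begin
      + p ℤ.* f x n                                  ≡⟨ ×≡* p (f x n) ⟨
      p SZ.× f x n                                   ≡⟨ SZ.∑-const p (f x n) ⟨
      SZ.∑ p (λ _ → f x n)                           ≡⟨ SZ.∑-cong p (λ i → ≡.sym (shift (toℕ i))) ⟩
      SZ.∑ p (λ i → f x (toℕ i ℕ.+ n))               ≡⟨ window per x n ⟩
      0ℤ                                             ∎)
      where
      shift : ∀ i → f x (i ℕ.+ n) ≡ f x n
      shift zero    = ≡.refl
      shift (suc i) = ≡.trans (const x (i ℕ.+ n)) (shift i)
    ... | inj₁ +p≡0 = contradiction (ℤ.+-injective +p≡0) (ℕ.≢-nonZero⁻¹ p)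
    ... | inj₂ f≡0  = f≡0

  ε : Expr → K
  ε (T a)   = a
  ε Z       = F.1#
  ε :0′     = F.0#
  ε :1′     = F.1#
  ε (d ⊕ e) = ε d F.+ ε e
  ε (d ⊗ e) = ε d F.* ε e
  ε (⊖ e)   = F.- ε e

  infix 4 _≡ₚ_
  infixr 3 _ₚ,_
  record _≡ₚ_ (x y : ℤ) : Set where
    constructor _ₚ,_
    field
      k   : ℤ
      x≡  : x ≡ y ℤ.+ k ℤ.* + p

  ≡⇒≡ₚ : ∀ {x y} → x ≡ y → x ≡ₚ y
  ≡⇒≡ₚ {x} {y} x≡y = 0ℤ ₚ, ≡.trans x≡y (solve 2 (λ y p → y := y :+ :0 :* p) ≡.refl y (+ p))

  ≡ₚ-trans : ∀ {x y z} → x ≡ₚ y → y ≡ₚ z → x ≡ₚ z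
  ≡ₚ-trans {x} {y} {z} (k ₚ, x≡) (l ₚ, y≡) = k ℤ.+ l ₚ, ≡.trans x≡ (≡.trans (≡.cong (ℤ._+ k ℤ.* + p) y≡)
    (solve 4 (λ z k l p → (z :+ l :* p) :+ k :* p := z :+ (k :+ l) :* p) ≡.refl z k l (+ p)))

  ≡ₚ-sym : ∀ {x y} → x ≡ₚ y → y ≡ₚ x
  ≡ₚ-sym {x} {y} (k ₚ, x≡) = ℤ.- k ₚ, ≡.trans (solve 3 (λ y k p → y := (y :+ k :* p) :+ (:- k) :* p) ≡.refl y k (+ p))
    (≡.cong (ℤ._+ (ℤ.- k) ℤ.* + p) (≡.sym x≡))

  ≡ₚ-+ : ∀ {x x′ y y′} → x ≡ₚ x′ → y ≡ₚ y′ → x ℤ.+ y ≡ₚ x′ ℤ.+ y′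
  ≡ₚ-+ {x′ = x′} {y′ = y′} (k ₚ, x≡) (l ₚ, y≡) = k ℤ.+ l ₚ, ≡.trans (≡.cong₂ ℤ._+_ x≡ y≡)
    (solve 5 (λ x y k l p → (x :+ k :* p) :+ (y :+ l :* p) := (x :+ y) :+ (k :+ l) :* p) ≡.refl x′ y′ k l (+ p))

  ≡ₚ-neg : ∀ {x x′} → x ≡ₚ x′ → ℤ.- x ≡ₚ ℤ.- x′
  ≡ₚ-neg {x′ = x′} (k ₚ, x≡) = ℤ.- k ₚ, ≡.trans (≡.cong ℤ.-_ x≡)
    (solve 3 (λ x k p → :- (x :+ k :* p) := :- x :+ (:- k) :* p) ≡.refl x′ k (+ p))

  %≡ₚ : ∀ n → + n ≡ₚ + (n % p)
  %≡ₚ n = + (n / p) ₚ, ≡.trans (≡.cong +_ (m≡m%n+[m/n]*n n p))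
    (≡.trans (ℤ.pos-+ (n % p) _) (≡.cong (ℤ._+_ (+ (n % p))) (ℤ.pos-* (n / p) p)))

  tr-+ₚ : ∀ x y → + tr x ℤ.+ + tr y ≡ₚ + tr (x F.+ y)
  tr-+ₚ x y = ≡ₚ-trans (≡⇒≡ₚ (≡.sym (ℤ.pos-+ (tr x) (tr y))))
    (≡ₚ-trans (%≡ₚ (tr x ℕ.+ tr y)) (≡⇒≡ₚ (≡.cong +_ (tr-+ x y))))

  tr-resp : ∀ {x y} → x ∼ y → tr x ≡ tr y
  tr-resp x∼y = tr-cong (Tr-cong x∼y)

  tr-0 : + tr F.0# ≡ₚ 0ℤ
  tr-0 = ≡⇒≡ₚ (≡.cong +_ (tr-zero F.refl))

  tr-neg : ∀ x → ℤ.- (+ tr x) ≡ₚ + tr (F.- x)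
  tr-neg x = ≡ₚ-trans (≡⇒≡ₚ (solve 2 (λ t s → :- t := s :- (t :+ s)) ≡.refl (+ tr x) (+ tr (F.- x))))
    (≡ₚ-trans (≡ₚ-+ (≡⇒≡ₚ {+ tr (F.- x)} ≡.refl) (≡ₚ-neg (≡ₚ-trans (tr-+ₚ x (F.- x))
      (≡ₚ-trans (≡⇒≡ₚ (≡.cong +_ (tr-resp (F.-‿inverseʳ x)))) tr-0))))
      (≡⇒≡ₚ (ℤ.+-identityʳ _)))

  -- Modulo p, weight is invariant under the shift of periodic functions.
  weight : (ℕ → ℤ) → ℤ
  weight s = SZ.∑ p (λ i → + toℕ i ℤ.* s (toℕ i))

  -- Summation by parts: i s(i+1) + s(i+1) is the term of index i + 1 in the sum of i s(i), and
  -- rotating the indices exchanges the zero term at 0 for p s(p). For vanishing windows the second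
  -- sum on the left drops out.
  weight-shift : ∀ s → weight (λ n → s (suc n)) ℤ.+ SZ.∑ p (λ i → s (suc (toℕ i))) ≡ + p ℤ.* s p ℤ.+ weight s
  weight-shift s = begin
    weight (λ n → s (suc n)) ℤ.+ SZ.∑ p (λ i → s (suc (toℕ i)))
      ≡⟨ SZ.∑-+ p (λ i → + toℕ i ℤ.* s (suc (toℕ i))) (λ i → s (suc (toℕ i))) ⟨
    SZ.∑ p (λ i → + toℕ i ℤ.* s (suc (toℕ i)) ℤ.+ s (suc (toℕ i)))
      ≡⟨ SZ.∑-cong p (λ i → ≡.trans (ℤ.+-comm _ (s (suc (toℕ i)))) (≡.sym (ℤ.suc-* (+ toℕ i) _))) ⟩
    SZ.∑ p (λ i → + suc (toℕ i) ℤ.* s (suc (toℕ i)))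
      ≡⟨ ≡.trans (≡.cong (ℤ._+ SZ.∑ p (λ i → + suc (toℕ i) ℤ.* s (suc (toℕ i)))) (ℤ.*-zeroˡ (s 0))) (ℤ.+-identityˡ _) ⟨
    + 0 ℤ.* s 0 ℤ.+ SZ.∑ p (λ i → + suc (toℕ i) ℤ.* s (suc (toℕ i)))
      ≡⟨ SZ.∑-rotate p (λ i → + i ℤ.* s i) ⟩
    + p ℤ.* s p ℤ.+ weight s ∎

  -- The invariant that makes residues visible: an operator e multiplies the parameter a by `ε e`,
  -- by `act-traces`, so that a function with parameter 1 recovers `ε e` from the way e acts.
  Traces : Functions → K → Set c
  Traces f a = ∀ x → weight (f x) ≡ₚ + tr (a F.* x)

  weight-+ : ∀ s t → weight (λ n → s n ℤ.+ t n) ≡ weight s ℤ.+ weight t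
  weight-+ s t = ≡.trans (SZ.∑-cong p (λ i → ℤ.*-distribˡ-+ (+ toℕ i) (s (toℕ i)) (t (toℕ i))))
    (SZ.∑-+ p (λ i → + toℕ i ℤ.* s (toℕ i)) (λ i → + toℕ i ℤ.* t (toℕ i)))

  weight-*ˡ : ∀ z s → weight (λ n → z ℤ.* s n) ≡ z ℤ.* weight s
  weight-*ˡ z s = ≡.trans (SZ.∑-cong p (λ i → solve 3 (λ i z s → i :* (z :* s) := z :* (i :* s)) ≡.refl (+ toℕ i) z (s (toℕ i))))
    (≡.sym (SZ.∑-*ˡ p z (λ i → + toℕ i ℤ.* s (toℕ i))))

  weight-cong : ∀ {s t} → (∀ n → s n ≡ t n) → weight s ≡ weight t
  weight-cong st = SZ.∑-cong p (λ i → ≡.cong (+ toℕ i ℤ.*_) (st (toℕ i)))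

  act-traces : ∀ e {f a} → Periodic f → Traces f a → Traces (act e f) (ε e F.* a)
  act-traces (T b) {f} {a} per tf x = ≡ₚ-trans (tf (b F.* x)) (≡⇒≡ₚ (≡.cong +_ (tr-resp
    (F.trans (F.sym (F.*-assoc a b x)) (F.*-congʳ (F.*-comm a b))))))
  act-traces Z {f} {a} per tf x = ≡ₚ-trans (≡ₚ-trans (f x p ₚ, shifted) (tf x))
    (≡⇒≡ₚ (≡.cong +_ (tr-resp (F.*-congʳ (F.sym (F.*-identityˡ a))))))
    where
    shifted : weight (λ n → f x (suc n)) ≡ weight (f x) ℤ.+ f x p ℤ.* + p
    shifted = begin
      weight (λ n → f x (suc n))                  ≡⟨ ℤ.+-identityʳ _ ⟨
      weight (λ n → f x (suc n)) ℤ.+ 0ℤ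
        ≡⟨ ≡.cong (ℤ._+_ (weight (λ n → f x (suc n)))) (≡.trans (SZ.∑-cong p (λ i → ≡.cong (f x) (≡.sym (ℕ.+-comm (toℕ i) 1)))) (window per x 1)) ⟨
      weight (λ n → f x (suc n)) ℤ.+ SZ.∑ p (λ i → f x (suc (toℕ i)))   ≡⟨ weight-shift (f x) ⟩
      + p ℤ.* f x p ℤ.+ weight (f x)              ≡⟨ solve 3 (λ p z w → p :* z :+ w := w :+ z :* p) ≡.refl (+ p) (f x p) (weight (f x)) ⟩
      weight (f x) ℤ.+ f x p ℤ.* + p              ∎
  act-traces :0′ per tf x = ≡ₚ-trans (≡⇒≡ₚ (SZ.∑-zero p (λ i → ℤ.*-zeroʳ (+ toℕ i))))
    (≡ₚ-trans (≡ₚ-sym tr-0) (≡⇒≡ₚ (≡.cong +_ (tr-resp (F.sym (F.trans (F.*-congʳ (F.zeroˡ _)) (F.zeroˡ x)))))))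
  act-traces :1′ {f} {a} per tf x = ≡ₚ-trans (tf x) (≡⇒≡ₚ (≡.cong +_ (tr-resp (F.*-congʳ (F.sym (F.*-identityˡ a))))))
  act-traces (d ⊕ e) {f} {a} per tf x = ≡ₚ-trans (≡⇒≡ₚ (weight-+ (act d f x) (act e f x)))
    (≡ₚ-trans (≡ₚ-+ (act-traces d per tf x) (act-traces e per tf x))
      (≡ₚ-trans (tr-+ₚ _ _) (≡⇒≡ₚ (≡.cong +_ (tr-resp (F.sym
        (F.trans (F.*-congʳ (F.distribʳ a _ _)) (F.distribʳ x _ _))))))))
  act-traces (d ⊗ e) {f} {a} per tf x = ≡ₚ-trans (act-traces d (act-periodic e per) (act-traces e per tf) x)
    (≡⇒≡ₚ (≡.cong +_ (tr-resp (F.*-congʳ (F.sym (F.*-assoc _ _ a))))))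
  act-traces (⊖ e) {f} {a} per tf x = ≡ₚ-trans (≡⇒≡ₚ (weight-neg (act e f x)))
    (≡ₚ-trans (≡ₚ-neg (act-traces e per tf x)) (≡ₚ-trans (tr-neg _) (≡⇒≡ₚ (≡.cong +_ (tr-resp
      (F.trans (-‿distribˡ-* _ x) (F.*-congʳ (-‿distribˡ-* _ a))))))))
    where
    open import Algebra.Properties.Ring F.ring using (-‿distribˡ-*)
    weight-neg : ∀ s → weight (λ n → ℤ.- s n) ≡ ℤ.- weight s
    weight-neg s = ≡.trans (weight-cong (λ n → ≡.sym (ℤ.-1*i≡-i (s n))))
      (≡.trans (weight-*ˡ (ℤ.- 1ℤ) s) (ℤ.-1*i≡-i (weight s)))

  private
    δ₀ : ℕ → ℤ
    δ₀ zero    = 1ℤ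
    δ₀ (suc _) = 0ℤ

  pulse : ℕ → ℤ
  pulse n = δ₀ (n % p)

  pulse-window : ∀ n → SZ.∑ p (λ i → pulse (toℕ i ℕ.+ n)) ≡ 1ℤ
  pulse-window zero    = ≡.trans (SZ.∑-cong p (λ i → ≡.cong δ₀
      (≡.trans (≡.cong (_% p) (ℕ.+-identityʳ (toℕ i))) (m<n⇒m%n≡m (Fin.toℕ<n i)))))
    (initial p (ℕ.<⇒≤ 1<p))
    where
    initial : ∀ n → 0 < n → SZ.∑ n (λ i → δ₀ (toℕ i)) ≡ 1ℤ
    initial (suc n) _ = ≡.cong (ℤ._+_ 1ℤ) (SZ.∑-zero n (λ _ → ≡.refl))
  pulse-window (suc n) = ∙-cancelˡ (pulse n) _ _ (begin
    pulse n ℤ.+ SZ.∑ p (λ i → pulse (toℕ i ℕ.+ suc n))          ≡⟨ ≡.cong (ℤ._+_ (pulse n)) (SZ.∑-cong p (λ i → ≡.cong pulse (ℕ.+-suc (toℕ i) n))) ⟩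
    pulse n ℤ.+ SZ.∑ p (λ i → pulse (suc (toℕ i) ℕ.+ n))        ≡⟨ SZ.∑-rotate p (λ i → pulse (i ℕ.+ n)) ⟩
    pulse (p ℕ.+ n) ℤ.+ SZ.∑ p (λ i → pulse (toℕ i ℕ.+ n))      ≡⟨ ≡.cong₂ ℤ._+_ pulse-period (pulse-window n) ⟩
    pulse n ℤ.+ 1ℤ                                              ∎)
    where
    open import Algebra.Properties.Group (CommutativeRing.+-group ℤ.+-*-commutativeRing) using (∙-cancelˡ)
    pulse-period : pulse (p ℕ.+ n) ≡ pulse n
    pulse-period = ≡.cong δ₀ (≡.trans (≡.cong (_% p) (ℕ.+-comm p n)) ([m+n]%n≡m%n n p))

  -- Each window of `pulse` has sum 1, so the difference of `pulse` and its shift has vanishing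
  -- windows. The weight of that difference is 1 - p, hence 1 modulo p, which gives this function
  -- the parameter 1.
  test : Functions
  test x n = + tr x ℤ.* (pulse n ℤ.+ ℤ.- 1ℤ ℤ.* pulse (suc n))

  test-periodic : Periodic test
  test-periodic = record
    { respects = λ n x∼y → ≡.cong (λ t → + t ℤ.* _) (tr-resp x∼y)
    ; window   = λ x n → begin
        SZ.∑ p (λ i → test x (toℕ i ℕ.+ n))
          ≡⟨ SZ.∑-*ˡ p (+ tr x) _ ⟨
        + tr x ℤ.* SZ.∑ p (λ i → pulse (toℕ i ℕ.+ n) ℤ.+ ℤ.- 1ℤ ℤ.* pulse (suc (toℕ i ℕ.+ n)))
          ≡⟨ ≡.cong (+ tr x ℤ.*_) (≡.trans (SZ.∑-+ p (λ i → pulse (toℕ i ℕ.+ n)) _) (≡.cong₂ ℤ._+_ (pulse-window n)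
              (≡.trans (≡.sym (SZ.∑-*ˡ p (ℤ.- 1ℤ) (λ i → pulse (suc (toℕ i ℕ.+ n)))))
                (≡.cong (ℤ.- 1ℤ ℤ.*_) (≡.trans (SZ.∑-cong p (λ i → ≡.cong pulse (≡.sym (ℕ.+-suc (toℕ i) n)))) (pulse-window (suc n))))))) ⟩
        + tr x ℤ.* 0ℤ ≡⟨ ℤ.*-zeroʳ (+ tr x) ⟩
        0ℤ ∎
    }

  test-traces : Traces test F.1#
  test-traces x = ≡ₚ-trans (ℤ.- (+ tr x) ₚ, (begin
    weight (test x)                                                   ≡⟨ weight-*ˡ (+ tr x) (λ n → pulse n ℤ.+ ℤ.- 1ℤ ℤ.* pulse (suc n)) ⟩
    + tr x ℤ.* weight (λ n → pulse n ℤ.+ ℤ.- 1ℤ ℤ.* pulse (suc n))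
      ≡⟨ ≡.cong (+ tr x ℤ.*_) (≡.trans (weight-+ pulse (λ n → ℤ.- 1ℤ ℤ.* pulse (suc n))) (≡.cong (ℤ._+_ (weight pulse)) (weight-*ˡ (ℤ.- 1ℤ) (λ n → pulse (suc n))))) ⟩
    + tr x ℤ.* (weight pulse ℤ.+ ℤ.- 1ℤ ℤ.* weight (λ n → pulse (suc n)))
      ≡⟨ solve 3 (λ t w v → t :* (w :+ :- :1 :* v) := t :* (:1 :+ w :- (v :+ :1))) ≡.refl (+ tr x) (weight pulse) (weight (λ n → pulse (suc n))) ⟩
    + tr x ℤ.* (1ℤ ℤ.+ weight pulse ℤ.- (weight (λ n → pulse (suc n)) ℤ.+ 1ℤ))
      ≡⟨ ≡.cong (λ z → + tr x ℤ.* (1ℤ ℤ.+ weight pulse ℤ.- z)) shifted ⟩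
    + tr x ℤ.* (1ℤ ℤ.+ weight pulse ℤ.- (+ p ℤ.* 1ℤ ℤ.+ weight pulse))
      ≡⟨ solve 3 (λ t w p → t :* (:1 :+ w :- (p :* :1 :+ w)) := t :+ (:- t) :* p) ≡.refl (+ tr x) (weight pulse) (+ p) ⟩
    + tr x ℤ.+ ℤ.- (+ tr x) ℤ.* + p ∎))
    (≡⇒≡ₚ (≡.cong +_ (tr-resp (F.sym (F.*-identityˡ x)))))
    where
    pulse-p : pulse p ≡ 1ℤ
    pulse-p = ≡.cong δ₀ (n%n≡0 p)
    shifted : weight (λ n → pulse (suc n)) ℤ.+ 1ℤ ≡ + p ℤ.* 1ℤ ℤ.+ weight pulse
    shifted = begin
      weight (λ n → pulse (suc n)) ℤ.+ 1ℤ
        ≡⟨ ≡.cong (ℤ._+_ (weight (λ n → pulse (suc n)))) (≡.trans (SZ.∑-cong p (λ i → ≡.cong pulse (≡.sym (ℕ.+-comm (toℕ i) 1)))) (pulse-window 1)) ⟨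
      weight (λ n → pulse (suc n)) ℤ.+ SZ.∑ p (λ i → pulse (suc (toℕ i)))   ≡⟨ weight-shift pulse ⟩
      + p ℤ.* pulse p ℤ.+ weight pulse                                      ≡⟨ ≡.cong (λ z → + p ℤ.* z ℤ.+ weight pulse) pulse-p ⟩
      + p ℤ.* 1ℤ ℤ.+ weight pulse                                           ∎

  ≡ₚ-<-≡ : ∀ {m n} → m < p → n < p → + m ≡ₚ + n → m ≡ n
  ≡ₚ-<-≡ {m} {n} m<p n<p (k ₚ, eq) = go k eq
    where
    wrap : ∀ {m n} → m < p → n < p → ∀ k → m ≡ n ℕ.+ k ℕ.* p → m ≡ n
    wrap {m} {n} m<p n<p k eq = ≡.trans (≡.sym (m<n⇒m%n≡m m<p)) (≡.trans (≡.trans (≡.cong (_% p) eq) ([m+kn]%n≡m%n n k p)) (m<n⇒m%n≡m n<p))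
    go : ∀ k → + m ≡ + n ℤ.+ k ℤ.* + p → m ≡ n
    go (+ k) eq = wrap m<p n<p k (ℤ.+-injective (≡.trans eq
      (≡.trans (≡.cong (ℤ._+_ (+ n)) (≡.sym (ℤ.pos-* k p))) (≡.sym (ℤ.pos-+ n (k ℕ.* p))))))
    go ℤ.-[1+ k ] eq = ≡.sym (wrap n<p m<p (suc k) (ℤ.+-injective (≡.sym (begin
      + (m ℕ.+ suc k ℕ.* p)                         ≡⟨ ≡.trans (ℤ.pos-+ m (suc k ℕ.* p)) (≡.cong (ℤ._+_ (+ m)) (ℤ.pos-* (suc k) p)) ⟩
      + m ℤ.+ + suc k ℤ.* + p                       ≡⟨ ≡.cong (ℤ._+ + suc k ℤ.* + p) eq ⟩
      + n ℤ.+ ℤ.- (+ suc k) ℤ.* + p ℤ.+ + suc k ℤ.* + p ≡⟨ solve 3 (λ n k p → n :+ (:- k) :* p :+ k :* p := n) ≡.refl (+ n) (+ suc k) (+ p) ⟩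
      + n                                           ∎))))

  -- If z = `ε (d - e)` were nonzero, some x would satisfy tr (z x) = 1. But d - e kills `test`, so
  -- the weight at x, which is tr (z x) modulo p, is 0.
  ε-cong : ∀ {d e} → d ≈ e → ε d ∼ ε e
  ε-cong {d} {e} d≈e with ε (d - e) ≟K F.0#
  ... | yes z≈0 = x∙y⁻¹≈ε⇒x≈y _ _ z≈0
    where open import Algebra.Properties.Group F.+-group using (x∙y⁻¹≈ε⇒x≈y)
  ... | no z≉0 = contradiction (≡ₚ-<-≡ 1<p (ℕ.<⇒≤ 1<p)
    (≡ₚ-trans (≡⇒≡ₚ (≡.cong +_ (≡.sym tr≡1))) (≡ₚ-trans (≡ₚ-sym traces) (≡⇒≡ₚ vanish)))) λ ()
    where
    z = ε (d - e)
    y = proj₁ ∃tr≡1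
    x = inv z F.* y
    zx∼y : z F.* F.1# F.* x ∼ y
    zx∼y = F.trans (F.*-congʳ (F.*-identityʳ z)) (F.trans (F.sym (F.*-assoc z (inv z) y))
      (F.trans (F.*-congʳ (inverseʳ z≉0)) (F.*-identityˡ y)))
    tr≡1 : tr (z F.* F.1# F.* x) ≡ 1
    tr≡1 = ≡.trans (tr-resp zx∼y) (proj₂ ∃tr≡1)
    traces : weight (act (d - e) test x) ≡ₚ + tr (z F.* F.1# F.* x)
    traces = act-traces (d - e) test-periodic test-traces x
    vanish : weight (act (d - e) test x) ≡ 0ℤ
    vanish = SZ.∑-zero p (λ i → ≡.trans (≡.cong (+ toℕ i ℤ.*_)
      (≡.trans (≡.cong (ℤ._- act e test x (toℕ i)) (agree d≈e test-periodic x (toℕ i))) (ℤ.+-inverseʳ (act e test x (toℕ i)))))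
      (ℤ.*-zeroʳ (+ toℕ i)))

-- Trace sums as eigenvectors modulo π

-- U a = Σ_x tr (a / x) T x satisfies T b · U a = U (b a) and is additive modulo p.
module TraceSum {c ℓ c′ ℓ′ M} (F : FiniteField (ℕ.suc M) c ℓ) (p : ℕ.ℕ) (pr : Prime p) (E : ℕ.ℕ)
  (Q≡p^E : ℕ.suc M ≡ p ℕ.^ E) (R : CommutativeRing c′ ℓ′) where

  open ℕ using (ℕ; suc)
  open import Data.Nat.DivMod using (_%_; _/_; m≡m%n+[m/n]*n)
  open import Data.Product.Base using (∃; _,_)

  private
    module F = FiniteField F
    open F using () renaming (Carrier to K; _≈_ to _∼_; _≟_ to _≟K_)
  open FieldTheory F using (inv; inv-cong; inv-*; inverseʳ; inverse-cancels)
  open Trace F p pr E Q≡p^E using (Tr-cong; tr; tr-+; tr-cong; tr-zero; p≢0)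
  open CommutativeRing R hiding (zero)
  open Sums R
  open FieldSum F R
  open Solver R
  open import Relation.Binary.Reasoning.Setoid (CommutativeRing.setoid R)

  module TraceSums (T : K → Carrier) (T-cong : ∀ {x y} → x ∼ y → T x ≈ T y) (T-* : ∀ x y → T (x F.* y) ≈ T x * T y)
    (T-0 : T F.0# ≈ 0#) (π u : Carrier) (p≈πu : p × 1# ≈ π * u) where

    U : K → Carrier
    U a = ∑F (λ x → (tr (a F.* inv x) × 1#) * T x)

    U-cong : ∀ {a b} → a ∼ b → U a ≈ U b
    U-cong a∼b = ∑F-cong (λ x → *-congʳ (×-congˡ (tr-cong (Tr-cong (F.*-congʳ a∼b)))))

    U-0 : ∀ {a} → a ∼ F.0# → U a ≈ 0#
    U-0 a∼0 = ∑F-zero (λ x → trans (*-congʳ (×-congˡ (tr-zero (F.trans (F.*-congʳ a∼0) (F.zeroˡ _))))) (zeroˡ _))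

    infix 4 _≡π_
    _≡π_ : Carrier → Carrier → Set _
    x ≡π y = ∃ λ z → x ≈ y + π * z

    ≈⇒≡π : ∀ {x y} → x ≈ y → x ≡π y
    ≈⇒≡π {x} {y} x≈y = 0# , trans x≈y (solve 2 (λ y π → y := y :+ π :* :0) refl y π)

    ≡π-trans : ∀ {x y z} → x ≡π y → y ≡π z → x ≡π z
    ≡π-trans {z = z} (u , x≈) (v , y≈) = v + u , trans x≈ (trans (+-congʳ y≈)
      (solve 4 (λ z π u v → (z :+ π :* v) :+ π :* u := z :+ π :* (v :+ u)) refl z π u v))

    ≡π-+ : ∀ {x x′ y y′} → x ≡π x′ → y ≡π y′ → x + y ≡π x′ + y′
    ≡π-+ {x′ = x′} {y′ = y′} (u , x≈) (v , y≈) = u + v , trans (+-cong x≈ y≈)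
      (solve 5 (λ x y π u v → (x :+ π :* u) :+ (y :+ π :* v) := (x :+ y) :+ π :* (u :+ v)) refl x′ y′ π u v)

    ≡π-*ˡ : ∀ a {x y} → x ≡π y → a * x ≡π a * y
    ≡π-*ˡ a {y = y} (u , x≈) = a * u , trans (*-congˡ x≈)
      (solve 4 (λ a y π u → a :* (y :+ π :* u) := a :* y :+ π :* (a :* u)) refl a y π u)

    -- The representatives `tr` add up to a representative plus p times a carry, and p is a multiple
    -- of π.
    U-+ : ∀ a b → U a + U b ≡π U (a F.+ b)
    U-+ a b = u * carries , (begin
      U a + U b                         ≈⟨ ∑F-+ _ _ ⟨
      ∑F (λ x → (tr (a F.* inv x) × 1#) * T x + (tr (b F.* inv x) × 1#) * T x)
                                        ≈⟨ ∑F-cong (λ x → carrying x) ⟩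
      ∑F (λ x → (tr ((a F.+ b) F.* inv x) × 1#) * T x + (p × 1#) * ((carry x × 1#) * T x))
                                        ≈⟨ ∑F-+ _ _ ⟩
      U (a F.+ b) + ∑F (λ x → (p × 1#) * ((carry x × 1#) * T x))
                                        ≈⟨ +-congˡ (trans (sym (∑F-*ˡ (p × 1#) _)) (trans (*-congʳ p≈πu) (*-assoc π u carries))) ⟩
      U (a F.+ b) + π * (u * carries)   ∎)
      where
      carry : K → ℕ
      carry x = (tr (a F.* inv x) ℕ.+ tr (b F.* inv x)) / p
      carries = ∑F (λ x → (carry x × 1#) * T x)
      carrying : ∀ x → (tr (a F.* inv x) × 1#) * T x + (tr (b F.* inv x) × 1#) * T x ≈
        (tr ((a F.+ b) F.* inv x) × 1#) * T x + (p × 1#) * ((carry x × 1#) * T x)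
      carrying x = begin
        (m × 1#) * T x + (n × 1#) * T x                 ≈⟨ distribʳ (T x) _ _ ⟨
        (m × 1# + n × 1#) * T x                         ≈⟨ *-congʳ (sym (×-homo-+ 1# m n)) ⟩
        ((m ℕ.+ n) × 1#) * T x                          ≈⟨ *-congʳ (×-congˡ (m≡m%n+[m/n]*n (m ℕ.+ n) p)) ⟩
        (((m ℕ.+ n) % p ℕ.+ carry x ℕ.* p) × 1#) * T x  ≈⟨ *-congʳ (×-homo-+ 1# ((m ℕ.+ n) % p) _) ⟩
        (((m ℕ.+ n) % p) × 1# + (carry x ℕ.* p) × 1#) * T x
          ≈⟨ *-congʳ (+-cong (×-congˡ (≡.trans (tr-+ _ _) (tr-cong (Tr-cong (F.sym (F.distribʳ (inv x) a b)))))) (×1-homo-* (carry x) p)) ⟩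
        (tr ((a F.+ b) F.* inv x) × 1# + (carry x × 1#) * (p × 1#)) * T x
          ≈⟨ solve 4 (λ s c p t → (s :+ c :* p) :* t := s :* t :+ p :* (c :* t)) refl _ (carry x × 1#) (p × 1#) (T x) ⟩
        (tr ((a F.+ b) F.* inv x) × 1#) * T x + (p × 1#) * ((carry x × 1#) * T x) ∎
        where
        m = tr (a F.* inv x)
        n = tr (b F.* inv x)

    T*U : ∀ a b → T a * U b ≈ U (a F.* b)
    T*U a b with a ≟K F.0#
    ... | yes a∼0 = trans (trans (*-congʳ (trans (T-cong a∼0) T-0)) (zeroˡ _))
                      (sym (U-0 (F.trans (F.*-congʳ a∼0) (F.zeroˡ b))))
    ... | no a≁0  = begin
      T a * U b                                                   ≈⟨ ∑F-*ˡ (T a) _ ⟩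
      ∑F (λ x → T a * ((tr (b F.* inv x) × 1#) * T x))            ≈⟨ ∑F-cong scaled ⟩
      ∑F (λ x → (tr (a F.* b F.* inv (a F.* x)) × 1#) * T (a F.* x)) ≈⟨ ∑F-permute (a F.*_) (inv a F.*_) F.*-congˡ F.*-congˡ
                                                                       (inverse-cancels (inverseʳ a≁0)) (inverse-cancels (F.trans (F.*-comm _ _) (inverseʳ a≁0)))
                                                                       (λ x → (tr (a F.* b F.* inv x) × 1#) * T x)
                                                                       (λ x∼y → *-cong (×-congˡ (tr-cong (Tr-cong (F.*-congˡ (inv-cong x∼y))))) (T-cong x∼y)) ⟨
      U (a F.* b)                                                 ∎
      where
      module SolveK = Solver F.commutativeRing
      cancelled : ∀ x → b F.* inv x ∼ a F.* b F.* inv (a F.* x)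
      cancelled x = F.sym (F.trans (F.*-congˡ (inv-* a x)) (F.trans
        (SolveK.solve 4 (λ a b c d → (a SolveK.:* b) SolveK.:* (c SolveK.:* d) SolveK.:= (a SolveK.:* c) SolveK.:* (b SolveK.:* d)) F.refl a b (inv a) (inv x))
        (F.trans (F.*-congʳ (inverseʳ a≁0)) (F.*-identityˡ _))))
      scaled : ∀ x → T a * ((tr (b F.* inv x) × 1#) * T x) ≈ (tr (a F.* b F.* inv (a F.* x)) × 1#) * T (a F.* x)
      scaled x = trans (solve 3 (λ t n s → t :* (n :* s) := n :* (t :* s)) refl (T a) _ (T x))
        (*-cong (×-congˡ (tr-cong (Tr-cong (cancelled x)))) (sym (T-* a x)))

    T*U-≡π : ∀ b a → T b * U a ≡π U (b F.* a)
    T*U-≡π b a = ≈⇒≡π (T*U b a)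

    ζ*U : ∀ {z} a → π + 1# ≈ z → z * U a ≡π U (F.1# F.* a)
    ζ*U a π+1≈z = U a , trans (*-congʳ (sym π+1≈z))
      (trans (solve 2 (λ π u → (π :+ :1) :* u := u :+ π :* u) refl π (U a)) (+-congʳ (U-cong (F.sym (F.*-identityˡ a)))))

    0*U : ∀ a → 0# * U a ≡π U (F.0# F.* a)
    0*U a = ≈⇒≡π (trans (zeroˡ _) (sym (U-0 (F.zeroˡ a))))

    1*U : ∀ a → 1# * U a ≡π U (F.1# F.* a)
    1*U a = ≈⇒≡π (trans (*-identityˡ _) (U-cong (F.sym (F.*-identityˡ a))))

    +*U : ∀ {d e x y} a → d * U a ≡π U (x F.* a) → e * U a ≡π U (y F.* a) → (d + e) * U a ≡π U ((x F.+ y) F.* a)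
    +*U {d} {e} a dU eU = ≡π-trans (≈⇒≡π (distribʳ (U a) d e)) (≡π-trans (≡π-+ dU eU)
      (≡π-trans (U-+ _ _) (≈⇒≡π (U-cong (F.sym (F.distribʳ a _ _))))))

    **U : ∀ {d e x y} a → d * U (y F.* a) ≡π U (x F.* (y F.* a)) → e * U a ≡π U (y F.* a) →
      (d * e) * U a ≡π U ((x F.* y) F.* a)
    **U {d} {e} a dU eU = ≡π-trans (≈⇒≡π (*-assoc d e (U a))) (≡π-trans (≡π-*ˡ d eU)
      (≡π-trans dU (≈⇒≡π (U-cong (F.sym (F.*-assoc _ _ a))))))

    -- Follows from additivity alone: U (x a) + U (- x a) ≡ U 0 = 0 modulo π.
    neg*U : ∀ {e x} a → e * U a ≡π U (x F.* a) → (- e) * U a ≡π U ((F.- x) F.* a)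
    neg*U {e} {x} a eU = ≡π-trans (≈⇒≡π (solve 3 (λ e u v → (:- e) :* u := :- :1 :* (e :* u :+ v) :+ v) refl e (U a) (U (F.- x F.* a))))
      (≡π-trans (≡π-+ (≡π-*ˡ (- 1#) (≡π-trans (≡π-+ eU (≈⇒≡π refl)) (≡π-trans (U-+ _ _)
          (≈⇒≡π (U-0 (F.trans (F.sym (F.distribʳ a _ _)) (F.trans (F.*-congʳ (F.-‿inverseʳ x)) (F.zeroˡ a))))))))
        (≈⇒≡π refl))
      (≈⇒≡π (solve 1 (λ v → :- :1 :* :0 :+ v := v) refl (U (F.- x F.* a)))))

    -- Modulo π, multiplication by x carries `U 1` to `U e`, where e is the residue of x; for e = 0
    -- this is `U 0` = 0.
    kernel : ∀ {x e} → e ∼ F.0# → x * U F.1# ≡π U (e F.* F.1#) → ∃ λ y → U F.1# * x ≈ π * y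
    kernel {x} {e} e∼0 (y , eq) = y , (begin
      U F.1# * x                ≈⟨ *-comm _ x ⟩
      x * U F.1#                ≈⟨ eq ⟩
      U (e F.* F.1#) + π * y    ≈⟨ +-congʳ (U-0 (F.trans (F.*-identityʳ _) e∼0)) ⟩
      0# + π * y                ≈⟨ +-identityˡ _ ⟩
      π * y                     ∎)

-- The ramified discrete valuation ring

-- The localisation O of ShiftRing at the kernel of ε: a discrete valuation ring with residue field K
-- in which p has valuation p − 1.
module Model {c ℓ M} (F : FiniteField (ℕ.suc M) c ℓ) (p : ℕ.ℕ) (pr : Prime p) (E : ℕ.ℕ)
  (Q≡p^E : ℕ.suc M ≡ p ℕ.^ E) where

  open import Data.Fin.Base using (Fin; zero; suc)
  open ℕ using (ℕ; zero; suc)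
  open import Data.Product.Base using (∃; _,_; proj₁; proj₂) renaming (_×_ to _∧_)
  import Data.Nat.Properties as ℕₚ
  open import Function.Bundles using (Inverse)

  private
    module F = FiniteField F
    module SF = Sums F.commutativeRing
    module ΣF = FieldSum F F.commutativeRing
    module R = CommutativeRing
    open F using () renaming (_≈_ to _∼_)
    open Inverse F.enumeration using (from)
  open FieldTheory F using (inv; inv-cong; inv-involutive; *-≉0; -≉0; Q)
  open Trace F p pr E Q≡p^E using (Tr; Tr-cong; tr; tr×1; ∑-Tr-inv; p≢0; 1<p)
  open ShiftRing F p pr E Q≡p^E using (shiftRing; ε; Z; π; T) public
  private module SR = ShiftRing F p pr E Q≡p^E
  open SR using (_⊕_; _⊗_; ⊖_; :0′; :1′)

  Unit : R.Carrier shiftRing → Set ℓ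
  Unit w = ¬ ε w ∼ F.0#

  Unit-* : ∀ {v w} → Unit v → Unit w → Unit (v ⊗ w)
  Unit-* = *-≉0

  open Localisation shiftRing Unit F.1≉0 (λ {v} {w} → Unit-* {v} {w}) using (≈⇒≋; ≋-cancel; multiplier) renaming (localised to O) public

  open CommutativeRing O hiding (zero) public
  open Sums O public
  open FieldSum F O public
  open Solver O
  open import Relation.Binary.Reasoning.Setoid (CommutativeRing.setoid O)

  cancel : ∀ {w x y} → Unit w → w * x ≈ w * y → x ≈ y
  cancel {w} = ≋-cancel {w}

  ε-cong : ∀ {x y} → x ≈ y → ε x ∼ ε y
  ε-cong (multiplier w unit wx≈wy) = FieldTheory.*-cancelˡ F unit (SR.ε-cong wx≈wy)

  π-cancel : ∀ {x y} → π * x ≈ π * y → x ≈ y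
  π-cancel {x} {y} (multiplier w unit eq) = multiplier w unit (SR.π-cancel
    (R.trans shiftRing (swap x) (R.trans shiftRing eq (R.sym shiftRing (swap y)))))
    where
    open import Algebra.Properties.CommutativeSemigroup (R.*-commutativeSemigroup shiftRing) using (x∙yz≈y∙xz)
    swap : ∀ x → SR._≈_ (π ⊗ (w ⊗ x)) (w ⊗ (π ⊗ x))
    swap x = x∙yz≈y∙xz π w x

  T-cong : ∀ {x y} → x ∼ y → T x ≈ T y
  T-cong x∼y = ≈⇒≋ (SR.T-cong x∼y)

  T-* : ∀ x y → T (x F.* y) ≈ T x * T y
  T-* x y = ≈⇒≋ (SR.T-* x y)

  T-1 : T F.1# ≈ 1#
  T-1 = ≈⇒≋ SR.T-1

  -- T 0 is idempotent and 1 − T 0 is a unit.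
  T-0 : T F.0# ≈ 0#
  T-0 = cancel {1# - T F.0#} unit (begin
    (1# - T F.0#) * T F.0#        ≈⟨ solve 1 (λ t → (:1 :- t) :* t := t :- t :* t) refl (T F.0#) ⟩
    T F.0# - T F.0# * T F.0#      ≈⟨ +-congˡ (-‿cong (T-* F.0# F.0#)) ⟨
    T F.0# - T (F.0# F.* F.0#)    ≈⟨ +-congˡ (-‿cong (T-cong (F.zeroˡ F.0#))) ⟩
    T F.0# - T F.0#               ≈⟨ solve 2 (λ w t → t :- t := w :* :0) refl (1# - T F.0#) (T F.0#) ⟩
    (1# - T F.0#) * 0#            ∎)
    where
    unit : Unit (1# - T F.0#)
    unit eq = F.1≉0 (F.trans (F.sym (F.+-identityʳ F.1#)) (F.trans (F.+-congˡ -0∼0) eq))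
      where
      open import Algebra.Properties.Ring F.ring using (-0#≈0#)
      -0∼0 = F.sym -0#≈0#

  ζ^p≈1 : Z ^ p ≈ 1#
  ζ^p≈1 = trans (reflexive (same-power p)) (≈⇒≋ SR.Z^p≈1)
    where
    same-power : ∀ n → Z ^ n ≡ Sums._^_ shiftRing Z n
    same-power zero    = ≡.refl
    same-power (suc n) = ≡.cong (Z ⊗_) (same-power n)

  π+1≈ζ : π + 1# ≈ Z
  π+1≈ζ = solve 1 (λ z → z :- :1 :+ :1 := z) refl Z

  επ∼0 : ε π ∼ F.0#
  επ∼0 = F.-‿inverseʳ F.1#

  -- Cancel π from 1 = (1 + π)^p = 1 + p (π + π² c) + π^p.
  p-ramified : ∃ λ y → (p × 1#) * (1# + π * y) ≈ - (π ^ (p ℕ.∸ 1))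
  p-ramified = y , π-cancel (begin
    π * ((p × 1#) * (1# + π * y))   ≈⟨ solve 3 (λ π p y → π :* (p :* (:1 :+ π :* y)) := p :* (π :+ π :* π :* y)) refl π (p × 1#) y ⟩
    (p × 1#) * (π + π * π * y)      ≈⟨ solve 2 (λ a b → a := (:1 :+ a :+ b) :- :1 :- b) refl _ (π ^ p) ⟩
    (1# + (p × 1#) * (π + π * π * y) + π ^ p) - 1# - π ^ p ≈⟨ +-congʳ (+-congʳ (proj₂ (PrimeBinomial.prime-binomial O pr π))) ⟨
    (π + 1#) ^ p - 1# - π ^ p       ≈⟨ +-congʳ (+-congʳ (trans (^-congˡ p π+1≈ζ) ζ^p≈1)) ⟩
    1# - 1# - π ^ p                 ≈⟨ +-congˡ (-‿cong (trans (^-congʳ π (≡.sym (suc-p∸1))) refl)) ⟩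
    1# - 1# - π * π ^ (p ℕ.∸ 1)     ≈⟨ solve 2 (λ π z → :1 :- :1 :- π :* z := π :* :- z) refl π (π ^ (p ℕ.∸ 1)) ⟩
    π * - (π ^ (p ℕ.∸ 1))           ∎)
    where
    y = proj₁ (PrimeBinomial.prime-binomial O pr π)
    suc-p∸1 : suc (p ℕ.∸ 1) ≡ p
    suc-p∸1 = ℕₚ.suc-pred p

  -- In p = p (1 + π y) - π p y the first term is -π^(p-1), and p - 1 ≥ 1.
  p∈πO : ∃ λ y → p × 1# ≈ π * y
  p∈πO = divided (proj₁ p-ramified) (p ℕ.∸ 2) (proj₂ p-ramified) (≡.sym (ℕₚ.+-∸-assoc 1 1<p))
    where
    divided : ∀ y n {m} → (p × 1#) * (1# + π * y) ≈ - (π ^ m) → suc n ≡ m → ∃ λ y → p × 1# ≈ π * y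
    divided y n eq ≡.refl = - (π ^ n) - (p × 1#) * y , (begin
      p × 1#                                                ≈⟨ solve 3 (λ p π y → p := p :* (:1 :+ π :* y) :- π :* (p :* y)) refl (p × 1#) π y ⟩
      (p × 1#) * (1# + π * y) - π * ((p × 1#) * y)          ≈⟨ +-congʳ eq ⟩
      - (π * π ^ n) - π * ((p × 1#) * y)                    ≈⟨ solve 3 (λ π a b → :- (π :* a) :- π :* b := π :* (:- a :- b)) refl π (π ^ n) ((p × 1#) * y) ⟩
      π * (- (π ^ n) - (p × 1#) * y)                        ∎)

  open TraceSum F p pr E Q≡p^E O
  private
    open module TS = TraceSums T T-cong T-* T-0 π (proj₁ p∈πO) (proj₂ p∈πO)

  -- Induction on x as an expression; the cases are the lemmas on trace sums modulo π.
  *U : ∀ x a → x * U a ≡π U (ε x F.* a)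
  *U (SR.T b)  a = T*U-≡π b a
  *U SR.Z      a = ζ*U a π+1≈ζ
  *U :0′       a = 0*U a
  *U :1′       a = 1*U a
  *U (d ⊕ e)   a = +*U {d} {e} a (*U d a) (*U e a)
  *U (d ⊗ e)   a = **U {d} {e} a (*U d (ε e F.* a)) (*U e a)
  *U (⊖ e)     a = neg*U {e} a (*U e a)

  ε-× : ∀ n → ε (n × 1#) ∼ n SF.× F.1#
  ε-× zero    = F.refl
  ε-× (suc n) = F.+-congˡ (ε-× n)

  ε-∑ : ∀ n f → ε (∑ n f) ∼ SF.∑ n (λ i → ε (f i))
  ε-∑ zero    f = F.refl
  ε-∑ (suc n) f = F.+-congˡ (ε-∑ n _)

  ε-∑F : ∀ f → ε (∑F f) ∼ ΣF.∑F (λ x → ε (f x))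
  ε-∑F f = F.trans (ε-cong (∑F≈∑ f)) (F.trans (ε-∑ Q (λ i → f (from i))) (F.sym (ΣF.∑F≈∑ (λ x → ε (f x)))))

  -- The residue is the sum of Tr (1 / u) u, and the substitution u ↦ 1 / u turns it into the sum of
  -- Tr u / u, which is -1.
  Unit-U : Unit (U F.1#)
  Unit-U eq = -≉0 F.1≉0 (F.trans (F.sym ∑-Tr-inv)
    (F.trans (ΣF.∑F-permute inv inv inv-cong inv-cong inv-involutive inv-involutive (λ u → Tr u F.* inv u)
               (λ x∼y → F.*-cong (Tr-cong x∼y) (inv-cong x∼y)))
    (F.trans (ΣF.∑F-cong (λ u → F.*-cong (coefficient u) (inv-involutive u)))
    (F.trans (F.sym (ε-∑F (λ u → (tr (F.1# F.* inv u) × 1#) * T u))) eq))))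
    where
    coefficient : ∀ u → Tr (inv u) ∼ ε (tr (F.1# F.* inv u) × 1#)
    coefficient u = F.trans (Tr-cong (F.sym (F.*-identityˡ _)))
      (F.trans (F.sym (tr×1 _)) (F.sym (ε-× (tr (F.1# F.* inv u)))))

  kernel⊆πO : ∀ x → ε x ∼ F.0# → ∃ λ w → ∃ λ y → Unit w ∧ w * x ≈ π * y
  kernel⊆πO x εx∼0 = U F.1# , proj₁ U*x , Unit-U , proj₂ U*x
    where
    U*x : ∃ λ y → U F.1# * x ≈ π * y
    U*x = kernel {x} εx∼0 (*U x F.1#)

-- Valuations with respect to π

module Valuation where

  open import Data.Product.Base using (∃; proj₁; proj₂) renaming (_×_ to _∧_)
  open ℕ using (ℕ; zero; suc)

  -- The interface between the construction of O and the valuation theory: `T` is a multiplicative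
  -- section of the residue map `ε`, and `p-ramified` fixes the valuation of p as p - 1, because 1 +
  -- π y has residue 1.
  record RamifiedRing {c ℓ n} (F : FiniteField n c ℓ) (p : ℕ) : Set (lsuc (c ⊔ ℓ)) where
    private module F = FiniteField F
    field
      O : CommutativeRing c (c ⊔ ℓ)
    open CommutativeRing O
    open Sums O using (_^_; _×_)
    field
      ε       : Carrier → F.Carrier
      ε-cong  : ∀ {x y} → x ≈ y → ε x F.≈ ε y
      ε-+     : ∀ x y → ε (x + y) F.≈ ε x F.+ ε y
      ε-*     : ∀ x y → ε (x * y) F.≈ ε x F.* ε y
      ε-neg   : ∀ x → ε (- x) F.≈ F.- ε x
      ε-0     : ε 0# F.≈ F.0#
      ε-1     : ε 1# F.≈ F.1#
    Unit : Carrier → Set ℓ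
    Unit w = ¬ ε w F.≈ F.0#
    field
      cancel  : ∀ {w x y} → Unit w → w * x ≈ w * y → x ≈ y
      T       : F.Carrier → Carrier
      T-cong  : ∀ {x y} → x F.≈ y → T x ≈ T y
      T-*     : ∀ x y → T (x F.* y) ≈ T x * T y
      T-1     : T F.1# ≈ 1#
      T-0     : T F.0# ≈ 0#
      ε-T     : ∀ x → ε (T x) F.≈ x
      π       : Carrier
    ζ : Carrier
    ζ = π + 1#
    field
      ζ^p≈1     : ζ ^ p ≈ 1#
      ε-π       : ε π F.≈ F.0#
      π-cancel  : ∀ {x y} → π * x ≈ π * y → x ≈ y
      kernel⊆πO : ∀ x → ε x F.≈ F.0# → ∃ λ w → ∃ λ y → Unit w ∧ w * x ≈ π * y
      p-ramified : ∃ λ y → (p × 1#) * (1# + π * y) ≈ - (π ^ (p ℕ.∸ 1))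

  module _ {c ℓ M} (F : FiniteField (suc M) c ℓ) (p : ℕ) (pr : Prime p) (E : ℕ) (Q≡p^E : suc M ≡ p ℕ.^ E) where

    private
      module F = FiniteField F
      module Mod = Model F p pr E Q≡p^E

    ramifiedRing : RamifiedRing F p
    ramifiedRing = record
      { O          = Mod.O
      ; ε          = Mod.ε
      ; ε-cong     = Mod.ε-cong
      ; ε-+        = λ _ _ → F.refl
      ; ε-*        = λ _ _ → F.refl
      ; ε-neg      = λ _ → F.refl
      ; ε-0        = F.refl
      ; ε-1        = F.refl
      ; cancel     = λ {w} → Mod.cancel {w}
      ; T          = Mod.T
      ; T-cong     = Mod.T-cong
      ; T-*        = Mod.T-*
      ; T-1        = Mod.T-1
      ; T-0        = Mod.T-0
      ; ε-T        = λ _ → F.refl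
      ; π          = Mod.π
      ; ζ^p≈1      = Mod.trans (Mod.^-congˡ p Mod.π+1≈ζ) Mod.ζ^p≈1
      ; ε-π        = Mod.επ∼0
      ; π-cancel   = Mod.π-cancel
      ; kernel⊆πO  = Mod.kernel⊆πO
      ; p-ramified = Mod.p-ramified
      }

  module Valuations {c ℓ M} (F : FiniteField (suc M) c ℓ) (p : ℕ) (pr : Prime p) (E : ℕ) (Q≡p^E : suc M ≡ p ℕ.^ E)
    (V : RamifiedRing F p) where

    open import Data.Fin.Base using (Fin; zero; suc)
    open import Data.Nat.Divisibility using (_∣_; _∤_; divides)
    import Data.Nat.Properties as ℕₚ
    open import Function.Bundles using (Inverse)
    open BigOperator ℕₚ.+-0-commutativeMonoid using () renaming (big to sumℕ)

    open RamifiedRing V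
    private
      module F = FiniteField F
      module SF = Sums F.commutativeRing
      module ΣF = FieldSum F F.commutativeRing
      open F using () renaming (_≈_ to _∼_)
    open FieldTheory F using (*-≉0; Q)
    open Trace F p pr E Q≡p^E using (×1≈0⇒∣; p≢0)
    open CommutativeRing O hiding (zero)
    open Sums O
    open FieldSum F O
    open Solver O
    open import Algebra.Properties.Ring F.ring using (-0#≈0#)
    open import Relation.Binary.Reasoning.Setoid (CommutativeRing.setoid O)

    Unit-* : ∀ {x y} → Unit x → Unit y → Unit (x * y)
    Unit-* ux uy eq = *-≉0 ux uy (F.trans (F.sym (ε-* _ _)) eq)

    Unit-1 : Unit 1#
    Unit-1 eq = F.1≉0 (F.trans (F.sym ε-1) eq)

    Unit-neg : ∀ {x} → Unit x → Unit (- x)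
    Unit-neg {x} ux eq = ux (F.trans (ε-cong (solve 1 (λ x → x := :- (:- x)) refl x))
      (F.trans (ε-neg (- x)) (F.trans (F.-‿cong eq) -0#≈0#)))

    ε-π* : ∀ y → ε (π * y) ∼ F.0#
    ε-π* y = F.trans (ε-* π y) (F.trans (F.*-congʳ ε-π) (F.zeroˡ _))

    Unit-1+π : ∀ y → Unit (1# + π * y)
    Unit-1+π y eq = F.1≉0 (F.trans (F.sym (F.+-identityʳ F.1#))
      (F.trans (F.sym (F.+-cong ε-1 (ε-π* y))) (F.trans (F.sym (ε-+ _ _)) eq)))

    ε-× : ∀ n → ε (n × 1#) ∼ n SF.× F.1#
    ε-× zero    = ε-0
    ε-× (suc n) = F.trans (ε-+ _ _) (F.+-cong ε-1 (ε-× n))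

    ε-^ : ∀ x n → ε (x ^ n) ∼ ε x SF.^ n
    ε-^ x zero    = ε-1
    ε-^ x (suc n) = F.trans (ε-* _ _) (F.*-congˡ (ε-^ x n))

    ε-∑ : ∀ n f → ε (∑ n f) ∼ SF.∑ n (λ i → ε (f i))
    ε-∑ zero    f = ε-0
    ε-∑ (suc n) f = F.trans (ε-+ _ _) (F.+-congˡ (ε-∑ n _))

    ε-∑F : ∀ f → ε (∑F f) ∼ ΣF.∑F (λ x → ε (f x))
    ε-∑F f = F.trans (ε-cong (∑F≈∑ f)) (F.trans (ε-∑ Q (λ i → f (Inverse.from F.enumeration i)))
      (F.sym (ΣF.∑F≈∑ (λ x → ε (f x)))))

    -- Every element with nonzero residue becomes invertible, so v(x) ≥ s is divisibility by π ^ s up to such a factor.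
    infix 4 _≼_ _≐_

    record _≼_ (s : ℕ) (x : Carrier) : Set (c ⊔ ℓ) where
      constructor bounded
      field
        {w}   : Carrier
        unit  : Unit w
        y     : Carrier
        w*x≈  : w * x ≈ π ^ s * y

    record _≐_ (s : ℕ) (x : Carrier) : Set (c ⊔ ℓ) where
      constructor exact
      field
        {w}    : Carrier
        unit   : Unit w
        {y}    : Carrier
        unit-y : Unit y
        w*x≈   : w * x ≈ π ^ s * y

    ≐⇒≼ : ∀ {s x} → s ≐ x → s ≼ x
    ≐⇒≼ (exact u {y} _ eq) = bounded u y eq

    ≼-cong : ∀ {s x x′} → x ≈ x′ → s ≼ x → s ≼ x′
    ≼-cong x≈x′ (bounded u y eq) = bounded u y (trans (*-congˡ (sym x≈x′)) eq)

    ≐-cong : ∀ {s x x′} → x ≈ x′ → s ≐ x → s ≐ x′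
    ≐-cong x≈x′ (exact u uy eq) = exact u uy (trans (*-congˡ (sym x≈x′)) eq)

    ≼-zero : ∀ {s x} → x ≈ 0# → s ≼ x
    ≼-zero {s} {x} x≈0 = bounded Unit-1 0# (trans (*-congˡ x≈0) (solve 1 (λ a → :1 :* :0 := a :* :0) refl (π ^ s)))

    0≼ : ∀ {x} → 0 ≼ x
    0≼ {x} = bounded Unit-1 x refl

    ≼-+ : ∀ {s x y} → s ≼ x → s ≼ y → s ≼ x + y
    ≼-+ {s} {x} {y} (bounded {v} uv a vx≈) (bounded {w} uw b wy≈) = bounded (Unit-* uv uw) (w * a + v * b) (begin
      v * w * (x + y)                       ≈⟨ solve 4 (λ v w x y → v :* w :* (x :+ y) := w :* (v :* x) :+ v :* (w :* y)) refl v w x y ⟩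
      w * (v * x) + v * (w * y)             ≈⟨ +-cong (*-congˡ vx≈) (*-congˡ wy≈) ⟩
      w * (π ^ s * a) + v * (π ^ s * b)     ≈⟨ solve 5 (λ v w a b q → w :* (q :* a) :+ v :* (q :* b) := q :* (w :* a :+ v :* b)) refl v w a b (π ^ s) ⟩
      π ^ s * (w * a + v * b)               ∎)

    ≼-∑ : ∀ {s} n f → (∀ i → s ≼ f i) → s ≼ ∑ n f
    ≼-∑ zero    f s≼f = ≼-zero refl
    ≼-∑ (suc n) f s≼f = ≼-+ (s≼f zero) (≼-∑ n _ (λ i → s≼f (suc i)))

    private
      multiply : ∀ {s t v w x y a b} → v * x ≈ π ^ s * a → w * y ≈ π ^ t * b →
        (v * w) * (x * y) ≈ π ^ (s ℕ.+ t) * (a * b)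
      multiply {s} {t} {v} {w} {x} {y} {a} {b} vx≈ wy≈ = begin
        (v * w) * (x * y)               ≈⟨ solve 4 (λ v w x y → (v :* w) :* (x :* y) := (v :* x) :* (w :* y)) refl v w x y ⟩
        (v * x) * (w * y)               ≈⟨ *-cong vx≈ wy≈ ⟩
        (π ^ s * a) * (π ^ t * b)       ≈⟨ solve 4 (λ q r a b → (q :* a) :* (r :* b) := (q :* r) :* (a :* b)) refl (π ^ s) (π ^ t) a b ⟩
        (π ^ s * π ^ t) * (a * b)       ≈⟨ *-congʳ (sym (^-homo-* π s t)) ⟩
        π ^ (s ℕ.+ t) * (a * b)         ∎

    ≼-* : ∀ {s t x y} → s ≼ x → t ≼ y → s ℕ.+ t ≼ x * y
    ≼-* {s} {t} (bounded uv a vx≈) (bounded uw b wy≈) = bounded (Unit-* uv uw) (a * b) (multiply {s} {t} vx≈ wy≈)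

    ≐-* : ∀ {s t x y} → s ≐ x → t ≐ y → s ℕ.+ t ≐ x * y
    ≐-* {s} {t} (exact uv ua vx≈) (exact uw ub wy≈) = exact (Unit-* uv uw) (Unit-* ua ub) (multiply {s} {t} vx≈ wy≈)

    ≐-unit : ∀ {x} → Unit x → 0 ≐ x
    ≐-unit ux = exact Unit-1 ux refl

    ≐-∏ : ∀ n (s : Fin n → ℕ) f → (∀ i → s i ≐ f i) → sumℕ n s ≐ ∏ n f
    ≐-∏ zero    s f s≐f = ≐-unit Unit-1
    ≐-∏ (suc n) s f s≐f = ≐-* (s≐f zero) (≐-∏ n _ _ (λ i → s≐f (suc i)))

    ≼-mono : ∀ {s t x} → s ℕ.≤ t → t ≼ x → s ≼ x
    ≼-mono {s} {t} {x} s≤t (bounded {w} u y eq) = bounded u (π ^ (t ℕ.∸ s) * y) (begin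
      w * x                             ≈⟨ eq ⟩
      π ^ t * y                         ≈⟨ *-congʳ (trans (^-congʳ π (≡.sym (ℕₚ.m+[n∸m]≡n s≤t))) (^-homo-* π s (t ℕ.∸ s))) ⟩
      π ^ s * π ^ (t ℕ.∸ s) * y         ≈⟨ *-assoc _ _ _ ⟩
      π ^ s * (π ^ (t ℕ.∸ s) * y)       ∎)

    ≼-cancel : ∀ {s u x} → Unit u → s ≼ u * x → s ≼ x
    ≼-cancel {s} {u} {x} uu (bounded {w} uw y eq) = bounded (Unit-* uw uu) y (trans (*-assoc w u x) eq)

    ≐-cancel : ∀ {s u x} → Unit u → s ≐ u * x → s ≐ x
    ≐-cancel {s} {u} {x} uu (exact {w} uw uy eq) = exact (Unit-* uw uu) uy (trans (*-assoc w u x) eq)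

    π^-cancel : ∀ s {x y} → π ^ s * x ≈ π ^ s * y → x ≈ y
    π^-cancel zero    eq = trans (sym (*-identityˡ _)) (trans eq (*-identityˡ _))
    π^-cancel (suc s) eq = π^-cancel s (π-cancel (trans (sym (*-assoc π _ _)) (trans eq (*-assoc π _ _))))

    -- Multiplying by both unit multipliers and cancelling π^s leaves a unit equal to a multiple of
    -- π, whose residue is 0.
    ≐-⋠ : ∀ {s x} → s ≐ x → ¬ suc s ≼ x
    ≐-⋠ {s} {x} (exact {v} uv {a} ua vx≈) (bounded {w} uw b wx≈) = Unit-* uw ua (F.trans (ε-cong wa≈) (ε-π* (v * b)))
      where
      wa≈ : w * a ≈ π * (v * b)
      wa≈ = π^-cancel s (begin
        π ^ s * (w * a)           ≈⟨ solve 3 (λ q w a → q :* (w :* a) := w :* (q :* a)) refl (π ^ s) w a ⟩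
        w * (π ^ s * a)           ≈⟨ *-congˡ vx≈ ⟨
        w * (v * x)               ≈⟨ solve 3 (λ w v x → w :* (v :* x) := v :* (w :* x)) refl w v x ⟩
        v * (w * x)               ≈⟨ *-congˡ wx≈ ⟩
        v * (π * π ^ s * b)       ≈⟨ solve 4 (λ v p q b → v :* (p :* q :* b) := q :* (p :* (v :* b))) refl v π (π ^ s) b ⟩
        π ^ s * (π * (v * b))     ∎)

    ≐-≼⇒≤ : ∀ {s t x} → s ≐ x → t ≼ x → t ℕ.≤ s
    ≐-≼⇒≤ s≐x t≼x = ℕₚ.≮⇒≥ (λ s<t → ≐-⋠ s≐x (≼-mono s<t t≼x))

    -- Does the work of integrality: up to unit multipliers, a is a unit times a power of π, and
    -- both can be cancelled. It removes the factor Q from the character sum for the number of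
    -- points.
    ≐-injective : ∀ {s a x y} → s ≐ a → a * x ≈ a * y → x ≈ y
    ≐-injective {s} {a} {x} {y} (exact {w} uw {b} ub eq) ax≈ay = cancel ub (π^-cancel s (begin
      π ^ s * (b * x)     ≈⟨ *-assoc _ _ _ ⟨
      π ^ s * b * x       ≈⟨ *-congʳ eq ⟨
      w * a * x           ≈⟨ trans (*-assoc w a x) (trans (*-congˡ ax≈ay) (sym (*-assoc w a y))) ⟩
      w * a * y           ≈⟨ *-congʳ eq ⟩
      π ^ s * b * y       ≈⟨ *-assoc _ _ _ ⟩
      π ^ s * (b * y)     ∎))

    ≐-p : p ℕ.∸ 1 ≐ p × 1#
    ≐-p = exact (Unit-1+π (proj₁ p-ramified)) (Unit-neg Unit-1) (begin
      (1# + π * proj₁ p-ramified) * (p × 1#)    ≈⟨ *-comm _ _ ⟩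
      (p × 1#) * (1# + π * proj₁ p-ramified)    ≈⟨ proj₂ p-ramified ⟩
      - (π ^ (p ℕ.∸ 1))                         ≈⟨ solve 1 (λ q → :- q := q :* :- :1) refl _ ⟩
      π ^ (p ℕ.∸ 1) * - 1#                      ∎)

    ≐-p^ : ∀ v → v ℕ.* (p ℕ.∸ 1) ≐ (p ℕ.^ v) × 1#
    ≐-p^ zero    = ≐-cong (sym (+-identityʳ 1#)) (≐-unit Unit-1)
    ≐-p^ (suc v) = ≐-cong (sym (×1-homo-* p (p ℕ.^ v))) (≐-* ≐-p (≐-p^ v))

    ∤⇒Unit : ∀ {n} → p ∤ n → Unit (n × 1#)
    ∤⇒Unit {n} p∤n eq = p∤n (×1≈0⇒∣ n (F.trans (F.sym (ε-× n)) eq))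

    -- Passage from p-adic to π-adic valuations: the cofactor of p^v is prime to p, hence a unit,
    -- and each factor p counts p - 1.
    ≐-ℕ : ∀ {v n} → p ℕ.^ v ∣ n → p ℕ.^ suc v ∤ n → v ℕ.* (p ℕ.∸ 1) ≐ n × 1#
    ≐-ℕ {v} {n} (divides j ≡.refl) p^1+v∤n = ≐-cong (sym (×1-homo-* j (p ℕ.^ v)))
      (≐-* (≐-unit (∤⇒Unit {j} λ { (divides i ≡.refl) →
        p^1+v∤n (divides i (ℕₚ.*-assoc i p (p ℕ.^ v))) })) (≐-p^ v))

-- Digit sums in base p

module DigitSum (p : ℕ.ℕ) .{{nt : ℕ.NonTrivial p}} where

  open import Data.Digit using (Expansion; fromDigits; toDigits)
  open import Data.Fin.Base using (Fin; toℕ; fromℕ<)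
  open import Data.Fin.Properties using (toℕ<n; toℕ-fromℕ<)
  open import Data.List.Base using (List; []; _∷_; map)
  open ℕ using (ℕ; zero; suc; NonTrivial; NonZero; _+_; _*_; _∸_; _^_; _<_; _≤_; s≤s; nonTrivial⇒n>1; nonTrivial⇒nonZero)
  open import Data.Nat.DivMod
    using (_%_; _/_; m≡m%n+[m/n]*n; m%n<n; m<n⇒m%n≡m; [m+kn]%n≡m%n; m/n<m; m<n*o⇒m/o<n)
  open import Data.Nat.Divisibility using (_∤_; divides)
  open import Data.Nat.Induction using (<-rec)
  open import Data.Nat.ListAction using (sum)
  open import Data.Nat.Properties
  open import Data.Nat.Solver using (module +-*-Solver)
  open import Data.Product.Base using (∃; _,_; proj₁; proj₂; _×_)
  open import Defs using (digitSum)
  open import Relation.Binary.PropositionalEquality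
  open import Relation.Nullary.Decidable using (fromWitness)
  open +-*-Solver

  1<p : 1 < p
  1<p = nonTrivial⇒n>1 p

  instance
    p≢0 : NonZero p
    p≢0 = nonTrivial⇒nonZero p

  S : ℕ → ℕ
  S = digitSum p

  digits : ℕ → Expansion p
  digits n = proj₁ (toDigits p {fromWitness (nonTrivial⇒n>1 p)} n)

  fromDigits-digits : ∀ n → fromDigits (digits n) ≡ n
  fromDigits-digits n = proj₂ (toDigits p {fromWitness (nonTrivial⇒n>1 p)} n)

  division-unique : ∀ {d e x y} → d < p → e < p → d + x * p ≡ e + y * p → d ≡ e × x ≡ y
  division-unique {d} {e} {x} {y} d<p e<p eq = d≡e , *-cancelʳ-≡ x y p (+-cancelˡ-≡ d _ _ (trans eq (cong (_+ y * p) (sym d≡e))))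
    where
    d≡e : d ≡ e
    d≡e = trans (sym (m<n⇒m%n≡m d<p)) (trans (sym ([m+kn]%n≡m%n d x p))
      (trans (cong (_% p) eq) (trans ([m+kn]%n≡m%n e y p) (m<n⇒m%n≡m e<p))))

  zero-digits : ∀ (ds : Expansion p) → fromDigits ds ≡ 0 → sum (map toℕ ds) ≡ 0
  zero-digits []       _  = refl
  zero-digits (d ∷ ds) eq = cong₂ _+_ (m+n≡0⇒m≡0 (toℕ d) eq)
    (zero-digits ds (m*n≡0⇒m≡0 (fromDigits ds) p (m+n≡0⇒n≡0 (toℕ d) eq)))

  -- Expansions of the same number agree up to leading zeros.
  sum-unique : ∀ (ds es : Expansion p) → fromDigits ds ≡ fromDigits es → sum (map toℕ ds) ≡ sum (map toℕ es)
  sum-unique []       es       eq = sym (zero-digits es (sym eq))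
  sum-unique (d ∷ ds) []       eq = zero-digits (d ∷ ds) eq
  sum-unique (d ∷ ds) (e ∷ es) eq with division-unique (toℕ<n d) (toℕ<n e) eq
  ... | d≡e , eq′ = cong₂ _+_ d≡e (sum-unique ds es eq′)

  S-step : ∀ {d} n → d < p → S (d + n * p) ≡ d + S n
  S-step {d} n d<p = trans (sum-unique (digits (d + n * p)) (fromℕ< d<p ∷ digits n)
    (trans (fromDigits-digits (d + n * p)) (sym (cong₂ _+_ (toℕ-fromℕ< d<p) (cong (_* p) (fromDigits-digits n))))))
    (cong (_+ S n) (toℕ-fromℕ< d<p))

  S-0 : S 0 ≡ 0
  S-0 = zero-digits (digits 0) (fromDigits-digits 0)

  S-small : ∀ {d} → d < p → S d ≡ d
  S-small {d} d<p = trans (cong S (sym (+-identityʳ d))) (trans (S-step 0 d<p) (trans (cong (d +_) S-0) (+-identityʳ d)))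

  S-1 : S 1 ≡ 1
  S-1 = S-small 1<p

  S-rec : ∀ n → S n ≡ n % p + S (n / p)
  S-rec n = trans (cong S (m≡m%n+[m/n]*n n p)) (S-step (n / p) (m%n<n n p))

  S-*p : ∀ n → S (n * p) ≡ S n
  S-*p n = S-step n (<⇒≤ 1<p)

  -- If the last digit is p - 1, it becomes 0 and the carry goes to n / p, to which the induction
  -- hypothesis applies.
  S-suc-≤ : ∀ n → S (suc n) ≤ suc (S n)
  S-suc-≤ = <-rec _ rec
    where
    rec : ∀ n → (∀ {m} → m < n → S (suc m) ≤ suc (S m)) → S (suc n) ≤ suc (S n)
    rec n ih with suc (n % p) ≟ p
    ... | no ≢p = ≤-reflexive (trans (cong (λ k → S (suc k)) (m≡m%n+[m/n]*n n p))
      (trans (S-step (n / p) (≤∧≢⇒< (m%n<n n p) ≢p)) (cong suc (sym (S-rec n)))))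
    ... | yes ≡p = begin
      S (suc n)                              ≡⟨ cong (λ k → S (suc k)) (m≡m%n+[m/n]*n n p) ⟩
      S (suc (n % p) + n / p * p)            ≡⟨ cong (λ k → S (k + n / p * p)) ≡p ⟩
      S (suc (n / p) * p)                    ≡⟨ S-*p (suc (n / p)) ⟩
      S (suc (n / p))                        ≤⟨ ih (quotient<n n ≡p) ⟩
      suc (S (n / p))                        ≤⟨ s≤s (m≤n+m (S (n / p)) (n % p)) ⟩
      suc (n % p + S (n / p))                ≡⟨ cong suc (S-rec n) ⟨
      suc (S n)                              ∎
      where
      open ≤-Reasoning
      quotient<n : ∀ n → suc (n % p) ≡ p → n / p < n
      quotient<n zero    eq = contradiction (trans (sym eq) (cong suc (m<n⇒m%n≡m (<⇒≤ 1<p)))) (>⇒≢ 1<p)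
      quotient<n n@(suc _) _ = m/n<m n p 1<p

  +-digits : ∀ a b → a + b ≡ a % p + b % p + (a / p + b / p) * p
  +-digits a b = trans (cong₂ _+_ (m≡m%n+[m/n]*n a p) (m≡m%n+[m/n]*n b p))
    (solve 5 (λ x y z w p → (x :+ z :* p) :+ (y :+ w :* p) := (x :+ y) :+ (z :+ w) :* p) refl
      (a % p) (b % p) (a / p) (b / p) p)

  S-+-rec : ∀ a b → a % p + b % p + (S (a / p) + S (b / p)) ≡ S a + S b
  S-+-rec a b = trans
    (solve 4 (λ x y z w → (x :+ y) :+ (z :+ w) := (x :+ z) :+ (y :+ w)) refl (a % p) (b % p) (S (a / p)) (S (b / p)))
    (sym (cong₂ _+_ (S-rec a) (S-rec b)))

  -- Column addition: each carry trades p in one column for 1 in the next, so it can only lower the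
  -- digit sum.
  S-+ : ∀ a b → S (a + b) ≤ S a + S b
  S-+ = <-rec _ rec
    where
    rec : ∀ a → (∀ {m} → m < a → ∀ b → S (m + b) ≤ S m + S b) → ∀ b → S (a + b) ≤ S a + S b
    rec zero      ih b = m≤n+m (S b) (S 0)
    rec a@(suc _) ih b with a % p + b % p <? p
    ... | yes small = begin
      S (a + b)                                       ≡⟨ cong S (+-digits a b) ⟩
      S (a % p + b % p + (a / p + b / p) * p)         ≡⟨ S-step (a / p + b / p) small ⟩
      a % p + b % p + S (a / p + b / p)               ≤⟨ +-monoʳ-≤ (a % p + b % p) (ih (m/n<m a p 1<p) (b / p)) ⟩
      a % p + b % p + (S (a / p) + S (b / p))         ≡⟨ S-+-rec a b ⟩
      S a + S b                                       ∎
      where open ≤-Reasoning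
    ... | no carry = begin
      S (a + b)                                       ≡⟨ cong S split ⟩
      S (r + suc (a / p + b / p) * p)                 ≡⟨ S-step (suc (a / p + b / p)) r<p ⟩
      r + S (suc (a / p + b / p))                     ≤⟨ +-monoʳ-≤ r (≤-trans (S-suc-≤ (a / p + b / p)) (s≤s (ih (m/n<m a p 1<p) (b / p)))) ⟩
      r + suc (S (a / p) + S (b / p))                 ≡⟨ +-suc r _ ⟩
      suc r + (S (a / p) + S (b / p))                 ≤⟨ +-monoˡ-≤ _ (subst (suc r ≤_) r+p (≤-trans (≤-reflexive (+-comm 1 r)) (+-monoʳ-≤ r (<⇒≤ 1<p)))) ⟩
      a % p + b % p + (S (a / p) + S (b / p))         ≡⟨ S-+-rec a b ⟩
      S a + S b                                       ∎
      where
      open ≤-Reasoning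
      r = a % p + b % p ∸ p
      r+p : r + p ≡ a % p + b % p
      r+p = m∸n+n≡m (≮⇒≥ carry)
      r<p : r < p
      r<p = +-cancelʳ-< p r p (subst (_< p + p) (sym r+p) (+-mono-< (m%n<n a p) (m%n<n b p)))
      split : a + b ≡ r + suc (a / p + b / p) * p
      split = trans (+-digits a b) (trans (cong (_+ (a / p + b / p) * p) (sym r+p)) (+-assoc r p _))

  S-suc : ∀ n → p ∤ suc n → S (suc n) ≡ suc (S n)
  S-suc n p∤ = trans (cong (λ k → S (suc k)) (m≡m%n+[m/n]*n n p))
    (trans (S-step (n / p) (≤∧≢⇒< (m%n<n n p) λ eq → p∤ (divides (suc (n / p))
      (trans (cong suc (m≡m%n+[m/n]*n n p)) (cong (_+ n / p * p) eq)))))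
    (cong suc (sym (S-rec n))))

  -- Every power of p is 1 modulo p - 1. Together with the congruence for the sum of all r this
  -- makes the minimal cost an integer.
  S-∣ : ∀ n → ∃ λ k → n ≡ S n + k * (p ∸ 1)
  S-∣ = <-rec _ rec
    where
    rec : ∀ n → (∀ {m} → m < n → ∃ λ k → m ≡ S m + k * (p ∸ 1)) → ∃ λ k → n ≡ S n + k * (p ∸ 1)
    rec zero      ih = 0 , sym (trans (+-identityʳ (S 0)) S-0)
    rec n@(suc _) ih with ih (m/n<m n p 1<p)
    ... | k , eq = k + n / p , (begin
      n                                               ≡⟨ m≡m%n+[m/n]*n n p ⟩
      n % p + n / p * p                               ≡⟨ cong (λ q → n % p + n / p * q) (suc-pred p) ⟨
      n % p + n / p * suc (p ∸ 1)                     ≡⟨ cong (n % p +_) (*-suc (n / p) (p ∸ 1)) ⟩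
      n % p + (n / p + n / p * (p ∸ 1))               ≡⟨ cong (λ q → n % p + (q + n / p * (p ∸ 1))) eq ⟩
      n % p + (S (n / p) + k * (p ∸ 1) + n / p * (p ∸ 1))
        ≡⟨ solve 5 (λ d s k x q → d :+ (s :+ k :* q :+ x :* q) := d :+ s :+ (k :+ x) :* q) refl (n % p) (S (n / p)) k (n / p) (p ∸ 1) ⟩
      n % p + S (n / p) + (k + n / p) * (p ∸ 1)       ≡⟨ cong (_+ (k + n / p) * (p ∸ 1)) (S-rec n) ⟨
      S n + (k + n / p) * (p ∸ 1)                     ∎)
      where open ≡-Reasoning

  S-split : ∀ E a b → b < p ^ E → S (a * p ^ E + b) ≡ S a + S b
  S-split zero    a zero    _ = trans (cong S (trans (+-identityʳ (a * 1)) (*-identityʳ a))) (sym (trans (cong (S a +_) S-0) (+-identityʳ _)))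
  S-split zero    a (suc b) (s≤s ())
  S-split (suc E) a b b<p^ = begin
    S (a * (p * p ^ E) + b)                               ≡⟨ cong S split ⟩
    S (b % p + (a * p ^ E + b / p) * p)                   ≡⟨ S-step (a * p ^ E + b / p) (m%n<n b p) ⟩
    b % p + S (a * p ^ E + b / p)                         ≡⟨ cong (b % p +_) (S-split E a (b / p) (m<n*o⇒m/o<n (subst (b <_) (*-comm p (p ^ E)) b<p^))) ⟩
    b % p + (S a + S (b / p))                             ≡⟨ solve 3 (λ x y z → x :+ (y :+ z) := y :+ (x :+ z)) refl (b % p) (S a) (S (b / p)) ⟩
    S a + (b % p + S (b / p))                             ≡⟨ cong (S a +_) (S-rec b) ⟨
    S a + S b                                             ∎
    where
    open ≡-Reasoning
    split : a * (p * p ^ E) + b ≡ b % p + (a * p ^ E + b / p) * p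
    split = trans (cong (a * (p * p ^ E) +_) (m≡m%n+[m/n]*n b p))
      (solve 5 (λ a p q r x → a :* (p :* q) :+ (r :+ x :* p) := r :+ (a :* q :+ x) :* p) refl a p (p ^ E) (b % p) (b / p))

  S-max : ∀ E → S (p ^ E ∸ 1) ≡ E * (p ∸ 1)
  S-max zero    = S-0
  S-max (suc E) = trans (cong S split) (trans (S-step (p ^ E ∸ 1) (≤-reflexive (suc-pred p))) (cong (p ∸ 1 +_) (S-max E)))
    where
    instance _ = m^n≢0 p E
    split : p * p ^ E ∸ 1 ≡ (p ∸ 1) + (p ^ E ∸ 1) * p
    split = trans (cong (λ q → p * q ∸ 1) (sym (suc-pred (p ^ E))))
      (trans (cong (_∸ 1) (*-comm p (suc (p ^ E ∸ 1)))) (+-∸-comm _ (<⇒≤ 1<p)))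

  -- p ^ E a + b and a + b agree modulo p ^ E - 1, and S (a + b) ≤ S a + S b = S (p ^ E a + b).
  reduce : ∀ {M} E → suc M ≡ p ^ E → 0 < M → ∀ n →
    ∃ λ r → r < suc M × S r ≤ S n × (0 < n → 0 < r) × (∃ λ k → n ≡ r + k * M)
  reduce {M} E eq 0<M = <-rec _ rec
    where
    rec : ∀ n → (∀ {m} → m < n → ∃ λ r → r < suc M × S r ≤ S m × (0 < m → 0 < r) × (∃ λ k → m ≡ r + k * M)) →
      ∃ λ r → r < suc M × S r ≤ S n × (0 < n → 0 < r) × (∃ λ k → n ≡ r + k * M)
    rec n ih with n <? suc M
    ... | yes n<Q = n , n<Q , ≤-refl , (λ 0<n → 0<n) , (0 , sym (+-identityʳ n))
    ... | no n≮Q = folded (ih a+b<n)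
      where
      a = n / suc M
      b = n % suc M
      n≡ : n ≡ a + b + a * M
      n≡ = trans (m≡m%n+[m/n]*n n (suc M)) (solve 3 (λ a b m → b :+ a :* (con 1 :+ m) := a :+ b :+ a :* m) refl a b M)
      0<a : 0 < a
      0<a = n≢0⇒n>0 λ a≡0 → n≮Q (subst (_< suc M)
        (sym (trans (m≡m%n+[m/n]*n n (suc M)) (trans (cong (λ a → b + a * suc M) a≡0) (+-identityʳ _)))) (m%n<n n (suc M)))
      a+b<n : a + b < n
      a+b<n = subst (a + b <_) (sym n≡) (subst (_< a + b + a * M) (+-identityʳ (a + b)) (+-monoʳ-< (a + b) (*-mono-< 0<a 0<M)))
      Sn : S n ≡ S a + S b
      Sn = trans (cong S (trans (m≡m%n+[m/n]*n n (suc M)) (trans (+-comm b _) (cong (λ q → a * q + b) eq))))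
        (S-split E a b (subst (b <_) eq (m%n<n n (suc M))))
      folded : (∃ λ r → r < suc M × S r ≤ S (a + b) × (0 < a + b → 0 < r) × (∃ λ k → a + b ≡ r + k * M)) →
        ∃ λ r → r < suc M × S r ≤ S n × (0 < n → 0 < r) × (∃ λ k → n ≡ r + k * M)
      folded (r , r<Q , Sr≤ , pos , k , eq′) = r , r<Q , ≤-trans Sr≤ (≤-trans (S-+ a b) (≤-reflexive (sym Sn))) ,
        (λ _ → pos (≤-trans 0<a (m≤m+n a b))) , k + a ,
        trans n≡ (trans (cong (_+ a * M) eq′) (solve 4 (λ r k a m → r :+ k :* m :+ a :* m := r :+ (k :+ a) :* m) refl r k a M))

-- Exact powers of p, finite minimisation, and degrees in D

module Support where

  open import Defs
  open import Defs
  open import Relation.Binary.PropositionalEquality as ≡ using (_≡_; refl)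

  open import Data.Fin.Base using (Fin; zero; suc; toℕ; finToFun; funToFin)
  import Data.Fin.Properties as Fin
  open import Data.Fin.Subset using (Subset; _∈_; Nonempty; ⁅_⁆; inside)
  open import Data.Fin.Subset.Properties using (_∈?_; Empty-unique)
  open import Data.Integer.Base as ℤ using (+_)
  import Data.Integer.Properties as ℤ
  open import Data.List.Base as List using (List; _∷_; filter; upTo)
  open import Data.List.Extrema.Nat using (max≤v⁺; v≤max⁺)
  open import Data.List.Membership.Propositional.Properties using (∈-filter⁺; ∈-upTo⁺)
  open import Data.List.Relation.Unary.All as All using (All)
  open import Data.List.Relation.Unary.All.Properties using (all-filter)
  open import Data.List.Relation.Unary.Any as Any using (Any)
  open ℕ using (ℕ; zero; suc; NonZero; _<_; _≤_; z≤n; z<s; _∸_)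
  open import Data.Nat.Divisibility using (_∣_; _∤_; _∣?_; divides; ∣-trans; ∣⇒≤; 1∣_)
  open import Data.Nat.Induction using (<-rec)
  import Data.Nat.Properties as ℕ
  open import Data.Product.Base using (∃; _,_; _×_)
  open import Data.Rational.Base as ℚ using (ℚ)
  import Data.Rational.Properties as ℚ
  import Data.Rational.Unnormalised.Properties as ℚᵘ
  open import Data.Rational.Unnormalised.Base using (mkℚᵘ; *≤*; *≡*)
  open import Data.Sum.Base using (inj₂)
  open import Data.Vec.Base as Vec using (Vec; _∷_)
  import Data.Vec.Properties as Vec
  open import Relation.Nullary.Construct.Add.Supremum using ([_])
  open import Relation.Nullary.Decidable using (_×-dec_)

  -- The quotient is (q ^ m − 1) / (q − 1).
  pred∣pred^ : ∀ q .{{_ : NonZero q}} m → (q ∸ 1) ∣ (q ℕ.^ m ∸ 1)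
  pred∣pred^ q m = divides (ratio m) (≡.cong (_∸ 1) (≡.sym (ratio-correct m)))
    where
    ratio : ℕ → ℕ
    ratio zero    = 0
    ratio (suc j) = 1 ℕ.+ q ℕ.* ratio j
    ratio-correct : ∀ j → suc (ratio j ℕ.* (q ∸ 1)) ≡ q ℕ.^ j
    ratio-correct zero    = refl
    ratio-correct (suc j) = ≡.trans (≡.cong suc (ℕ.+-comm (q ∸ 1) _))
      (≡.trans (≡.sym (ℕ.+-suc (q ℕ.* ratio j ℕ.* (q ∸ 1)) (q ∸ 1)))
      (≡.trans (≡.cong₂ ℕ._+_ (ℕ.*-assoc q (ratio j) (q ∸ 1)) (ℕ.suc-pred q))
      (≡.trans (ℕ.+-comm _ q) (≡.trans (≡.sym (ℕ.*-suc q _)) (≡.cong (q ℕ.*_) (ratio-correct j))))))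

  -- With c the valuation of Q, this is the valuation of the power sum of exponent n when Q - 1
  -- divides n: the sum is Q for n = 0 and the unit Q - 1 otherwise.
  whenZero : ℕ → ℕ → ℕ
  whenZero c zero    = c
  whenZero c (suc _) = 0

  n<p^n : ∀ {p} → 1 < p → ∀ n → n < p ℕ.^ n
  n<p^n 1<p zero    = z<s
  n<p^n {p} 1<p (suc n) = ℕ.≤-<-trans (n<p^n 1<p n) (ℕ.^-monoʳ-< p 1<p (ℕ.n<1+n n))

  ν-unique : ∀ {p} → 1 < p → ∀ {n v} → 0 < n → p ℕ.^ v ∣ n → p ℕ.^ suc v ∤ n → ν p n ≡ [ v ]
  ν-unique {p} 1<p {n@(suc _)} {v} _ p^v∣n p^1+v∤n = ≡.cong [_] (ℕ.≤-antisym
    (max≤v⁺ {xs = candidates} z≤n (All.map bound (all-filter (λ v → p ℕ.^ v ∣? n) (upTo n))))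
    (v≤max⁺ 0 candidates (inj₂ (Any.map ℕ.≤-reflexive (∈-filter⁺ (λ v → p ℕ.^ v ∣? n)
      (∈-upTo⁺ (ℕ.<-≤-trans (n<p^n 1<p v) (∣⇒≤ p^v∣n))) p^v∣n)))))
    where
    candidates = filter (λ v → p ℕ.^ v ∣? n) (upTo n)
    bound : ∀ {w} → p ℕ.^ w ∣ n → w ≤ v
    bound {w} p^w∣n = ℕ.≮⇒≥ λ v<w → p^1+v∤n (∣-trans (divides (p ℕ.^ (w ∸ suc v))
      (≡.trans (≡.cong (p ℕ.^_) (≡.sym (ℕ.m∸n+n≡m v<w))) (ℕ.^-distribˡ-+-* p (w ∸ suc v) (suc v)))) p^w∣n)

  exponent : ∀ {p} → 1 < p → ∀ n → 0 < n → ∃ λ v → p ℕ.^ v ∣ n × p ℕ.^ suc v ∤ n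
  exponent {p} 1<p = <-rec _ rec
    where
    rec : ∀ n → (∀ {m} → m < n → 0 < m → ∃ λ v → p ℕ.^ v ∣ m × p ℕ.^ suc v ∤ m) → 0 < n → ∃ λ v → p ℕ.^ v ∣ n × p ℕ.^ suc v ∤ n
    rec n ih 0<n with p ∣? n
    ... | no p∤n = 0 , 1∣ n , λ p*1∣n → p∤n (≡.subst (_∣ n) (ℕ.*-identityʳ p) p*1∣n)
    ... | yes (divides j refl) with ih (ℕ.m<m*n j p {{j≢0}} 1<p) (ℕ.n≢0⇒n>0 (ℕ.≢-nonZero⁻¹ j {{j≢0}}))
      where
      j≢0 : NonZero j
      j≢0 = ℕ.≢-nonZero λ j≡0 → ℕ.<⇒≢ 0<n (≡.sym (≡.cong (ℕ._* p) j≡0))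
    ...   | v , divides i eq , p^∤ = suc v , divides i (≡.trans (≡.cong (ℕ._* p) eq) (≡.trans (ℕ.*-assoc i _ p) (≡.cong (i ℕ.*_) (ℕ.*-comm _ p)))) ,
      λ { (divides i eq) → p^∤ (divides i (ℕ.*-cancelʳ-≡ j _ p {{ℕ.>-nonZero (ℕ.<⇒≤ 1<p)}} (≡.trans eq
        (≡.trans (≡.cong (i ℕ.*_) (ℕ.*-comm p _)) (≡.sym (ℕ.*-assoc i _ p)))))) }

  argmin : ∀ {n} {P : Fin n → Set} → (∀ i → Dec (P i)) → (g : Fin n → ℕ) → ∃ P →
    ∃ λ i → P i × (∀ j → P j → g i ≤ g j)
  argmin {n} {P} P? g (i , Pi) = <-rec (λ x → ∀ i → g i ≡ x → P i → ∃ λ i → P i × (∀ j → P j → g i ≤ g j)) rec (g i) i refl Pi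
    where
    rec : ∀ x → (∀ {y} → y < x → ∀ i → g i ≡ y → P i → ∃ λ i → P i × (∀ j → P j → g i ≤ g j)) →
      ∀ i → g i ≡ x → P i → ∃ λ i → P i × (∀ j → P j → g i ≤ g j)
    rec x ih i refl Pi with Fin.any? (λ j → P? j ×-dec (g j ℕ.<? g i))
    ... | yes (j , Pj , gj<gi) = ih gj<gi j refl Pj
    ... | no minimal = i , Pi , λ j Pj → ℕ.≮⇒≥ (λ gj<gi → minimal (j , Pj , gj<gi))

  -- The enumeration `finToFun` reaches a given function only up to pointwise equality, so P and c
  -- are asked to respect it in place of function extensionality.
  argmin-function : ∀ {m n} {P : (Fin m → Fin n) → Set} → (∀ f → Dec (P f)) → (∀ {f g} → (∀ i → f i ≡ g i) → P f → P g) →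
    (c : (Fin m → Fin n) → ℕ) → (∀ {f g} → (∀ i → f i ≡ g i) → c f ≡ c g) → ∃ P →
    ∃ λ f → P f × (∀ g → P g → c f ≤ c g)
  argmin-function P? P-resp c c-resp (f , Pf)
    with argmin (λ i → P? (finToFun i)) (λ i → c (finToFun i)) (funToFin f , P-resp (λ i → ≡.sym (Fin.finToFun-funToFin f i)) Pf)
  ... | i , Pi , minimal = finToFun i , Pi , λ g Pg → ℕ.≤-trans
    (minimal (funToFin g) (P-resp (λ j → ≡.sym (Fin.finToFun-funToFin g j)) Pg)) (ℕ.≤-reflexive (c-resp (Fin.finToFun-funToFin g)))

  search : ∀ {m n} {P : (Fin m → Fin n) → Set} → (∀ f → Dec (P f)) → (∀ {f g} → (∀ i → f i ≡ g i) → P f → P g) →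
    Dec (∃ P)
  search P? P-resp with Fin.any? (λ i → P? (finToFun i))
  ... | yes (i , Pi) = yes (finToFun i , Pi)
  ... | no none = no λ (f , Pf) → none (funToFin f , P-resp (λ i → ≡.sym (Fin.finToFun-funToFin f i)) Pf)

  /-mono : ∀ {a b} d .{{_ : NonZero d}} → a ≤ b → + a ℚ./ d ℚ.≤ + b ℚ./ d
  /-mono {a} {b} (suc d) a≤b = ℚ.toℚᵘ-cancel-≤ (ℚᵘ.≤-trans (ℚᵘ.≤-reflexive (ℚ.toℚᵘ-fromℚᵘ (mkℚᵘ (+ a) d)))
    (ℚᵘ.≤-trans (*≤* (ℤ.*-monoʳ-≤-nonNeg (+ suc d) (ℤ.+≤+ a≤b))) (ℚᵘ.≤-reflexive (ℚᵘ.≃-sym (ℚ.toℚᵘ-fromℚᵘ (mkℚᵘ (+ b) d))))))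

  /-exact : ∀ c d .{{_ : NonZero d}} → + (c ℕ.* d) ℚ./ d ≡ + c ℚ./ 1
  /-exact c (suc d) = ℚ.fromℚᵘ-cong {mkℚᵘ (+ (c ℕ.* suc d)) d} {mkℚᵘ (+ c) 0}
    (*≡* (≡.trans (ℤ.*-identityʳ _) (ℤ.pos-* c (suc d))))

  -- The positive degree found here is the degree of the filler monomials that repair vanishing
  -- coordinate sums.
  nonzero-member : ∀ {b} (D : Subset (suc b)) → Nonempty D → ¬ D ≡ ⁅ zero ⁆ → ∃ λ d → 0 < d × ⟦ D ⟧ d
  nonzero-member {b} D (i , i∈D) D≢0 = cases (Fin.any? (λ i → suc i ∈? D))
    where
    cases : Dec (∃ λ i → suc i ∈ D) → ∃ λ d → 0 < d × ⟦ D ⟧ d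
    cases (yes (i , 1+i∈D)) = suc (toℕ i) , z<s , suc i , 1+i∈D , refl
    cases (no ∄) = contradiction (only-zero D i i∈D ∄) D≢0
      where
      only-zero : ∀ (D : Subset (suc b)) i → i ∈ D → ¬ (∃ λ i → suc i ∈ D) → D ≡ ⁅ zero ⁆
      only-zero D        (suc i) i∈D  ∄ = contradiction (i , i∈D) ∄
      only-zero (x ∷ D′) zero    Vec.here ∄ = ≡.cong (inside ∷_) (Empty-unique λ (i , i∈D′) → ∄ (i , Vec.there i∈D′))

-- Gauss sums and Stickelberger's theorem

module Gauss {c ℓ M} (F : FiniteField (ℕ.suc M) c ℓ) (p : ℕ.ℕ) (pr : Prime p) (E : ℕ.ℕ)
  (Q≡p^E : ℕ.suc M ≡ p ℕ.^ E) (V : Valuation.RamifiedRing F p) where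

  open import Data.Fin.Base using (Fin; zero; suc; toℕ; fromℕ)
  import Data.Fin.Properties as Fin
  open ℕ using (ℕ; zero; suc; NonZero; _<_; _≤_; s≤s; z≤n; z<s)
  open import Data.Nat.Divisibility using (_∣_; _∤_; divides; ∣⇒≤; _∣?_)
  open import Data.Nat.DivMod using (_%_; _/_; m≡m%n+[m/n]*n)
  open import Data.Nat.Induction using (<-rec)
  import Data.Nat.Properties as ℕₚ
  open import Data.Product.Base using (proj₁; proj₂)

  private
    module F = FiniteField F
    module SF = Sums F.commutativeRing
    module ΣF = FieldSum F F.commutativeRing
    module FS = Solver F.commutativeRing
    open F using () renaming (Carrier to K; _≈_ to _∼_; _≟_ to _≟K_)
  open FieldTheory F hiding (*-cancelˡ)
  open Trace F p pr E Q≡p^E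
  open Valuation.RamifiedRing V
  open Valuation.Valuations F p pr E Q≡p^E V
  open CommutativeRing O hiding (zero)
  open Sums O
  open FieldSum F O
  open Solver O
  open DigitSum p {{prime⇒nonTrivial pr}} using (S; S-0; S-1; S-*p; S-suc; S-max)
  open import Algebra.Properties.Group F.+-group using (x∙y⁻¹≈ε⇒x≈y)
  open import Relation.Binary.Reasoning.Setoid (CommutativeRing.setoid O)

  ψ : K → Carrier
  ψ u = ζ ^ tr u

  ζ^-% : ∀ n → ζ ^ n ≈ ζ ^ (n % p)
  ζ^-% n = begin
    ζ ^ n                               ≈⟨ ^-congʳ ζ (m≡m%n+[m/n]*n n p) ⟩
    ζ ^ (n % p ℕ.+ n / p ℕ.* p)         ≈⟨ ^-homo-* ζ (n % p) _ ⟩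
    ζ ^ (n % p) * ζ ^ (n / p ℕ.* p)     ≈⟨ *-congˡ (trans (^-congʳ ζ (ℕₚ.*-comm (n / p) p)) (sym (^-assocʳ ζ p (n / p)))) ⟩
    ζ ^ (n % p) * (ζ ^ p) ^ (n / p)     ≈⟨ *-congˡ (trans (^-congˡ (n / p) ζ^p≈1) (1^ (n / p))) ⟩
    ζ ^ (n % p) * 1#                    ≈⟨ *-identityʳ _ ⟩
    ζ ^ (n % p)                         ∎

  ψ-Tr : ∀ {u v} → Tr u ∼ Tr v → ψ u ≈ ψ v
  ψ-Tr eq = ^-congʳ ζ (tr-cong eq)

  ψ-cong : ∀ {u v} → u ∼ v → ψ u ≈ ψ v
  ψ-cong u∼v = ψ-Tr (Tr-cong u∼v)

  ψ-+ : ∀ u v → ψ (u F.+ v) ≈ ψ u * ψ v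
  ψ-+ u v = begin
    ζ ^ tr (u F.+ v)                ≈⟨ ^-congʳ ζ (tr-+ u v) ⟨
    ζ ^ ((tr u ℕ.+ tr v) % p)       ≈⟨ ζ^-% _ ⟨
    ζ ^ (tr u ℕ.+ tr v)             ≈⟨ ^-homo-* ζ (tr u) (tr v) ⟩
    ψ u * ψ v                       ∎

  ψ-0 : ψ F.0# ≈ 1#
  ψ-0 = ^-congʳ ζ (tr-zero F.refl)

  T-cancel : ∀ {x y} → ¬ x ∼ F.1# → (T x - 1#) * y ≈ 0# → y ≈ 0#
  T-cancel {x} {y} x≁1 eq = cancel unit (trans eq (sym (zeroʳ _)))
    where
    unit : Unit (T x - 1#)
    unit ε≈0 = x≁1 (x∙y⁻¹≈ε⇒x≈y x F.1# (F.trans (F.sym (F.trans (ε-+ _ _)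
      (F.+-cong (ε-T x) (F.trans (ε-neg 1#) (F.-‿cong ε-1))))) ε≈0))

  module Powers = CharacterSum F O
  τ : ℕ → Carrier
  τ = Powers.power-sum T T-cong T-* T-1 T-0 T-cancel

  τ-0 : τ 0 ≈ Q × 1#
  τ-0 = Powers.power-sum-0 T T-cong T-* T-1 T-0 T-cancel

  τ-∣ : ∀ n → .{{NonZero n}} → M ∣ n → τ n ≈ M × 1#
  τ-∣ = Powers.power-sum-∣ T T-cong T-* T-1 T-0 T-cancel

  τ-∤ : ∀ n → ¬ M ∣ n → τ n ≈ 0#
  τ-∤ = Powers.power-sum-∤ T T-cong T-* T-1 T-0 T-cancel

  T-^ : ∀ x n → T (x SF.^ n) ≈ T x ^ n
  T-^ = Powers.T-^ T T-cong T-* T-1 T-0 T-cancel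

  -- Translating by an element of trace 1 multiplies the sum by ζ.
  ∑ψ≈0 : ∑F ψ ≈ 0#
  ∑ψ≈0 = π-cancel (begin
    π * ∑F ψ                          ≈⟨ solve 2 (λ π s → π :* s := (π :+ :1) :* s :- s) refl π (∑F ψ) ⟩
    ζ * ∑F ψ - ∑F ψ                   ≈⟨ +-congʳ (trans (*-congʳ ζ≈ψy) (∑F-*ˡ (ψ y) ψ)) ⟩
    ∑F (λ u → ψ y * ψ u) - ∑F ψ       ≈⟨ +-congʳ (∑F-cong (λ u → sym (ψ-+ y u))) ⟩
    ∑F (λ u → ψ (y F.+ u)) - ∑F ψ     ≈⟨ +-congʳ (∑F-permute (y F.+_) (F.- y F.+_) F.+-congˡ F.+-congˡ
                                           (λ x → FS.solve 2 (λ y x → y FS.:+ (FS.:- y FS.:+ x) FS.:= x) F.refl y x)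
                                           (λ x → FS.solve 2 (λ y x → FS.:- y FS.:+ (y FS.:+ x) FS.:= x) F.refl y x) ψ ψ-cong) ⟨
    ∑F ψ - ∑F ψ                       ≈⟨ solve 2 (λ π s → s :- s := π :* :0) refl π (∑F ψ) ⟩
    π * 0#                            ∎)
    where
    y = proj₁ ∃tr≡1
    ζ≈ψy : ζ ≈ ψ y
    ζ≈ψy = trans (sym (*-identityʳ ζ)) (^-congʳ ζ (≡.sym (proj₂ ∃tr≡1)))

  ∑F-scale : ∀ {a} f → Respects f → ¬ a ∼ F.0# → ∑F f ≈ ∑F (λ x → f (a F.* x))
  ∑F-scale {a} f f-cong a≁0 = ∑F-permute (a F.*_) (inv a F.*_) F.*-congˡ F.*-congˡ
    (inverse-cancels (inverseʳ a≁0)) (inverse-cancels (F.trans (F.*-comm _ _) (inverseʳ a≁0))) f f-cong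

  ∑F-inv : ∀ f → Respects f → ∑F f ≈ ∑F (λ x → f (inv x))
  ∑F-inv = ∑F-permute inv inv inv-cong inv-cong inv-involutive inv-involutive

  orthogonality : ∀ a → ∑F (λ u → ψ (a F.* u)) ≈ [ a ≟K F.0# ] * (Q × 1#)
  orthogonality a with a ≟K F.0#
  ... | yes a∼0 = begin
    ∑F (λ u → ψ (a F.* u))        ≈⟨ ∑F-cong (λ u → trans (ψ-cong (F.trans (F.*-congʳ a∼0) (F.zeroˡ u))) ψ-0) ⟩
    ∑F (λ u → 1#)                 ≈⟨ ∑F-const 1# ⟩
    Q × 1#                        ≈⟨ *-identityˡ _ ⟨
    1# * (Q × 1#)                 ≈⟨ *-congʳ ([ a ≟K F.0# ]-yes a∼0) ⟨
    [ a ≟K F.0# ] * (Q × 1#)      ∎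
  ... | no a≁0 = begin
    ∑F (λ u → ψ (a F.* u))        ≈⟨ ∑F-scale ψ ψ-cong a≁0 ⟨
    ∑F ψ                          ≈⟨ ∑ψ≈0 ⟩
    0#                            ≈⟨ zeroˡ _ ⟨
    0# * (Q × 1#)                 ≈⟨ *-congʳ ([ a ≟K F.0# ]-no a≁0) ⟨
    [ a ≟K F.0# ] * (Q × 1#)      ∎

  T⁻¹ : K → Carrier
  T⁻¹ u = T (inv u)

  T⁻¹-cong : ∀ {u v} → u ∼ v → T⁻¹ u ≈ T⁻¹ v
  T⁻¹-cong u∼v = T-cong (inv-cong u∼v)

  T⁻¹-* : ∀ u v → T⁻¹ (u F.* v) ≈ T⁻¹ u * T⁻¹ v
  T⁻¹-* u v = trans (T-cong (inv-* u v)) (T-* _ _)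

  T⁻¹-0 : ∀ {u} → u ∼ F.0# → T⁻¹ u ≈ 0#
  T⁻¹-0 u∼0 = trans (T-cong (inv-0 u∼0)) T-0

  -- Formed with the inverse of the Teichmüller character, the normalisation in which the valuation
  -- is `S b`.
  gauss : ℕ → Carrier
  gauss b = ∑F (λ u → ψ u * T⁻¹ u ^ b)

  ∑T⁻¹^ : ∀ n → ¬ M ∣ n → ∑F (λ u → T⁻¹ u ^ n) ≈ 0#
  ∑T⁻¹^ n M∤n = trans (sym (∑F-inv (λ u → T u ^ n) (λ u∼v → ^-congˡ n (T-cong u∼v)))) (τ-∤ n M∤n)

  -- The exponents run over 1, ..., M and not 0, ..., M - 1, so that w = 0 obeys the same formula:
  -- the sum s satisfies (T w - 1) s = T w^Q - T w = 0 for every w.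
  geometric : ∀ w → ∑ M (λ r → T w ^ suc (toℕ r)) ≈ [ w ≟K F.1# ] * (M × 1#)
  geometric w with w ≟K F.1#
  ... | yes w∼1 = begin
    ∑ M (λ r → T w ^ suc (toℕ r))     ≈⟨ ∑-cong M (λ r → trans (^-congˡ (suc (toℕ r)) (trans (T-cong w∼1) T-1)) (1^ (suc (toℕ r)))) ⟩
    ∑ M (λ r → 1#)                    ≈⟨ ∑-const M 1# ⟩
    M × 1#                            ≈⟨ *-identityˡ _ ⟨
    1# * (M × 1#)                     ≈⟨ *-congʳ ([ w ≟K F.1# ]-yes w∼1) ⟨
    [ w ≟K F.1# ] * (M × 1#)          ∎
  ... | no w≁1 = trans (T-cancel w≁1 (begin
    (T w - 1#) * s                    ≈⟨ solve 2 (λ t s → (t :- :1) :* s := (t :* :1 :+ t :* s) :- t :- s) refl (T w) s ⟩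
    (T w * 1# + T w * s) - T w - s    ≈⟨ +-congʳ (+-congʳ (+-congˡ (∑-*ˡ M (T w) (λ r → T w ^ suc (toℕ r))))) ⟩
    (T w * 1# + ∑ M (λ r → T w ^ suc (suc (toℕ r)))) - T w - s ≈⟨ +-congʳ (+-congʳ (∑-rotate M (λ r → T w ^ suc r))) ⟩
    (T w ^ suc M + s) - T w - s       ≈⟨ +-congʳ (+-congʳ (+-congʳ (trans (sym (T-^ w Q)) (T-cong (fermat′ w))))) ⟩
    (T w + s) - T w - s               ≈⟨ solve 2 (λ t s → t :+ s :- t :- s := :0) refl (T w) s ⟩
    0#                                ∎))
    (trans (sym (zeroˡ _)) (*-congʳ (sym ([ w ≟K F.1# ]-no w≁1))))
    where s = ∑ M (λ r → T w ^ suc (toℕ r))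

  -- The coefficients of M ψ(u) as a polynomial in T u; the factor M saves a division. The powers 0
  -- and M of T u differ only at u = 0, where M ψ(0) = M dictates the constant coefficient.
  -- Subtracting M in degree M corrects this for u ≠ 0, and leaves -1 - M = -Q there, whose
  -- valuation is again `S M`.
  coefficient : ℕ → Carrier
  coefficient zero    = M × 1#
  coefficient (suc r) = gauss (suc r) - [ suc r ℕₚ.≟ M ] * (M × 1#)

  T^M : ∀ {u} → ¬ u ∼ F.0# → T u ^ M ≈ 1#
  T^M {u} u≁0 = trans (sym (T-^ u M)) (trans (T-cong (fermat u≁0)) T-1)

  fourier : ∀ u → (M × 1#) * ψ u ≈ ∑ Q (λ r → coefficient (toℕ r) * T u ^ toℕ r)
  fourier u with u ≟K F.0#
  ... | yes u∼0 = begin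
    (M × 1#) * ψ u                            ≈⟨ *-congˡ (trans (ψ-cong u∼0) ψ-0) ⟩
    (M × 1#) * 1#                             ≈⟨ +-identityʳ _ ⟨
    (M × 1#) * 1# + 0#                        ≈⟨ +-congˡ (∑-zero M (λ r → trans (*-congˡ (trans (*-congʳ (trans (T-cong u∼0) T-0)) (zeroˡ _))) (zeroʳ _))) ⟨
    ∑ Q (λ r → coefficient (toℕ r) * T u ^ toℕ r) ∎
  ... | no u≁0 = sym (begin
    (M × 1#) * 1# + ∑ M (λ r → coefficient (suc (toℕ r)) * T u ^ suc (toℕ r))
      ≈⟨ +-congˡ (∑-cong M (λ r → solve 3 (λ g d t → (g :- d) :* t := g :* t :+ d :* (:- :1 :* t)) refl _ _ _)) ⟩
    (M × 1#) * 1# + ∑ M (λ r → gauss (suc (toℕ r)) * T u ^ suc (toℕ r) + [ suc (toℕ r) ℕₚ.≟ M ] * (M × 1#) * (- 1# * T u ^ suc (toℕ r)))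
      ≈⟨ +-congˡ (∑-+ M (λ r → gauss (suc (toℕ r)) * T u ^ suc (toℕ r)) (λ r → [ suc (toℕ r) ℕₚ.≟ M ] * (M × 1#) * (- 1# * T u ^ suc (toℕ r)))) ⟩
    (M × 1#) * 1# + (∑ M (λ r → gauss (suc (toℕ r)) * T u ^ suc (toℕ r)) + ∑ M (λ r → [ suc (toℕ r) ℕₚ.≟ M ] * (M × 1#) * (- 1# * T u ^ suc (toℕ r))))
      ≈⟨ +-congˡ (+-cong gauss-part last-part) ⟩
    (M × 1#) * 1# + ((M × 1#) * ψ u + (M × 1#) * - 1#)
      ≈⟨ solve 2 (λ m s → m :* :1 :+ (m :* s :+ m :* :- :1) := m :* s) refl (M × 1#) (ψ u) ⟩
    (M × 1#) * ψ u ∎)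
    where
    last-part : ∑ M (λ r → [ suc (toℕ r) ℕₚ.≟ M ] * (M × 1#) * (- 1# * T u ^ suc (toℕ r))) ≈ (M × 1#) * - 1#
    last-part = trans (∑-cong M (λ r → trans (*-assoc _ _ _) (*-congˡ (*-congˡ (*-congˡ refl)))))
      (trans (only-last M 0<M (λ r → (M × 1#) * (- 1# * T u ^ r)))
        (*-congˡ (trans (*-congˡ (T^M u≁0)) (*-identityʳ _))))
      where
      only-last : ∀ m → 0 < m → (f : ℕ → Carrier) → ∑ m (λ r → [ suc (toℕ r) ℕₚ.≟ m ] * f (suc (toℕ r))) ≈ f m
      only-last m@(suc m′) _ f = trans (∑-cong m (λ r → *-congʳ {f (suc (toℕ r))} (same r))) (trans (∑-δ m (fromℕ m′) (λ r → f (suc (toℕ r))))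
        (reflexive (≡.cong (λ k → f (suc k)) (Fin.toℕ-fromℕ m′))))
        where
        same : ∀ r → [ suc (toℕ r) ℕₚ.≟ m ] ≈ [ r Fin.≟ fromℕ m′ ]
        same r = indicator-cong (suc (toℕ r) ℕₚ.≟ m) (r Fin.≟ fromℕ m′)
          (λ eq → Fin.toℕ-injective (≡.trans (ℕₚ.suc-injective eq) (≡.sym (Fin.toℕ-fromℕ m′))))
          (λ eq → ≡.cong suc (≡.trans (≡.cong toℕ eq) (Fin.toℕ-fromℕ m′)))
    regroup : ∀ v r → ψ v * T⁻¹ v ^ r * T u ^ r ≈ ψ v * T (u F.* inv v) ^ r
    regroup v r = trans (*-assoc _ _ _) (*-congˡ (trans (sym (^-distrib-* (T⁻¹ v) (T u) r))
      (^-congˡ r (trans (*-comm _ _) (sym (T-* u (inv v)))))))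
    diagonal : ∀ v → [ (u F.* inv v) ≟K F.1# ] ≈ [ v ≟K u ]
    diagonal v = indicator-cong ((u F.* inv v) ≟K F.1#) (v ≟K u) equal
      (λ v∼u → F.trans (F.*-congˡ (inv-cong v∼u)) (inverseʳ u≁0))
      where
      equal : u F.* inv v ∼ F.1# → v ∼ u
      equal eq with v ≟K F.0#
      ... | yes v∼0 = contradiction (F.trans (F.sym eq) (F.trans (F.*-congˡ (inv-0 v∼0)) (F.zeroʳ u))) F.1≉0
      ... | no v≁0  = F.trans (F.sym (F.*-identityˡ v)) (F.trans (F.*-congʳ (F.sym eq)) (F.trans (F.*-assoc _ _ _)
        (F.trans (F.*-congˡ (F.trans (F.*-comm _ _) (inverseʳ v≁0))) (F.*-identityʳ u))))
    -- Fourier inversion: after exchanging the sums, the geometric sum in u / v isolates v = u.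
    gauss-part : ∑ M (λ r → gauss (suc (toℕ r)) * T u ^ suc (toℕ r)) ≈ (M × 1#) * ψ u
    gauss-part = begin
      ∑ M (λ r → gauss (suc (toℕ r)) * T u ^ suc (toℕ r))
        ≈⟨ ∑-cong M (λ r → trans (∑F-*ʳ (λ v → ψ v * T⁻¹ v ^ suc (toℕ r)) (T u ^ suc (toℕ r))) (∑F-cong (λ v → regroup v (suc (toℕ r))))) ⟩
      ∑ M (λ r → ∑F (λ v → ψ v * T (u F.* inv v) ^ suc (toℕ r)))
        ≈⟨ ∑F-∑ M (λ v r → ψ v * T (u F.* inv v) ^ suc (toℕ r)) ⟨
      ∑F (λ v → ∑ M (λ r → ψ v * T (u F.* inv v) ^ suc (toℕ r)))
        ≈⟨ ∑F-cong (λ v → trans (sym (∑-*ˡ M (ψ v) (λ r → T (u F.* inv v) ^ suc (toℕ r)))) (*-congˡ (trans (geometric (u F.* inv v)) (*-congʳ (diagonal v))))) ⟩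
      ∑F (λ v → ψ v * ([ v ≟K u ] * (M × 1#)))
        ≈⟨ ∑F-cong (λ v → solve 3 (λ s d m → s :* (d :* m) := d :* (m :* s)) refl (ψ v) [ v ≟K u ] (M × 1#)) ⟩
      ∑F (λ v → [ v ≟K u ] * ((M × 1#) * ψ v))
        ≈⟨ ∑F-δ u (λ v → (M × 1#) * ψ v) (λ v∼w → *-congˡ (ψ-cong v∼w)) ⟩
      (M × 1#) * ψ u ∎

  gauss-M : gauss M ≈ - 1#
  gauss-M = begin
    ∑F (λ u → ψ u * T⁻¹ u ^ M)                      ≈⟨ ∑F-cong value ⟩
    ∑F (λ u → ψ u + [ u ≟K F.0# ] * (- 1# * ψ u))   ≈⟨ ∑F-+ _ _ ⟩
    ∑F ψ + ∑F (λ u → [ u ≟K F.0# ] * (- 1# * ψ u))  ≈⟨ +-cong ∑ψ≈0 (∑F-δ F.0# (λ u → - 1# * ψ u) (λ u∼v → *-congˡ (ψ-cong u∼v))) ⟩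
    0# + - 1# * ψ F.0#                              ≈⟨ +-congˡ (*-congˡ ψ-0) ⟩
    0# + - 1# * 1#                                  ≈⟨ solve 0 (:0 :+ :- :1 :* :1 := :- :1) refl ⟩
    - 1#                                            ∎
    where
    value : ∀ u → ψ u * T⁻¹ u ^ M ≈ ψ u + [ u ≟K F.0# ] * (- 1# * ψ u)
    value u with u ≟K F.0#
    ... | yes u∼0 = trans (*-congˡ (trans (^-congˡ M (T⁻¹-0 u∼0)) (0^ M)))
      (trans (solve 1 (λ s → s :* :0 := s :+ :1 :* (:- :1 :* s)) refl (ψ u)) (+-congˡ (*-congʳ (sym ([ u ≟K F.0# ]-yes u∼0)))))
    ... | no u≁0 = trans (*-congˡ (T^M (inv-≉0 u≁0)))
      (trans (solve 1 (λ s → s :* :1 := s :+ :0 :* (:- :1 :* s)) refl (ψ u)) (+-congˡ (*-congʳ (sym ([ u ≟K F.0# ]-no u≁0)))))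

  -- Substitute u ↦ u^p, a bijection of the field that preserves the trace and hence ψ.
  gauss-*p : ∀ b → gauss (b ℕ.* p) ≈ gauss b
  gauss-*p b = begin
    ∑F (λ u → ψ u * T⁻¹ u ^ (b ℕ.* p))                ≈⟨ ∑F-cong (λ u → *-cong (ψ-Tr (F.sym (Tr-frobenius u))) (power u)) ⟩
    ∑F (λ u → ψ (u SF.^ p) * T⁻¹ (u SF.^ p) ^ b)      ≈⟨ ∑F-permute (SF._^ p) (SF._^ (p ℕ.^ (E ℕ.∸ 1))) (SF.^-congˡ p) (SF.^-congˡ (p ℕ.^ (E ℕ.∸ 1)))
                                                           (λ u → F.trans (SF.^-assocʳ u (p ℕ.^ (E ℕ.∸ 1)) p) (F.trans (SF.^-congʳ u (ℕₚ.*-comm (p ℕ.^ (E ℕ.∸ 1)) p)) (root u)))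
                                                           (λ u → F.trans (SF.^-assocʳ u p (p ℕ.^ (E ℕ.∸ 1))) (root u))
                                                           (λ u → ψ u * T⁻¹ u ^ b) (λ u∼v → *-cong (ψ-cong u∼v) (^-congˡ b (T⁻¹-cong u∼v))) ⟨
    ∑F (λ u → ψ u * T⁻¹ u ^ b)                        ∎
    where
    root : ∀ u → u SF.^ (p ℕ.* p ℕ.^ (E ℕ.∸ 1)) ∼ u
    root u = F.trans (SF.^-congʳ u (≡.trans (≡.cong (p ℕ.^_) (ℕₚ.m+[n∸m]≡n 1≤E)) (≡.sym Q≡p^E))) (fermat′ u)
    power : ∀ u → T⁻¹ u ^ (b ℕ.* p) ≈ T⁻¹ (u SF.^ p) ^ b
    power u = trans (^-congʳ (T⁻¹ u) (ℕₚ.*-comm b p)) (trans (sym (^-assocʳ (T⁻¹ u) p b)) (^-congˡ b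
      (trans (sym (T-^ (inv u) p)) (T-cong (F.trans (SF.^-assocʳ u ι p) (F.trans (SF.^-congʳ u (ℕₚ.*-comm ι p)) (F.sym (SF.^-assocʳ u p ι))))))))

  jacobi : ℕ → Carrier
  jacobi b = ∑F (λ w → T⁻¹ w * T⁻¹ (F.1# F.- w) ^ b)

  -- Pairs are collected by their sum s. For s ≠ 0, scaling by s turns the inner sum into the Jacobi
  -- sum; for s = 0 it is a multiple of the power sum of exponent b + 1, which vanishes because M
  -- does not divide b + 1.
  gauss-gauss : ∀ b → ¬ M ∣ suc b → gauss 1 * gauss b ≈ jacobi b * gauss (suc b)
  gauss-gauss b M∤1+b = begin
    gauss 1 * gauss b
      ≈⟨ ∑F-*ʳ _ (gauss b) ⟩
    ∑F (λ u → ψ u * T⁻¹ u ^ 1 * gauss b)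
      ≈⟨ ∑F-cong (λ u → trans (*-congˡ (translate u)) (∑F-*ˡ _ _)) ⟩
    ∑F (λ u → ∑F (λ s → ψ u * T⁻¹ u ^ 1 * (ψ (s F.- u) * T⁻¹ (s F.- u) ^ b)))
      ≈⟨ ∑F-cong (λ u → ∑F-cong (λ s → combine u s)) ⟩
    ∑F (λ u → ∑F (λ s → ψ s * (T⁻¹ u * T⁻¹ (s F.- u) ^ b)))
      ≈⟨ ∑F-comm (λ u s → ψ s * (T⁻¹ u * T⁻¹ (s F.- u) ^ b)) ⟩
    ∑F (λ s → ∑F (λ u → ψ s * (T⁻¹ u * T⁻¹ (s F.- u) ^ b)))
      ≈⟨ ∑F-cong (λ s → trans (sym (∑F-*ˡ (ψ s) _)) (trans (*-congˡ (inner s)) (solve 3 (λ x y z → x :* (y :* z) := z :* (x :* y)) refl _ _ _))) ⟩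
    ∑F (λ s → jacobi b * (ψ s * T⁻¹ s ^ suc b))
      ≈⟨ ∑F-*ˡ (jacobi b) _ ⟨
    jacobi b * gauss (suc b) ∎
    where
    translate : ∀ u → gauss b ≈ ∑F (λ s → ψ (s F.- u) * T⁻¹ (s F.- u) ^ b)
    translate u = ∑F-permute (F._- u) (F._+ u) F.+-congʳ F.+-congʳ
      (λ x → FS.solve 2 (λ x u → x FS.:+ u FS.:- u FS.:= x) F.refl x u)
      (λ x → FS.solve 2 (λ x u → x FS.:- u FS.:+ u FS.:= x) F.refl x u)
      (λ v → ψ v * T⁻¹ v ^ b) (λ u∼v → *-cong (ψ-cong u∼v) (^-congˡ b (T⁻¹-cong u∼v)))
    combine : ∀ u s → ψ u * T⁻¹ u ^ 1 * (ψ (s F.- u) * T⁻¹ (s F.- u) ^ b) ≈ ψ s * (T⁻¹ u * T⁻¹ (s F.- u) ^ b)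
    combine u s = trans
      (solve 4 (λ x y z w → x :* (y :* :1) :* (z :* w) := (x :* z) :* (y :* w)) refl (ψ u) (T⁻¹ u) (ψ (s F.- u)) (T⁻¹ (s F.- u) ^ b))
      (*-congʳ (trans (sym (ψ-+ u (s F.- u))) (ψ-cong (FS.solve 2 (λ u s → u FS.:+ (s FS.:- u) FS.:= s) F.refl u s))))
    inner : ∀ s → ∑F (λ u → T⁻¹ u * T⁻¹ (s F.- u) ^ b) ≈ T⁻¹ s ^ suc b * jacobi b
    inner s with s ≟K F.0#
    ... | yes s∼0 = trans (begin
      ∑F (λ u → T⁻¹ u * T⁻¹ (s F.- u) ^ b)                          ≈⟨ ∑F-cong (λ u → *-congˡ (^-congˡ b (trans (T⁻¹-cong (negate u)) (T⁻¹-* _ u)))) ⟩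
      ∑F (λ u → T⁻¹ u * (T⁻¹ (F.- F.1#) * T⁻¹ u) ^ b)               ≈⟨ ∑F-cong (λ u → trans (*-congˡ (^-distrib-* _ _ b))
                                                                          (solve 3 (λ x y z → x :* (y :* z) := y :* (x :* z)) refl _ _ _)) ⟩
      ∑F (λ u → T⁻¹ (F.- F.1#) ^ b * (T⁻¹ u ^ suc b))               ≈⟨ ∑F-*ˡ (T⁻¹ (F.- F.1#) ^ b) (λ u → T⁻¹ u ^ suc b) ⟨
      T⁻¹ (F.- F.1#) ^ b * ∑F (λ u → T⁻¹ u ^ suc b)                 ≈⟨ *-congˡ (∑T⁻¹^ (suc b) M∤1+b) ⟩
      T⁻¹ (F.- F.1#) ^ b * 0#                                       ≈⟨ zeroʳ _ ⟩
      0#                                                            ∎)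
      (sym (trans (*-congʳ (trans (*-congʳ (T⁻¹-0 s∼0)) (zeroˡ _))) (zeroˡ _)))
      where
      negate : ∀ u → s F.- u ∼ (F.- F.1#) F.* u
      negate u = F.trans (F.+-congʳ s∼0) (FS.solve 1 (λ u → FS.:0 FS.:- u FS.:= (FS.:- FS.:1) FS.:* u) F.refl u)
    ... | no s≁0 = begin
      ∑F (λ u → T⁻¹ u * T⁻¹ (s F.- u) ^ b)                          ≈⟨ ∑F-scale (λ u → T⁻¹ u * T⁻¹ (s F.- u) ^ b)
                                                                          (λ u∼v → *-cong (T⁻¹-cong u∼v) (^-congˡ b (T⁻¹-cong (F.+-congˡ (F.-‿cong u∼v))))) s≁0 ⟩
      ∑F (λ w → T⁻¹ (s F.* w) * T⁻¹ (s F.- s F.* w) ^ b)            ≈⟨ ∑F-cong (λ w → *-cong (T⁻¹-* s w)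
                                                                          (trans (^-congˡ b (trans (T⁻¹-cong (factor w)) (T⁻¹-* s _))) (^-distrib-* _ _ b))) ⟩
      ∑F (λ w → T⁻¹ s * T⁻¹ w * (T⁻¹ s ^ b * T⁻¹ (F.1# F.- w) ^ b)) ≈⟨ ∑F-cong (λ w → solve 4 (λ x y z t → x :* y :* (z :* t) := (x :* z) :* (y :* t)) refl _ _ _ _) ⟩
      ∑F (λ w → T⁻¹ s ^ suc b * (T⁻¹ w * T⁻¹ (F.1# F.- w) ^ b))     ≈⟨ ∑F-*ˡ (T⁻¹ s ^ suc b) _ ⟨
      T⁻¹ s ^ suc b * jacobi b                                      ∎
      where
      factor : ∀ w → s F.- s F.* w ∼ s F.* (F.1# F.- w)
      factor w = FS.solve 2 (λ s w → s FS.:- s FS.:* w FS.:= s FS.:* (FS.:1 FS.:- w)) F.refl s w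

  -- Recursion from the partial fractions 1 / (w (1 − w)) = 1 / w + 1 / (1 − w).
  private
    module Residue (1<M : 1 < M) where

      -- The residue of `jacobi b`.
      κ : ℕ → K
      κ b = ΣF.∑F (λ w → inv w F.* inv (F.1# F.- w) SF.^ b)

      ∑-inv^ : ∀ n → 0 < n → n < M → ΣF.∑F (λ w → inv w SF.^ n) ∼ F.0#
      ∑-inv^ n 0<n n<M = F.trans (F.sym (ΣF.∑F-permute inv inv inv-cong inv-cong inv-involutive inv-involutive
          (λ w → w SF.^ n) (SF.^-congˡ n)))
        (∑-power-∤ n (λ M∣n → ℕₚ.<⇒≱ n<M (∣⇒≤ {{ℕ.>-nonZero 0<n}} M∣n)))

      ∑-1-inv^ : ∀ n → 0 < n → n < M → ΣF.∑F (λ w → inv (F.1# F.- w) SF.^ n) ∼ F.0#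
      ∑-1-inv^ n 0<n n<M = F.trans (F.sym (ΣF.∑F-permute (λ x → F.1# F.- x) (λ x → F.1# F.- x)
          (λ x∼y → F.+-congˡ (F.-‿cong x∼y)) (λ x∼y → F.+-congˡ (F.-‿cong x∼y)) reflect reflect
          (λ w → inv w SF.^ n) (λ x∼y → SF.^-congˡ n (inv-cong x∼y))))
        (∑-inv^ n 0<n n<M)
        where
        reflect : ∀ x → F.1# F.- (F.1# F.- x) ∼ x
        reflect = FS.solve 1 (λ x → FS.:1 FS.:- (FS.:1 FS.:- x) FS.:= x) F.refl

      inv-1 : inv F.1# ∼ F.1#
      inv-1 = F.trans (F.sym (F.*-identityˡ _)) (inverseʳ F.1≉0)

      [_≟0] [_≟1] : K → K
      [ w ≟0] = SF.[_] (w ≟K F.0#)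
      [ w ≟1] = SF.[_] (w ≟K F.1#)

      -- As `inv` sends 0 to 0, the usual identity is off by 1 at each of the two poles; the
      -- indicators remove this.
      partial-fractions : ∀ w → inv w F.* inv (F.1# F.- w) ∼ inv w F.+ inv (F.1# F.- w) F.- [ w ≟0] F.- [ w ≟1]
      partial-fractions w with w ≟K F.0# | w ≟K F.1#
      ... | yes w∼0 | yes w∼1 = contradiction (F.trans (F.sym w∼1) w∼0) F.1≉0
      ... | yes w∼0 | no w≁1 = F.trans (F.trans (F.*-congʳ (inv-0 w∼0)) (F.zeroˡ _)) (F.sym (F.trans
        (F.+-cong (F.+-cong (F.+-cong (inv-0 w∼0) (F.trans (inv-cong (F.trans (F.+-congˡ (F.-‿cong w∼0))
            (FS.solve 0 (FS.:1 FS.:- FS.:0 FS.:= FS.:1) F.refl))) inv-1))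
          (F.-‿cong (SF.[_]-yes (w ≟K F.0#) w∼0))) (F.-‿cong (SF.[_]-no (w ≟K F.1#) w≁1)))
        (FS.solve 0 (FS.:0 FS.:+ FS.:1 FS.:- FS.:1 FS.:- FS.:0 FS.:= FS.:0) F.refl)))
      ... | no w≁0 | yes w∼1 = F.trans (F.trans (F.*-congˡ (inv-0 1-w∼0)) (F.zeroʳ _)) (F.sym (F.trans
        (F.+-cong (F.+-cong (F.+-cong (F.trans (inv-cong w∼1) inv-1) (inv-0 1-w∼0))
          (F.-‿cong (SF.[_]-no (w ≟K F.0#) w≁0))) (F.-‿cong (SF.[_]-yes (w ≟K F.1#) w∼1)))
        (FS.solve 0 (FS.:1 FS.:+ FS.:0 FS.:- FS.:0 FS.:- FS.:1 FS.:= FS.:0) F.refl)))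
        where
        1-w∼0 : F.1# F.- w ∼ F.0#
        1-w∼0 = F.trans (F.+-congˡ (F.-‿cong w∼1)) (F.-‿inverseʳ F.1#)
      ... | no w≁0 | no w≁1 = FieldTheory.*-cancelˡ F w≁0 (FieldTheory.*-cancelˡ F 1-w≁0 (F.trans
          (FS.solve 4 (λ w v x y → v FS.:* (w FS.:* (x FS.:* y)) FS.:= (w FS.:* x) FS.:* (v FS.:* y)) F.refl w (F.1# F.- w) (inv w) (inv (F.1# F.- w)))
          (F.trans (F.*-cong (inverseʳ w≁0) (inverseʳ 1-w≁0)) (F.sym (F.trans
            (F.*-congˡ (F.*-congˡ (F.+-cong (F.+-congˡ (F.-‿cong (SF.[_]-no (w ≟K F.0#) w≁0))) (F.-‿cong (SF.[_]-no (w ≟K F.1#) w≁1)))))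
            (F.trans (FS.solve 3 (λ w x y → (FS.:1 FS.:- w) FS.:* (w FS.:* (x FS.:+ y FS.:- FS.:0 FS.:- FS.:0)) FS.:= (FS.:1 FS.:- w) FS.:* (w FS.:* x) FS.:+ w FS.:* ((FS.:1 FS.:- w) FS.:* y)) F.refl w (inv w) (inv (F.1# F.- w)))
            (F.trans (F.+-cong (F.*-congˡ (inverseʳ w≁0)) (F.*-congˡ (inverseʳ 1-w≁0)))
              (FS.solve 1 (λ w → (FS.:1 FS.:- w) FS.:* FS.:1 FS.:+ w FS.:* FS.:1 FS.:= FS.:1 FS.:* FS.:1) F.refl w))))))))
        where
        1-w≁0 : ¬ F.1# F.- w ∼ F.0#
        1-w≁0 eq = w≁1 (F.sym (x∙y⁻¹≈ε⇒x≈y F.1# w eq))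

      κ-suc : ∀ b → suc b < M → κ (suc b) ∼ κ b F.- F.1# F.- SF._^_ F.0# b
      κ-suc b 1+b<M = F.trans (ΣF.∑F-cong (λ w → F.trans (F.sym (F.*-assoc _ _ _)) (F.trans (F.*-congʳ (partial-fractions w)) (expand w))))
        (F.trans (ΣF.∑F-+ _ _) (F.+-cong (F.trans (ΣF.∑F-+ _ _) (F.+-cong (F.trans (ΣF.∑F-+ _ _)
            (F.trans (F.+-congˡ (∑-1-inv^ (suc b) z<s 1+b<M)) (F.+-identityʳ _)))
            (F.trans (ΣF.∑F-δ F.0# (λ w → F.- (inv (F.1# F.- w) SF.^ b)) (λ x∼y → F.-‿cong (SF.^-congˡ b (inv-cong (F.+-congˡ (F.-‿cong x∼y))))))
              (F.-‿cong (F.trans (SF.^-congˡ b (F.trans (inv-cong (FS.solve 0 (FS.:1 FS.:- FS.:0 FS.:= FS.:1) F.refl)) inv-1)) (SF.1^ b))))))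
          (F.trans (ΣF.∑F-δ F.1# (λ w → F.- (inv (F.1# F.- w) SF.^ b)) (λ x∼y → F.-‿cong (SF.^-congˡ b (inv-cong (F.+-congˡ (F.-‿cong x∼y))))))
            (F.-‿cong (SF.^-congˡ b (inv-0 (F.-‿inverseʳ F.1#)))))))
        where
        expand : ∀ w → let v = inv (F.1# F.- w) SF.^ b in
          (inv w F.+ inv (F.1# F.- w) F.- [ w ≟0] F.- [ w ≟1]) F.* v ∼
          inv w F.* v F.+ inv (F.1# F.- w) F.* v F.+ [ w ≟0] F.* (F.- v) F.+ [ w ≟1] F.* (F.- v)
        expand w = FS.solve 5 (λ x y d e v → (x FS.:+ y FS.:- d FS.:- e) FS.:* v FS.:=
          x FS.:* v FS.:+ y FS.:* v FS.:+ d FS.:* (FS.:- v) FS.:+ e FS.:* (FS.:- v)) F.refl (inv w) (inv (F.1# F.- w)) [ w ≟0] [ w ≟1] (inv (F.1# F.- w) SF.^ b)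

      -- κ 0 = 0, and each step subtracts 1 for the pole at w = 0. The pole at w = 1 contributes
      -- 0^b, which is 1 in the first step only; hence b + 2 in place of b + 1, and the residue is
      -- nonzero precisely when p does not divide b + 2.
      κ-value : ∀ b → suc b < M → κ (suc b) ∼ F.- (suc (suc b) SF.× F.1#)
      κ-value zero 1<M = F.trans (κ-suc 0 1<M) (F.trans (F.+-congʳ (F.+-congʳ κ0))
        (FS.solve 0 (FS.:0 FS.:- FS.:1 FS.:- FS.:1 FS.:= FS.:- (FS.:1 FS.:+ (FS.:1 FS.:+ FS.:0))) F.refl))
        where
        κ0 : κ 0 ∼ F.0#
        κ0 = ∑-inv^ 1 z<s 1<M
      κ-value (suc b) 2+b<M = F.trans (κ-suc (suc b) 2+b<M)
        (F.trans (F.+-cong (F.+-congʳ (κ-value b (ℕₚ.<⇒≤ 2+b<M))) (F.-‿cong (F.zeroˡ _)))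
          (FS.solve 1 (λ s → FS.:- s FS.:- FS.:1 FS.:- FS.:0 FS.:= FS.:- (FS.:1 FS.:+ s)) F.refl (suc (suc b) SF.× F.1#)))

      Unit-jacobi : ∀ b → suc b < M → p ∤ suc (suc b) → Unit (jacobi (suc b))
      Unit-jacobi b 1+b<M p∤ ε≈0 = -≉0 (λ eq → p∤ (×1≈0⇒∣ (suc (suc b)) eq)) (F.trans (F.sym (κ-value b 1+b<M))
        (F.trans (F.sym (F.trans (ε-∑F _) (ΣF.∑F-cong (λ w → F.trans (ε-* _ _) (F.*-cong (ε-T _)
          (F.trans (ε-^ _ (suc b)) (SF.^-congˡ (suc b) (ε-T _)))))))) ε≈0))

  -- (1 + π)^n = 1 + n π + π² (…)
  second-order : ℕ → Carrier
  second-order zero    = 0#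
  second-order (suc n) = n × 1# + second-order n + π * second-order n

  ζ^-expansion : ∀ n → ζ ^ n ≈ 1# + π * (n × 1# + π * second-order n)
  ζ^-expansion zero    = solve 1 (λ π → :1 := :1 :+ π :* (:0 :+ π :* :0)) refl π
  ζ^-expansion (suc n) = trans (*-congˡ (ζ^-expansion n))
    (solve 3 (λ π n s → (π :+ :1) :* (:1 :+ π :* (n :+ π :* s)) := :1 :+ π :* ((:1 :+ n) :+ π :* (n :+ s :+ π :* s)))
      refl π (n × 1#) (second-order n))

  -- Expand ψ(u) = (1 + π)^tr(u) to first order: the constant part is a power sum that vanishes for
  -- M > 1, and the coefficient of π has residue Σ Tr u / u = -1.
  gauss-1 : 1 < M → 1 ≐ gauss 1
  gauss-1 1<M = exact Unit-1 unit (begin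
    1# * gauss 1                                    ≈⟨ *-identityˡ _ ⟩
    gauss 1                                         ≈⟨ ∑F-cong (λ u → trans (*-congʳ (ζ^-expansion (tr u)))
                                                         (solve 4 (λ π n s t → (:1 :+ π :* (n :+ π :* s)) :* (t :* :1) := t :* :1 :+ π :* (n :* t :+ π :* (s :* t))) refl π _ _ _)) ⟩
    ∑F (λ u → T⁻¹ u ^ 1 + π * (first u + π * second u)) ≈⟨ ∑F-+ _ _ ⟩
    ∑F (λ u → T⁻¹ u ^ 1) + ∑F (λ u → π * (first u + π * second u))
                                                    ≈⟨ +-cong (∑T⁻¹^ 1 (λ M∣1 → ℕₚ.<⇒≱ 1<M (∣⇒≤ M∣1)))
                                                         (trans (sym (∑F-*ˡ π _)) (*-congˡ (trans (∑F-+ _ _) (+-congˡ (sym (∑F-*ˡ π second)))))) ⟩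
    0# + π * y                                      ≈⟨ solve 2 (λ π y → :0 :+ π :* y := π :* :1 :* y) refl π y ⟩
    π ^ 1 * y                                       ∎)
    where
    first second : K → Carrier
    first u  = (tr u × 1#) * T⁻¹ u
    second u = second-order (tr u) * T⁻¹ u
    y = ∑F first + π * ∑F second
    unit : Unit y
    unit ε≈0 = -≉0 F.1≉0 (F.trans (F.sym ∑-Tr-inv) (F.trans (ΣF.∑F-cong (λ u → F.sym (F.trans (ε-* _ _)
        (F.*-cong (F.trans (ε-× (tr u)) (tr×1 u)) (ε-T _)))))
      (F.trans (F.sym (ε-∑F first)) (F.trans (F.sym (F.+-identityʳ _)) (F.trans (F.+-congˡ (F.sym (ε-π* _)))
        (F.trans (F.sym (ε-+ _ _)) ε≈0))))))

  -- Multiples of p are divided by p, which changes neither the Gauss sum nor the digit sum.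
  -- Otherwise b arises from b - 1 without a carry, so the digit sum grows by 1, as does the
  -- valuation: the product of `gauss 1` and the sum at b - 1 is a unit Jacobi sum times the sum at
  -- b.
  stickelberger : ∀ b → 0 < b → b < M → S b ≐ gauss b
  stickelberger = <-rec _ rec
    where
    rec : ∀ b → (∀ {b′} → b′ < b → 0 < b′ → b′ < M → S b′ ≐ gauss b′) → 0 < b → b < M → S b ≐ gauss b
    rec b ih 0<b b<M with p ∣? b
    rec b ih 0<b b<M | yes (divides j ≡.refl) =
      ≡.subst (_≐ gauss (j ℕ.* p)) (≡.sym (S-*p j)) (≐-cong (sym (gauss-*p j)) (ih j<b 0<j (ℕₚ.<-trans j<b b<M)))
      where
      0<j : 0 < j
      0<j = ℕₚ.n≢0⇒n>0 λ j≡0 → ℕₚ.<⇒≢ 0<b (≡.sym (≡.cong (ℕ._* p) j≡0))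
      j<b : j < j ℕ.* p
      j<b = ℕₚ.m<m*n j p {{ℕ.>-nonZero 0<j}} 1<p
    rec 1 ih _ 1<M | no p∤1 = ≡.subst (_≐ gauss 1) (≡.sym S-1) (gauss-1 1<M)
    rec (suc (suc b)) ih _ 2+b<M | no p∤2+b =
      ≡.subst (_≐ gauss (suc (suc b))) (≡.trans (≡.cong (ℕ._+ S (suc b)) S-1) (≡.sym (S-suc (suc b) p∤2+b)))
        (≐-cancel (Residue.Unit-jacobi 1<M b 1+b<M p∤2+b) (≐-cong (gauss-gauss (suc b) M∤2+b)
          (≐-* (≡.subst (_≐ gauss 1) (≡.sym S-1) (gauss-1 1<M)) (ih (ℕₚ.n<1+n _) z<s 1+b<M))))
      where
      1+b<M : suc b < M
      1+b<M = ℕₚ.<⇒≤ 2+b<M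
      1<M : 1 < M
      1<M = ℕₚ.≤-trans (s≤s (s≤s z≤n)) 1+b<M
      M∤2+b : ¬ M ∣ suc (suc b)
      M∤2+b M∣ = ℕₚ.<⇒≱ 2+b<M (∣⇒≤ M∣)

  Unit-M : Unit (M × 1#)
  Unit-M ε≈0 = -≉0 F.1≉0 (F.trans (F.sym M×1≈-1) (F.trans (F.sym (ε-× M)) ε≈0))

  ≐-Q : E ℕ.* (p ℕ.∸ 1) ≐ Q × 1#
  ≐-Q = ≐-cong (×-congˡ (≡.sym Q≡p^E)) (≐-p^ E)

  S-M : S M ≡ E ℕ.* (p ℕ.∸ 1)
  S-M = ≡.trans (≡.cong (λ q → S (q ℕ.∸ 1)) Q≡p^E) (S-max E)

  coefficient-exact : ∀ r → r ≤ M → S r ≐ coefficient r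
  coefficient-exact zero    _ = ≡.subst (_≐ M × 1#) (≡.sym S-0) (≐-unit Unit-M)
  coefficient-exact (suc r) 1+r≤M with suc r ℕₚ.≟ M
  ... | no 1+r≢M = ≐-cong (sym (trans (+-congˡ (-‿cong (trans (*-congʳ ([ suc r ℕₚ.≟ M ]-no 1+r≢M)) (zeroˡ _))))
      (solve 1 (λ g → g :- :0 := g) refl (gauss (suc r))))) (stickelberger (suc r) z<s (ℕₚ.≤∧≢⇒< 1+r≤M 1+r≢M))
  ... | yes 1+r≡M = ≡.subst (_≐ coefficient (suc r)) (≡.trans (≡.sym S-M) (≡.cong S (≡.sym 1+r≡M)))
    (≐-cong (sym (begin
      gauss (suc r) - [ suc r ℕₚ.≟ M ] * (M × 1#)     ≈⟨ +-cong (trans (reflexive (≡.cong gauss 1+r≡M)) gauss-M)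
                                                          (-‿cong (*-congʳ ([ suc r ℕₚ.≟ M ]-yes 1+r≡M))) ⟩
      - 1# - 1# * (M × 1#)                            ≈⟨ solve 1 (λ m → :- :1 :- :1 :* m := :- :1 :* (:1 :+ m)) refl (M × 1#) ⟩
      - 1# * (Q × 1#)                                 ∎))
    (≐-* (≐-unit (Unit-neg Unit-1)) ≐-Q))

-- Discarding terms whose degree lies outside D

module Cleanup {c ℓ n} (F : FiniteField n c ℓ) (k : ℕ.ℕ) where

  open import Defs

  open import Data.List.Base as List using (List; []; _∷_; filter; length; cartesianProduct)
  open import Data.List.Properties using (filter-≐)
  open import Data.List.Relation.Unary.All as All using (All; []; _∷_)
  open ℕ using (ℕ; suc; _≤_; s≤s; z≤n)
  import Data.Nat.Properties as ℕ
  open import Data.Product.Base using (_,_; proj₁)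
  open import Data.Vec.Base as Vec using (Vec; []; _∷_)
  import Data.Vec.Properties as Vec
  open import Relation.Nullary.Decidable using (decidable-stable)
  open import Relation.Unary using (_⊆_)

  open FiniteField F hiding (zero)
  open Counting F k
  open Sums commutativeRing using (_^_)
  open Solver commutativeRing
  open import Relation.Binary.Reasoning.Setoid (CommutativeRing.setoid commutativeRing)

  monomial : Vec Carrier k → Vec ℕ k → Carrier
  monomial xs t = Vec.foldr′ _*_ 1# (Vec.zipWith _^_ xs t)

  sum₁ : Poly → Carrier
  sum₁ f = List.foldr _+_ 0# (List.map proj₁ f)

  restrict : ∀ {p} {P : Vec ℕ k → Set p} → (∀ t → Dec (P t)) → Poly → Poly
  restrict P? = filter (λ (_ , t) → P? t)

  restrict-split : ∀ {p} {P : Vec ℕ k → Set p} (P? : ∀ t → Dec (P t)) f xs →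
    eval f xs ≈ eval (restrict P? f) xs + eval (restrict (λ t → ¬? (P? t)) f) xs
  restrict-split P? []            xs = sym (+-identityˡ 0#)
  restrict-split P? ((a , t) ∷ f) xs with P? t
  ... | yes _ = trans (+-congˡ (restrict-split P? f xs)) (sym (+-assoc _ _ _))
  ... | no _  = trans (+-congˡ (restrict-split P? f xs)) (solve 3 (λ m x y → m :+ (x :+ y) := x :+ (m :+ y)) refl _ _ _)

  module _ {p q} {P : Vec ℕ k → Set p} (P? : ∀ t → Dec (P t)) {E : Vec ℕ k → Set q} (E? : ∀ t → Dec (E t)) where

    sum₁-restrict-⊆ : (∀ t → E t → P t) → ∀ f → sum₁ (restrict E? (restrict P? f)) ≡ sum₁ (restrict E? f)
    sum₁-restrict-⊆ E⊆P []            = ≡.refl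
    sum₁-restrict-⊆ E⊆P ((a , t) ∷ f) with P? t
    ... | yes _ with E? t
    ...   | yes _ = ≡.cong (a +_) (sum₁-restrict-⊆ E⊆P f)
    ...   | no _  = sum₁-restrict-⊆ E⊆P f
    sum₁-restrict-⊆ E⊆P ((a , t) ∷ f) | no ¬Pt with E? t
    ...   | yes Et = contradiction (E⊆P t Et) ¬Pt
    ...   | no _   = sum₁-restrict-⊆ E⊆P f

    sum₁-restrict-∅ : (∀ t → E t → ¬ P t) → ∀ f → sum₁ (restrict E? (restrict P? f)) ≡ 0#
    sum₁-restrict-∅ E⊆¬P []            = ≡.refl
    sum₁-restrict-∅ E⊆¬P ((a , t) ∷ f) with P? t
    ... | no _   = sum₁-restrict-∅ E⊆¬P f
    ... | yes Pt with E? t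
    ...   | yes Et = contradiction Pt (E⊆¬P t Et)
    ...   | no _   = sum₁-restrict-∅ E⊆¬P f

  eq? : ∀ (s t : Vec ℕ k) → Dec (t ≡ s)
  eq? s t = Vec.≡-dec ℕ._≟_ t s

  eval-equal : ∀ s f xs → eval (restrict (eq? s) f) xs ≈ coeff f s * monomial xs s
  eval-equal s f xs = go (eq? s) (λ { ≡.refl → refl }) f
    where
    go : ∀ {p} {P : Vec ℕ k → Set p} (P? : ∀ t → Dec (P t)) → (∀ {t} → P t → monomial xs t ≈ monomial xs s) →
      ∀ f → eval (restrict P? f) xs ≈ sum₁ (restrict P? f) * monomial xs s
    go P? same []            = sym (zeroˡ _)
    go P? same ((a , t) ∷ f) with P? t
    ... | yes Pt = trans (+-cong (*-congˡ (same Pt)) (go P? same f)) (sym (distribʳ _ _ _))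
    ... | no _   = go P? same f

  length-restrict : ∀ {p} {P : Vec ℕ k → Set p} (P? : ∀ t → Dec (P t)) f → length (restrict P? f) ≤ length f
  length-restrict P? []            = z≤n
  length-restrict P? ((a , t) ∷ f) with P? t
  ... | yes _ = s≤s (length-restrict P? f)
  ... | no _  = ℕ.m≤n⇒m≤1+n (length-restrict P? f)

  length-remove : ∀ a t f → length (restrict (λ s → ¬? (eq? t s)) ((a , t) ∷ f)) ≤ length f
  length-remove a t f = go (λ s → ¬? (eq? t s)) (λ ¬t≡t → ¬t≡t ≡.refl)
    where
    go : ∀ {p} {P : Vec ℕ k → Set p} (P? : ∀ t → Dec (P t)) → ¬ P t → length (restrict P? ((a , t) ∷ f)) ≤ length f
    go P? ¬Pt with P? t
    ... | yes Pt = contradiction Pt ¬Pt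
    ... | no _   = length-restrict P? f

  -- The terms sharing the exponents of the head add up to a vanishing coefficient and are removed
  -- together. What is left is a filtered list and not a tail, hence the recursion on a bound m for
  -- the length.
  eval-zero : ∀ f → IsZero f → ∀ xs → eval f xs ≈ 0#
  eval-zero f zero-f xs = go (length f) f ℕ.≤-refl zero-f
    where
    go : ∀ m f → length f ≤ m → IsZero f → eval f xs ≈ 0#
    go m       []                _        _      = refl
    go (suc m) f@((a , t) ∷ f′) (s≤s len) zero-f = begin
      eval f xs                                             ≈⟨ restrict-split (eq? t) f xs ⟩
      eval (restrict (eq? t) f) xs + eval others xs         ≈⟨ +-cong (eval-equal t f xs) (go m others (ℕ.≤-trans (length-remove a t f′) len) zero-others) ⟩
      coeff f t * monomial xs t + 0#                        ≈⟨ +-identityʳ _ ⟩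
      coeff f t * monomial xs t                             ≈⟨ trans (*-congʳ (zero-f t)) (zeroˡ _) ⟩
      0#                                                    ∎
      where
      others = restrict (λ s → ¬? (eq? t s)) f
      zero-others : IsZero others
      zero-others s with eq? t s
      ... | yes ≡.refl = reflexive (sum₁-restrict-∅ (λ s → ¬? (eq? t s)) (eq? t) (λ s s≡t ¬s≡t → ¬s≡t s≡t) f)
      ... | no s≢t     = trans (reflexive (sum₁-restrict-⊆ (λ s → ¬? (eq? t s)) (eq? s) (λ { u ≡.refl → s≢t }) f)) (zero-f s)

  module _ {D : ℕ → Set} (D? : ∀ d → Dec (D d)) where

    restrictᴰ : Poly → Poly
    restrictᴰ = restrict (λ t → D? (Vec.sum t))

    -- Terms outside D may still occur in the list, as long as they cancel. `Deg` is a negation, so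
    -- a degree outside it only gives coefficients that are not nonzero; decidable equality of the
    -- field turns this into vanishing.
    eval-restrictᴰ : ∀ f → Deg f ⊆ D → ∀ xs → eval f xs ≈ eval (restrictᴰ f) xs
    eval-restrictᴰ f Deg⊆D xs = trans (restrict-split (λ t → D? (Vec.sum t)) f xs)
      (trans (+-congˡ (eval-zero outside outside-zero xs)) (+-identityʳ _))
      where
      outside? : ∀ t → Dec (¬ D (Vec.sum t))
      outside? t = ¬? (D? (Vec.sum t))
      outside = restrict outside? f
      outside-zero : IsZero outside
      outside-zero t with D? (Vec.sum t)
      ... | yes Dt = reflexive (sum₁-restrict-∅ outside? (eq? t) (λ { s ≡.refl ¬Dt → ¬Dt Dt }) f)
      ... | no ¬Dt = begin
        coeff outside t                                   ≡⟨ sum₁-restrict-⊆ outside? (eq? t) (λ { s ≡.refl → ¬Dt }) f ⟩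
        coeff f t                                         ≡⟨ sum₁-restrict-⊆ (λ s → Vec.sum s ℕ.≟ Vec.sum t) (eq? t) (λ { s ≡.refl → ≡.refl }) f ⟨
        coeff (homogeneousComponent (Vec.sum t) f) t      ≈⟨ decidable-stable (coeff (homogeneousComponent (Vec.sum t) f) t ≟ 0#)
                                                               (λ c≉0 → ¬Dt (Deg⊆D (λ zero-h → c≉0 (zero-h t)))) ⟩
        0#                                                ∎

    restrictᴰ-∈ : ∀ f → All (λ (_ , t) → D (Vec.sum t)) (restrictᴰ f)
    restrictᴰ-∈ = all-filter (λ (_ , t) → D? (Vec.sum t))
      where open import Data.List.Relation.Unary.All.Properties using (all-filter)

    Deg-⊆ : ∀ f → All (λ (_ , t) → D (Vec.sum t)) f → Deg f ⊆ D
    Deg-⊆ f all-D {d} d∈Deg = decidable-stable (D? d) λ ¬Dd → d∈Deg λ t → reflexive (≡.cong (λ h → coeff h t)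
      (filter-none (λ (_ , s) → Vec.sum s ℕ.≟ d) (All.map (λ { Ds ≡.refl → ¬Dd Ds }) all-D)))
      where open import Data.List.Properties using (filter-none)

  N-cong : ∀ q f g → (∀ xs → eval f xs ≈ eval g xs) → N q f ≡ N q g
  N-cong q f g fg = ≡.cong length (filter-≐ _ _
    ((λ {(xs , y)} eq → trans (sym (fg xs)) eq) , (λ {(xs , y)} eq → trans (fg xs) eq))
    (cartesianProduct (tuples elements k) elements))

-- The number of points as a sum over r

module Expansion {c ℓ M} (F : FiniteField (ℕ.suc M) c ℓ) (p : ℕ.ℕ) (pr : Prime p) (e m : ℕ.ℕ)
  (Q≡q^m : ℕ.suc M ≡ (p ℕ.^ e) ℕ.^ m) (Q≡p^E : ℕ.suc M ≡ p ℕ.^ (e ℕ.* m)) (1≤m : 1 ℕ.≤ m)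
  (V : Valuation.RamifiedRing F p) where

  open import Defs
  open Support using (pred∣pred^; whenZero)

  open import Data.Fin.Base using (Fin; zero; suc; toℕ; punchIn)
  import Data.Fin.Properties as Fin
  open import Data.List.Base as List using (List; []; _∷_; length; filter; cartesianProductWith; cartesianProduct; allFin; tabulate; _++_)
  open ℕ using (ℕ; zero; suc; NonZero; _∸_; _<_; _≤_; z<s)
  open import Data.Nat.Divisibility using (_∣_; divides; _∣?_)
  import Data.Nat.Properties as ℕₚ
  open import Data.Product.Base using (∃; _,_; proj₁; proj₂) renaming (_×_ to _∧_)
  open import Data.Vec.Base as Vec using (Vec; []; _∷_; lookup)
  open import Function.Base using (id)
  open import Function.Bundles using (Inverse)

  private
    E = e ℕ.* m
    module F = FiniteField F
    module SF = Sums F.commutativeRing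
    module ΣF = FieldSum F F.commutativeRing
    module FS = Solver F.commutativeRing
    open F using () renaming (Carrier to K; _≈_ to _∼_; _≟_ to _≟K_)
    open Inverse F.enumeration using (from; to; strictlyInverseʳ)
  open FieldTheory F hiding (*-cancelˡ; no-zero-divisors)
  open Trace F p pr E Q≡p^E
  open Valuation.RamifiedRing V
  open Valuation.Valuations F p pr E Q≡p^E V
  open CommutativeRing O hiding (zero)
  open Sums O
  open FieldSum F O
  open Solver O
  open Gauss F p pr E Q≡p^E V
  open DigitSum p {{prime⇒nonTrivial pr}} using (S)
  open BigOperator ℕₚ.+-0-commutativeMonoid using () renaming (big to sumℕ)
  open import Algebra.Properties.Group F.+-group using (x∙y⁻¹≈ε⇒x≈y) renaming (∙-cancelˡ to +-cancelˡ; ∙-cancelʳ to +-cancelʳ)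
  open import Relation.Binary.Reasoning.Setoid (CommutativeRing.setoid O)

  q : ℕ
  q = p ℕ.^ e

  ∑ᴸ : ∀ {a} {A : Set a} → List A → (A → Carrier) → Carrier
  ∑ᴸ []       f = 0#
  ∑ᴸ (x ∷ xs) f = f x + ∑ᴸ xs f

  module _ {a} {A : Set a} where

    ∑ᴸ-cong : ∀ (xs : List A) {f g : A → Carrier} → (∀ x → f x ≈ g x) → ∑ᴸ xs f ≈ ∑ᴸ xs g
    ∑ᴸ-cong []       fg = refl
    ∑ᴸ-cong (x ∷ xs) fg = +-cong (fg x) (∑ᴸ-cong xs fg)

    ∑ᴸ-++ : ∀ (xs ys : List A) f → ∑ᴸ (xs ++ ys) f ≈ ∑ᴸ xs f + ∑ᴸ ys f
    ∑ᴸ-++ []       ys f = sym (+-identityˡ _)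
    ∑ᴸ-++ (x ∷ xs) ys f = trans (+-congˡ (∑ᴸ-++ xs ys f)) (sym (+-assoc _ _ _))

    ∑ᴸ-map : ∀ {b} {B : Set b} (h : B → A) xs f → ∑ᴸ (List.map h xs) f ≈ ∑ᴸ xs (λ x → f (h x))
    ∑ᴸ-map h []       f = refl
    ∑ᴸ-map h (x ∷ xs) f = +-congˡ (∑ᴸ-map h xs f)

    ∑ᴸ-tabulate : ∀ n (h : Fin n → A) f → ∑ᴸ (tabulate h) f ≈ ∑ n (λ i → f (h i))
    ∑ᴸ-tabulate zero    h f = refl
    ∑ᴸ-tabulate (suc n) h f = +-congˡ (∑ᴸ-tabulate n (λ i → h (suc i)) f)

    length-filter : ∀ {ℓ} {P : A → Set ℓ} (P? : ∀ x → Dec (P x)) xs →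
      length (filter P? xs) × 1# ≈ ∑ᴸ xs (λ x → [ P? x ])
    length-filter P? []       = refl
    length-filter P? (x ∷ xs) with P? x
    ... | yes _ = +-congˡ (length-filter P? xs)
    ... | no _  = trans (length-filter P? xs) (sym (+-identityˡ _))

  ∑ᴸ-product : ∀ {a b d} {A : Set a} {B : Set b} {D : Set d} (h : A → B → D) xs ys f →
    ∑ᴸ (cartesianProductWith h xs ys) f ≈ ∑ᴸ xs (λ x → ∑ᴸ ys (λ y → f (h x y)))
  ∑ᴸ-product h []       ys f = refl
  ∑ᴸ-product h (x ∷ xs) ys f = trans (∑ᴸ-++ (List.map (h x) ys) _ f) (+-cong (∑ᴸ-map (h x) ys f) (∑ᴸ-product h xs ys f))

  ∑ᴸ-elements : ∀ f → ∑ᴸ F.elements f ≈ ∑ Q (λ i → f (from i))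
  ∑ᴸ-elements f = trans (∑ᴸ-map from (allFin Q) f) (∑ᴸ-tabulate Q id (λ i → f (from i)))

  ∑ᴸ-tuples : ∀ k f → ∑ᴸ (tuples F.elements k) f ≈ ∑ᵛ Q from k f
  ∑ᴸ-tuples zero    f = +-identityʳ _
  ∑ᴸ-tuples (suc k) f = trans (∑ᴸ-product _∷_ F.elements (tuples F.elements k) f)
    (trans (∑ᴸ-elements (λ x → ∑ᴸ (tuples F.elements k) (λ v → f (x ∷ v))))
      (∑-cong Q (λ i → ∑ᴸ-tuples k (λ v → f (from i ∷ v)))))

  ∑F-∑ᵛ : ∀ {a} {A : Set a} n (g : Fin n → A) k (f : K → Vec A k → Carrier) →
    ∑F (λ x → ∑ᵛ n g k (f x)) ≈ ∑ᵛ n g k (λ v → ∑F (λ x → f x v))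
  ∑F-∑ᵛ n g k f = trans (∑F≈∑ _) (trans (sym (∑ᵛ-∑ n g k Q (λ v i → f (from i) v)))
    (∑ᵛ-cong n g k (λ v → sym (∑F≈∑ (λ x → f x v)))))

  Tr-q : ∀ z → Tr (z SF.^ q) ∼ Tr z
  Tr-q z = iterate e
    where
    iterate : ∀ i → Tr (z SF.^ (p ℕ.^ i)) ∼ Tr z
    iterate zero    = Tr-cong (F.*-identityʳ z)
    iterate (suc i) = F.trans (Tr-cong (F.trans (SF.^-congʳ z (ℕₚ.*-comm p (p ℕ.^ i))) (F.sym (SF.^-assocʳ z (p ℕ.^ i) p))))
      (F.trans (Tr-frobenius _) (iterate i))

  Q≡q*q^ : suc M ≡ q ℕ.^ (m ∸ 1) ℕ.* q
  Q≡q*q^ = ≡.trans Q≡q^m (≡.trans (≡.cong (q ℕ.^_) (≡.sym (ℕₚ.m+[n∸m]≡n 1≤m))) (ℕₚ.*-comm q _))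

  -- The inverse of the q-th power map, because x^(q^m) = x.
  root-q : K → K
  root-q x = x SF.^ (q ℕ.^ (m ∸ 1))

  root-q^q : ∀ x → root-q x SF.^ q ∼ x
  root-q^q x = F.trans (SF.^-assocʳ x (q ℕ.^ (m ∸ 1)) q) (F.trans (SF.^-congʳ x (≡.sym Q≡q*q^)) (fermat′ x))

  InFq : K → Set ℓ
  InFq x = x SF.^ q ∼ x

  InFq? : ∀ x → Dec (InFq x)
  InFq? x = (x SF.^ q) ≟K x

  InFq-resp : ∀ {x y} → x ∼ y → InFq x → InFq y
  InFq-resp x∼y fix = F.trans (SF.^-congˡ q (F.sym x∼y)) (F.trans fix x∼y)

  fixed-q^ : ∀ {x} → InFq x → ∀ i → x SF.^ (q ℕ.^ i) ∼ x
  fixed-q^ {x} fix zero    = F.*-identityʳ x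
  fixed-q^ {x} fix (suc i) = F.trans (F.sym (SF.^-assocʳ x q (q ℕ.^ i))) (F.trans (SF.^-congˡ (q ℕ.^ i) fix) (fixed-q^ fix i))

  -- Tr (λ y^q) = Tr (λ^(1/q) y) turns the sum over y into an orthogonality relation.
  ∑-artin-schreier : ∀ v x → ∑F (λ y → ψ ((v F.- (y SF.^ q F.- y)) F.* x)) ≈ [ InFq? x ] * (Q × 1#) * ψ (x F.* v)
  ∑-artin-schreier v x = begin
    ∑F (λ y → ψ ((v F.- (y SF.^ q F.- y)) F.* x))         ≈⟨ ∑F-cong (λ y → trans (ψ-Tr (same-trace y)) (ψ-+ _ _)) ⟩
    ∑F (λ y → ψ (x F.* v) * ψ ((x F.- root-q x) F.* y))   ≈⟨ ∑F-*ˡ (ψ (x F.* v)) _ ⟨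
    ψ (x F.* v) * ∑F (λ y → ψ ((x F.- root-q x) F.* y))   ≈⟨ trans (*-comm _ _) (*-congʳ (trans (orthogonality _) (*-congʳ same-indicator))) ⟩
    [ InFq? x ] * (Q × 1#) * ψ (x F.* v)                  ∎
    where
    same-trace : ∀ y → Tr ((v F.- (y SF.^ q F.- y)) F.* x) ∼ Tr (x F.* v F.+ (x F.- root-q x) F.* y)
    same-trace y = +-cancelʳ (Tr (root-q x F.* y)) _ _ (F.trans (F.+-congˡ (F.trans (F.sym (Tr-q (root-q x F.* y)))
        (Tr-cong (F.trans (SF.^-distrib-* (root-q x) y q) (F.*-congʳ (root-q^q x))))))
      (F.trans (F.sym (Tr-+ _ _)) (F.trans (Tr-cong
        (FS.solve 5 (λ v z y x r → (v FS.:- (z FS.:- y)) FS.:* x FS.:+ x FS.:* z FS.:= (x FS.:* v FS.:+ (x FS.:- r) FS.:* y) FS.:+ r FS.:* y)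
          F.refl v (y SF.^ q) y x (root-q x)))
        (Tr-+ _ _))))
    same-indicator : [ (x F.- root-q x) ≟K F.0# ] ≈ [ InFq? x ]
    same-indicator = indicator-cong ((x F.- root-q x) ≟K F.0#) (InFq? x)
      (λ eq → F.trans (SF.^-congˡ q (x∙y⁻¹≈ε⇒x≈y x (root-q x) eq)) (root-q^q x))
      (λ fix → F.trans (F.+-congˡ (F.-‿cong (fixed-q^ fix (m ∸ 1)))) (F.-‿inverseʳ x))

  module _ (k : ℕ) where

    open Counting F k
    open Cleanup F k using (monomial)

    count-indicator : ∀ f → N q f × 1# ≈ ∑ᵛ Q from k (λ xs → ∑F (λ y → [ eval f xs ≟K (y SF.^ q F.- y) ]))
    count-indicator f = begin
      N q f × 1#
        ≈⟨ length-filter (λ (xs , y) → eval f xs ≟K (y SF.^ q F.- y)) (cartesianProduct (tuples F.elements k) F.elements) ⟩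
      ∑ᴸ (cartesianProduct (tuples F.elements k) F.elements) (λ (xs , y) → [ eval f xs ≟K (y SF.^ q F.- y) ])
        ≈⟨ ∑ᴸ-product _,_ (tuples F.elements k) F.elements _ ⟩
      ∑ᴸ (tuples F.elements k) (λ xs → ∑ᴸ F.elements (λ y → [ eval f xs ≟K (y SF.^ q F.- y) ]))
        ≈⟨ ∑ᴸ-cong (tuples F.elements k) (λ xs → trans (∑ᴸ-elements _) (sym (∑F≈∑ (λ y → [ eval f xs ≟K (y SF.^ q F.- y) ])))) ⟩
      ∑ᴸ (tuples F.elements k) (λ xs → ∑F (λ y → [ eval f xs ≟K (y SF.^ q F.- y) ]))
        ≈⟨ ∑ᴸ-tuples k _ ⟩
      ∑ᵛ Q from k (λ xs → ∑F (λ y → [ eval f xs ≟K (y SF.^ q F.- y) ])) ∎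

    -- Orthogonality writes Q times the number of points as a sum over additive characters, indexed
    -- by x. Summing over y first yields another factor Q and restricts x to the subfield of order
    -- q; then Q is cancelled.
    count-ψ : ∀ f → N q f × 1# ≈ ∑F (λ x → [ InFq? x ] * ∑ᵛ Q from k (λ xs → ψ (x F.* eval f xs)))
    count-ψ f = ≐-injective ≐-Q (begin
      (Q × 1#) * (N q f × 1#)
        ≈⟨ trans (*-congˡ (count-indicator f)) (trans (∑ᵛ-*ˡ Q from k _ _) (∑ᵛ-cong Q from k (λ xs → ∑F-*ˡ _ _))) ⟩
      ∑ᵛ Q from k (λ xs → ∑F (λ y → (Q × 1#) * [ eval f xs ≟K (y SF.^ q F.- y) ]))
        ≈⟨ ∑ᵛ-cong Q from k (λ xs → ∑F-cong (λ y → trans (*-comm _ _) (trans (*-congʳ (difference (eval f xs) (y SF.^ q F.- y))) (sym (orthogonality _))))) ⟩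
      ∑ᵛ Q from k (λ xs → ∑F (λ y → ∑F (λ x → ψ ((eval f xs F.- (y SF.^ q F.- y)) F.* x))))
        ≈⟨ ∑ᵛ-cong Q from k (λ xs → trans (∑F-comm _) (∑F-cong (λ x → ∑-artin-schreier (eval f xs) x))) ⟩
      ∑ᵛ Q from k (λ xs → ∑F (λ x → [ InFq? x ] * (Q × 1#) * ψ (x F.* eval f xs)))
        ≈⟨ ∑F-∑ᵛ Q from k _ ⟨
      ∑F (λ x → ∑ᵛ Q from k (λ xs → [ InFq? x ] * (Q × 1#) * ψ (x F.* eval f xs)))
        ≈⟨ ∑F-cong (λ x → trans (sym (∑ᵛ-*ˡ Q from k _ _)) (solve 3 (λ i n s → i :* n :* s := n :* (i :* s)) refl _ _ _)) ⟩
      ∑F (λ x → (Q × 1#) * ([ InFq? x ] * ∑ᵛ Q from k (λ xs → ψ (x F.* eval f xs))))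
        ≈⟨ ∑F-*ˡ _ _ ⟨
      (Q × 1#) * ∑F (λ x → [ InFq? x ] * ∑ᵛ Q from k (λ xs → ψ (x F.* eval f xs))) ∎)
      where
      difference : ∀ a b → [ a ≟K b ] ≈ [ (a F.- b) ≟K F.0# ]
      difference a b = indicator-cong (a ≟K b) ((a F.- b) ≟K F.0#)
        (λ a∼b → F.trans (F.+-congʳ a∼b) (F.-‿inverseʳ b)) (x∙y⁻¹≈ε⇒x≈y a b)

    -- Coefficients and exponents are kept apart, so that the coefficients can vary while the
    -- exponents stay fixed.
    polynomial : ∀ {L} → Vec K L → Vec (Vec ℕ k) L → Poly
    polynomial []       []       = []
    polynomial (a ∷ as) (t ∷ ts) = (a , t) ∷ polynomial as ts

    polynomial-list : ∀ f → polynomial (Vec.map proj₁ (Vec.fromList f)) (Vec.map proj₂ (Vec.fromList f)) ≡ f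
    polynomial-list []      = ≡.refl
    polynomial-list (t ∷ f) = ≡.cong (t ∷_) (polynomial-list f)

    module _ {L} (r : Vec (Fin Q) L) where

      coefficients : Carrier
      coefficients = ∏ L (λ l → coefficient (toℕ (lookup r l)))

      leading : Vec K L → Carrier
      leading as = ∏ L (λ l → T (lookup as l) ^ toℕ (lookup r l))

      total cost : ℕ
      total = sumℕ L (λ l → toℕ (lookup r l))
      cost  = sumℕ L (λ l → S (toℕ (lookup r l)))

      degree : Vec (Vec ℕ k) L → Fin k → ℕ
      degree ts i = sumℕ L (λ l → toℕ (lookup r l) ℕ.* lookup (lookup ts l) i)

    T-monomial : ∀ xs t → T (monomial xs t) ≈ ∏ k (λ i → T (lookup xs i) ^ lookup t i)
    T-monomial = go k
      where
      go : ∀ k (xs : Vec K k) (t : Vec ℕ k) →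
        T (Vec.foldr′ F._*_ F.1# (Vec.zipWith SF._^_ xs t)) ≈ ∏ k (λ i → T (lookup xs i) ^ lookup t i)
      go zero    []       []      = T-1
      go (suc k) (x ∷ xs) (d ∷ t) = trans (T-* _ _) (*-cong (T-^ x d) (go k xs t))

    -- ψ turns the sum of L terms into a product, and `fourier` costs one factor M for each; M is a
    -- unit, so `count-≼` can cancel the power M^L.
    ψ-expansion : ∀ {L} (as : Vec K L) ts x xs → (M × 1#) ^ L * ψ (x F.* eval (polynomial as ts) xs) ≈
      ∑ᵛ Q id L (λ r → coefficients r * (leading r as * (T x ^ total r * ∏ k (λ i → T (lookup xs i) ^ degree r ts i))))
    ψ-expansion [] [] x xs = begin
      1# * ψ (x F.* F.0#)         ≈⟨ *-congˡ (trans (ψ-cong (F.zeroʳ x)) ψ-0) ⟩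
      1# * 1#                     ≈⟨ *-congˡ (sym (trans (*-identityˡ _) (trans (*-identityˡ _) (∏-one k (λ _ → refl))))) ⟩
      1# * (1# * (1# * ∏ k (λ _ → 1#))) ∎
    ψ-expansion {suc L} (a ∷ as) (t ∷ ts) x xs = begin
      (M × 1#) * (M × 1#) ^ L * ψ (x F.* (a F.* μ F.+ eval (polynomial as ts) xs))
        ≈⟨ *-congˡ (trans (ψ-cong (F.distribˡ x _ _)) (ψ-+ _ _)) ⟩
      (M × 1#) * (M × 1#) ^ L * (ψ (x F.* (a F.* μ)) * ψ (x F.* eval (polynomial as ts) xs))
        ≈⟨ solve 4 (λ m n s t → m :* n :* (s :* t) := (m :* s) :* (n :* t)) refl _ _ _ _ ⟩
      (M × 1#) * ψ (x F.* (a F.* μ)) * ((M × 1#) ^ L * ψ (x F.* eval (polynomial as ts) xs))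
        ≈⟨ *-cong (fourier (x F.* (a F.* μ))) (ψ-expansion as ts x xs) ⟩
      ∑ Q (λ r → coefficient (toℕ r) * T (x F.* (a F.* μ)) ^ toℕ r) * ∑ᵛ Q id L rest
        ≈⟨ ∑-*ʳ Q (λ r → coefficient (toℕ r) * T (x F.* (a F.* μ)) ^ toℕ r) _ ⟩
      ∑ Q (λ r → coefficient (toℕ r) * T (x F.* (a F.* μ)) ^ toℕ r * ∑ᵛ Q id L rest)
        ≈⟨ ∑-cong Q (λ r → trans (∑ᵛ-*ˡ Q id L _ rest) (∑ᵛ-cong Q id L (λ rs → combine r rs))) ⟩
      ∑ Q (λ r → ∑ᵛ Q id L (λ rs → coefficients (r ∷ rs) * (leading (r ∷ rs) (a ∷ as) *
        (T x ^ total (r ∷ rs) * ∏ k (λ i → T (lookup xs i) ^ degree (r ∷ rs) (t ∷ ts) i))))) ∎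
      where
      μ = monomial xs t
      rest : Vec (Fin Q) L → Carrier
      rest rs = coefficients rs * (leading rs as * (T x ^ total rs * ∏ k (λ i → T (lookup xs i) ^ degree rs ts i)))
      combine : ∀ r rs → coefficient (toℕ r) * T (x F.* (a F.* μ)) ^ toℕ r * rest rs ≈
        coefficients (r ∷ rs) * (leading (r ∷ rs) (a ∷ as) * (T x ^ total (r ∷ rs) * ∏ k (λ i → T (lookup xs i) ^ degree (r ∷ rs) (t ∷ ts) i)))
      combine r rs = begin
        coefficient n * T (x F.* (a F.* μ)) ^ n * rest rs
          ≈⟨ *-congʳ (*-congˡ (trans (^-congˡ n (trans (T-* _ _) (*-congˡ (T-* _ _)))) (trans (^-distrib-* _ _ n) (*-congˡ (^-distrib-* _ _ n))))) ⟩
        coefficient n * (T x ^ n * (T a ^ n * T μ ^ n)) * rest rs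
          ≈⟨ solve 8 (λ c x a u d l y v → c :* (x :* (a :* u)) :* (d :* (l :* (y :* v))) := (c :* d) :* ((a :* l) :* ((x :* y) :* (u :* v)))) refl
               (coefficient n) (T x ^ n) (T a ^ n) (T μ ^ n) (coefficients rs) (leading rs as) (T x ^ total rs) (∏ k (λ i → T (lookup xs i) ^ degree rs ts i)) ⟩
        (coefficient n * coefficients rs) * ((T a ^ n * leading rs as) * ((T x ^ n * T x ^ total rs) * (T μ ^ n * ∏ k (λ i → T (lookup xs i) ^ degree rs ts i))))
          ≈⟨ *-congˡ (*-congˡ (*-cong (sym (^-homo-* (T x) n (total rs))) monomials)) ⟩
        coefficients (r ∷ rs) * (leading (r ∷ rs) (a ∷ as) * (T x ^ total (r ∷ rs) * ∏ k (λ i → T (lookup xs i) ^ degree (r ∷ rs) (t ∷ ts) i))) ∎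
        where
        n = toℕ r
        monomials : T μ ^ n * ∏ k (λ i → T (lookup xs i) ^ degree rs ts i) ≈ ∏ k (λ i → T (lookup xs i) ^ (n ℕ.* lookup t i ℕ.+ degree rs ts i))
        monomials = trans (*-congʳ (trans (^-congˡ n (T-monomial xs t)) (∏-^ k _ n))) (trans (sym (∏-* k _ _))
          (∏-cong k (λ i → sym (trans (^-homo-* (T (lookup xs i)) (n ℕ.* lookup t i) (degree rs ts i))
            (*-congʳ (trans (^-congʳ _ (ℕₚ.*-comm n (lookup t i))) (sym (^-assocʳ _ (lookup t i) n))))))))

    σ : ℕ → Carrier
    σ n = ∑F (λ x → [ InFq? x ] * T x ^ n)

    -- The part of the term of r that does not involve the coefficients of the polynomial.
    weight : ∀ {L} → Vec (Vec ℕ k) L → Vec (Fin Q) L → Carrier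
    weight ts r = coefficients r * (σ (total r) * ∏ k (λ i → τ (degree r ts i)))

    -- For fixed r the summand is a product of functions of the separate variables, so that
    -- summation yields the power sums `σ` and `τ`.
    count-expansion : ∀ {L} (as : Vec K L) ts → (M × 1#) ^ L * (N q (polynomial as ts) × 1#) ≈ ∑ᵛ Q id L (λ r → leading r as * weight ts r)
    count-expansion {L} as ts = begin
      (M × 1#) ^ L * (N q f × 1#)
        ≈⟨ trans (*-congˡ (count-ψ f)) (∑F-*ˡ _ _) ⟩
      ∑F (λ x → (M × 1#) ^ L * ([ InFq? x ] * ∑ᵛ Q from k (λ xs → ψ (x F.* eval f xs))))
        ≈⟨ ∑F-cong (λ x → trans (solve 3 (λ m i s → m :* (i :* s) := i :* (m :* s)) refl _ _ _) (*-congˡ (trans (∑ᵛ-*ˡ Q from k _ _) (∑ᵛ-cong Q from k (λ xs → ψ-expansion as ts x xs))))) ⟩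
      ∑F (λ x → [ InFq? x ] * ∑ᵛ Q from k (λ xs → ∑ᵛ Q id L (λ r → summand r x xs)))
        ≈⟨ ∑F-cong (λ x → *-congˡ (∑ᵛ-comm Q from Q id k L _)) ⟩
      ∑F (λ x → [ InFq? x ] * ∑ᵛ Q id L (λ r → ∑ᵛ Q from k (λ xs → summand r x xs)))
        ≈⟨ ∑F-cong (λ x → trans (∑ᵛ-*ˡ Q id L _ _) (∑ᵛ-cong Q id L (λ r → *-congˡ (separate r x)))) ⟩
      ∑F (λ x → ∑ᵛ Q id L (λ r → [ InFq? x ] * (coefficients r * (leading r as * (T x ^ total r * ∏ k (λ i → τ (degree r ts i)))))))
        ≈⟨ ∑F-∑ᵛ Q id L _ ⟩
      ∑ᵛ Q id L (λ r → ∑F (λ x → [ InFq? x ] * (coefficients r * (leading r as * (T x ^ total r * ∏ k (λ i → τ (degree r ts i)))))))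
        ≈⟨ ∑ᵛ-cong Q id L (λ r → trans (∑F-cong (λ x → solve 5 (λ i c l t v → i :* (c :* (l :* (t :* v))) := (i :* t) :* (l :* (c :* v))) refl _ _ _ _ _))
             (trans (sym (∑F-*ʳ _ _)) (solve 4 (λ s l c v → s :* (l :* (c :* v)) := l :* (c :* (s :* v))) refl _ _ _ _))) ⟩
      ∑ᵛ Q id L (λ r → leading r as * weight ts r) ∎
      where
      f = polynomial as ts
      summand : Vec (Fin Q) L → K → Vec K k → Carrier
      summand r x xs = coefficients r * (leading r as * (T x ^ total r * ∏ k (λ i → T (lookup xs i) ^ degree r ts i)))
      separate : ∀ r x → ∑ᵛ Q from k (summand r x) ≈ coefficients r * (leading r as * (T x ^ total r * ∏ k (λ i → τ (degree r ts i))))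
      separate r x = begin
        ∑ᵛ Q from k (summand r x)
          ≈⟨ ∑ᵛ-cong Q from k (λ xs → solve 4 (λ c l t v → c :* (l :* (t :* v)) := (c :* (l :* t)) :* v) refl _ _ _ _) ⟩
        ∑ᵛ Q from k (λ xs → coefficients r * (leading r as * T x ^ total r) * ∏ k (λ i → T (lookup xs i) ^ degree r ts i))
          ≈⟨ ∑ᵛ-*ˡ Q from k _ _ ⟨
        coefficients r * (leading r as * T x ^ total r) * ∑ᵛ Q from k (λ xs → ∏ k (λ i → T (lookup xs i) ^ degree r ts i))
          ≈⟨ *-congˡ (trans (∑ᵛ-∏ Q from k (λ i x → T x ^ degree r ts i)) (∏-cong k (λ i → sym (∑F≈∑ (λ x → T x ^ degree r ts i))))) ⟩
        coefficients r * (leading r as * T x ^ total r) * ∏ k (λ i → τ (degree r ts i))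
          ≈⟨ solve 4 (λ c l t v → (c :* (l :* t)) :* v := c :* (l :* (t :* v))) refl _ _ _ _ ⟩
        coefficients r * (leading r as * (T x ^ total r * ∏ k (λ i → τ (degree r ts i)))) ∎

    -- The (Q - 1)/(q - 1)-th power of a nonzero element lies in the subfield of order q. For a
    -- suitable element its n-th power differs from 1, and multiplication by it permutes the
    -- subfield.
    σ-∤ : ∀ n → ¬ (q ∸ 1) ∣ n → σ n ≈ 0#
    σ-∤ n q-1∤n = vanish (non-root′ (ratio ℕ.* n) not-multiple)
      where
      instance
        q≢0 : NonZero q
        q≢0 = ℕₚ.m^n≢0 p e
      q-1∣M : (q ∸ 1) ∣ M
      q-1∣M = ≡.subst (λ Q → (q ∸ 1) ∣ (Q ∸ 1)) (≡.sym Q≡q^m) (pred∣pred^ q m)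
      ratio : ℕ
      ratio = _∣_.quotient q-1∣M
      M≡ : M ≡ ratio ℕ.* (q ∸ 1)
      M≡ = _∣_.equality q-1∣M
      instance
        ratio≢0 : NonZero (ratio)
        ratio≢0 = ℕ.≢-nonZero (λ eq → ℕ.≢-nonZero⁻¹ M (≡.trans M≡ (≡.cong (ℕ._* (q ∸ 1)) eq)))
      not-multiple : ¬ M ∣ ratio ℕ.* n
      not-multiple (divides j eq) = q-1∤n (divides j (ℕₚ.*-cancelˡ-≡ n _ (ratio)
        (≡.trans eq (≡.trans (≡.cong (j ℕ.*_) M≡) (x∙yz≈y∙xz j (ratio) (q ∸ 1))))))
        where open import Algebra.Properties.CommutativeSemigroup ℕₚ.*-commutativeSemigroup using (x∙yz≈y∙xz)
      vanish : (∃ λ x → (¬ x ∼ F.0#) ∧ (¬ x SF.^ (ratio ℕ.* n) ∼ F.1#)) → σ n ≈ 0#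
      vanish (x , x≁0 , x^≁1) = T-cancel (λ eq → x^≁1 (F.trans (F.sym (SF.^-assocʳ x (ratio) n)) eq)) (begin
        (T (y SF.^ n) - 1#) * σ n               ≈⟨ solve 2 (λ t s → (t :- :1) :* s := t :* s :- s) refl _ (σ n) ⟩
        T (y SF.^ n) * σ n - σ n                ≈⟨ +-congʳ (trans (∑F-*ˡ _ _) (∑F-cong scaled)) ⟩
        ∑F (λ z → [ InFq? (y F.* z) ] * T (y F.* z) ^ n) - σ n
          ≈⟨ +-congʳ (sym (∑F-scale (λ z → [ InFq? z ] * T z ^ n) (λ {z} {w} z∼w → *-cong (indicator-cong (InFq? z) (InFq? w) (InFq-resp z∼w) (InFq-resp (F.sym z∼w))) (^-congˡ n (T-cong z∼w))) (^-≉0 (ratio) x≁0))) ⟩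
        σ n - σ n                               ≈⟨ -‿inverseʳ _ ⟩
        0#                                      ∎)
        where
        y = x SF.^ ratio
        y-fixed : InFq y
        y-fixed = F.trans (SF.^-congʳ y (≡.sym (ℕₚ.suc-pred q))) (F.trans (F.*-congˡ (F.trans (SF.^-assocʳ x (ratio) (q ∸ 1))
          (F.trans (SF.^-congʳ x (≡.sym M≡)) (fermat x≁0)))) (F.*-identityʳ y))
        scaled : ∀ z → T (y SF.^ n) * ([ InFq? z ] * T z ^ n) ≈ [ InFq? (y F.* z) ] * T (y F.* z) ^ n
        scaled z = trans (solve 3 (λ a b d → a :* (b :* d) := b :* (a :* d)) refl _ _ _) (*-cong
          (indicator-cong (InFq? z) (InFq? (y F.* z))
            (λ fix → F.trans (SF.^-distrib-* y z q) (F.*-cong y-fixed fix))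
            (λ fix → FieldTheory.*-cancelˡ F (^-≉0 (ratio) x≁0) (F.trans (F.*-congʳ (F.sym y-fixed)) (F.trans (F.sym (SF.^-distrib-* y z q)) fix))))
          (trans (*-congʳ (T-^ y n)) (trans (sym (^-distrib-* (T y) (T z) n)) (^-congˡ n (sym (T-* y z))))))

    -- The subfield is closed under translation by 1, so its cardinality vanishes in K.
    σ-unit : ∀ n → 0 < n → (q ∸ 1) ∣ n → Unit (σ n)
    σ-unit n@(suc n′) _ (divides j n≡) ε≈0 = -≉0 F.1≉0 (F.trans (F.sym sum≈-1) (F.trans (F.sym residue) ε≈0))
      where
      instance
        q≢0 : NonZero q
        q≢0 = ℕₚ.m^n≢0 p e
      d : K → K
      d x = SF.[_] (InFq? x)
      d-cong : ∀ {x y} → x ∼ y → d x ∼ d y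
      d-cong {x} {y} x∼y = SF.indicator-cong (InFq? x) (InFq? y) (InFq-resp x∼y) (InFq-resp (F.sym x∼y))
      d-shift : ∀ x → d (x F.+ F.1#) ∼ d x
      d-shift x = SF.indicator-cong (InFq? (x F.+ F.1#)) (InFq? x)
        (λ fix → +-cancelʳ F.1# _ _ (F.trans (F.sym power) fix)) (λ fix → F.trans power (F.+-congʳ fix))
        where
        power : (x F.+ F.1#) SF.^ q ∼ x SF.^ q F.+ F.1#
        power = F.trans (frobenius^ e x F.1#) (F.+-congˡ (SF.1^ q))
      cardinality : ΣF.∑F d ∼ F.0#
      cardinality = +-cancelˡ (ΣF.∑F (λ x → d x F.* x)) _ _ (F.trans (F.sym (ΣF.∑F-+ _ _))
        (F.trans (ΣF.∑F-cong (λ x → F.trans (FS.solve 2 (λ d x → d FS.:* x FS.:+ d FS.:= d FS.:* (x FS.:+ FS.:1)) F.refl (d x) x) (F.*-congʳ (F.sym (d-shift x)))))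
        (F.trans (F.sym (ΣF.∑F-permute (F._+ F.1#) (F._- F.1#) F.+-congʳ F.+-congʳ
            (FS.solve 1 (λ x → x FS.:- FS.:1 FS.:+ FS.:1 FS.:= x) F.refl) (FS.solve 1 (λ x → x FS.:+ FS.:1 FS.:- FS.:1 FS.:= x) F.refl)
            (λ x → d x F.* x) (λ x∼y → F.*-cong (d-cong x∼y) x∼y)))
          (F.sym (F.+-identityʳ _)))))
      summand : ∀ x → ε ([ InFq? x ] * T x ^ n) ∼ d x F.+ SF.[_] (x ≟K F.0#) F.* (F.- d x)
      summand x = F.trans (ε-* _ _) (F.trans (F.*-cong (ε-indicator (InFq? x)) (F.trans (ε-^ (T x) n) (SF.^-congˡ n (ε-T x)))) (value x))
        where
        ε-indicator : ∀ {a} {A : Set a} (A? : Dec A) → ε [ A? ] ∼ SF.[_] A?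
        ε-indicator (yes _) = ε-1
        ε-indicator (no _)  = ε-0
        value : ∀ x → d x F.* x SF.^ n ∼ d x F.+ SF.[_] (x ≟K F.0#) F.* (F.- d x)
        value x with x ≟K F.0#
        ... | yes x∼0 = F.trans (F.trans (F.*-congˡ (F.trans (F.*-congʳ x∼0) (F.zeroˡ _))) (F.zeroʳ _))
          (F.sym (F.trans (F.+-congˡ (F.trans (F.*-congʳ (SF.[_]-yes (x ≟K F.0#) x∼0)) (F.*-identityˡ _))) (F.-‿inverseʳ _)))
        ... | no x≁0 = F.trans fixed (F.sym (F.trans (F.+-congˡ (F.trans (F.*-congʳ (SF.[_]-no (x ≟K F.0#) x≁0)) (F.zeroˡ _))) (F.+-identityʳ _)))
          where
          fixed : d x F.* x SF.^ n ∼ d x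
          fixed = by-membership (InFq? x)
            where
            by-membership : (fix? : Dec (InFq x)) → SF.[_] fix? F.* x SF.^ n ∼ SF.[_] fix?
            by-membership (no _)    = F.zeroˡ _
            by-membership (yes fix) = F.trans (F.*-identityˡ _) (F.trans (SF.^-congʳ x (≡.trans n≡ (ℕₚ.*-comm j (q ∸ 1))))
              (F.trans (F.sym (SF.^-assocʳ x (q ∸ 1) j)) (F.trans (SF.^-congˡ j (FieldTheory.*-cancelˡ F x≁0
                (F.trans (SF.^-congʳ x (ℕₚ.suc-pred q)) (F.trans fix (F.sym (F.*-identityʳ x)))))) (SF.1^ j))))
      residue : ε (σ n) ∼ ΣF.∑F (λ x → d x F.+ SF.[_] (x ≟K F.0#) F.* (F.- d x))
      residue = F.trans (ε-∑F _) (ΣF.∑F-cong summand)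
      sum≈-1 : ΣF.∑F (λ x → d x F.+ SF.[_] (x ≟K F.0#) F.* (F.- d x)) ∼ F.- F.1#
      sum≈-1 = F.trans (ΣF.∑F-+ _ _) (F.trans (F.+-cong cardinality (ΣF.∑F-δ F.0# (λ x → F.- d x) (λ x∼y → F.-‿cong (d-cong x∼y))))
        (F.trans (F.+-identityˡ _) (F.-‿cong (SF.[_]-yes (InFq? F.0#) (SF.0^ q)))))

    deficit : ℕ → ℕ
    deficit = whenZero (E ℕ.* (p ∸ 1))

    τ-exact : ∀ n → M ∣ n → deficit n ≐ τ n
    τ-exact zero    _   = ≐-cong (sym τ-0) ≐-Q
    τ-exact (suc n) M∣n = ≐-cong (sym (τ-∣ (suc n) M∣n)) (≐-unit Unit-M)

    coefficients-exact : ∀ {L} (r : Vec (Fin Q) L) → cost r ≐ coefficients r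
    coefficients-exact {L} r = ≐-∏ L _ _ (λ l → coefficient-exact (toℕ (lookup r l)) (ℕₚ.≤-pred (Fin.toℕ<n (lookup r l))))

    -- When a congruence fails, `σ` or one of the `τ` vanishes, so `bound` is only asked for r that
    -- satisfy them all. The sum `σ` enters with the trivial bound 0.
    weight-≼ : ∀ {L} B ts (r : Vec (Fin Q) L) →
      ((q ∸ 1) ∣ total r → (∀ i → M ∣ degree r ts i) → B ≤ cost r ℕ.+ sumℕ k (λ i → deficit (degree r ts i))) → B ≼ weight ts r
    weight-≼ {L} B ts r bound with (q ∸ 1) ∣? total r | Fin.all? (λ i → M ∣? degree r ts i)
    ... | yes q-1∣ | yes M∣ = ≼-mono (bound q-1∣ M∣) (≼-* (≐⇒≼ (coefficients-exact r))
      (≼-* 0≼ (≐⇒≼ (≐-∏ k _ (λ i → τ (degree r ts i)) (λ i → τ-exact (degree r ts i) (M∣ i))))))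
    ... | no q-1∤ | _ = ≼-zero (trans (*-congˡ (trans (*-congʳ (σ-∤ (total r) q-1∤)) (zeroˡ _))) (zeroʳ _))
    ... | yes _ | no ¬M∣ = ≼-zero (trans (*-congˡ (trans (*-congˡ (vanish (Fin.¬∀⟶∃¬ k _ (λ i → M ∣? degree r ts i) ¬M∣))) (zeroʳ _))) (zeroʳ _))
      where
      vanish : (∃ λ i → ¬ M ∣ degree r ts i) → ∏ k (λ i → τ (degree r ts i)) ≈ 0#
      vanish (i , M∤) = ∏-zero k i (τ-∤ (degree r ts i) M∤)

    weight-≐ : ∀ {L} ts (r : Vec (Fin Q) L) → 0 < total r → (q ∸ 1) ∣ total r →
      (∀ i → 0 < degree r ts i ∧ M ∣ degree r ts i) → cost r ≐ weight ts r
    weight-≐ {L} ts r 0<total q-1∣ degrees = ≡.subst (_≐ weight ts r) (≡.trans (≡.cong (cost r ℕ.+_) (no-deficit k)) (ℕₚ.+-identityʳ _))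
      (≐-* (coefficients-exact r) (≐-* (≐-unit (σ-unit (total r) 0<total q-1∣))
        (≐-∏ k (λ _ → 0) (λ i → τ (degree r ts i)) (λ i → ≐-cong (sym (τ-∣ (degree r ts i) {{ℕ.>-nonZero (proj₁ (degrees i))}} (proj₂ (degrees i)))) (≐-unit Unit-M)))))
      where
      no-deficit : ∀ k → sumℕ k (λ _ → 0) ≡ 0
      no-deficit zero    = ≡.refl
      no-deficit (suc k) = no-deficit k

    ≼-∑ᵛ : ∀ {s} n {a} {A : Set a} (g : Fin n → A) L f → (∀ v → s ≼ f v) → s ≼ ∑ᵛ n g L f
    ≼-∑ᵛ n g zero    f s≼f = s≼f []
    ≼-∑ᵛ n g (suc L) f s≼f = ≼-∑ n _ (λ i → ≼-∑ᵛ n g L _ (λ v → s≼f (g i ∷ v)))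

    Unit-^ : ∀ {x} n → Unit x → Unit (x ^ n)
    Unit-^ zero    ux = Unit-1
    Unit-^ (suc n) ux = Unit-* ux (Unit-^ n ux)

    count-≼ : ∀ {L} B (as : Vec K L) ts →
      (∀ r → (q ∸ 1) ∣ total r → (∀ i → M ∣ degree r ts i) → B ≤ cost r ℕ.+ sumℕ k (λ i → deficit (degree r ts i))) →
      B ≼ N q (polynomial as ts) × 1#
    count-≼ {L} B as ts bound = ≼-cancel (Unit-^ L Unit-M) (≼-cong (sym (count-expansion as ts))
      (≼-∑ᵛ Q id L _ (λ r → ≼-* {0} 0≼ (weight-≼ B ts r (bound r)))))

    -- Interpolation in each variable: the coefficient of T a ^ r with 0 < r < M is recovered by
    -- summing against T a ^ (M − r), that of T a ^ 0 at a = 0, and that of T a ^ M from the plain sum.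
    extract : ∀ {s} L (W : Vec (Fin Q) L → Carrier) →
      (∀ is → s ≼ ∑ᵛ Q id L (λ r → leading r (Vec.map from is) * W r)) → ∀ r → s ≼ W r
    extract zero    W s≼P [] = ≼-cong (*-identityˡ _) (s≼P [])
    extract {s} (suc L) W s≼P (r ∷ rs) = extract L (λ rs → W (r ∷ rs))
      (λ is → coordinate (slice (Vec.map from is)) (λ i → ≼-cong (regroup (from i) (Vec.map from is)) (s≼P (i ∷ is))) r) rs
      where
      slice : Vec K L → Fin Q → Carrier
      slice as r = ∑ᵛ Q id L (λ rs → leading rs as * W (r ∷ rs))
      regroup : ∀ a as → ∑ᵛ Q id (suc L) (λ r → leading r (a ∷ as) * W r) ≈ ∑ Q (λ r → T a ^ toℕ r * slice as r)
      regroup a as = ∑-cong Q (λ r → trans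
        (∑ᵛ-cong Q id L (λ rs → *-assoc (T a ^ toℕ r) (leading rs as) (W (r ∷ rs))))
        (sym (∑ᵛ-*ˡ Q id L (T a ^ toℕ r) (λ rs → leading rs as * W (r ∷ rs)))))
      coordinate : (C : Fin Q → Carrier) → (∀ i → s ≼ ∑ Q (λ r → T (from i) ^ toℕ r * C r)) → ∀ r → s ≼ C r
      coordinate C s≼ = λ { zero → s≼C₀ ; (suc i) → at-suc i }
        where
        s≼C₀ : s ≼ C zero
        s≼C₀ = ≼-cong (trans (+-cong (*-identityˡ _) (∑-zero M (λ r → trans (*-congʳ (trans (*-congʳ (trans (T-cong (strictlyInverseʳ F.0#)) T-0)) (zeroˡ _))) (zeroˡ _)))) (+-identityʳ _))
          (s≼ (to F.0#))
        at-suc : ∀ i → s ≼ C (suc i)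
        at-suc i = ≼-cancel Unit-M (≼-cong isolate (≼-+ {s} s≼sum (≼-* {0} {s} 0≼ (≼-∑ M _ s≼others))))
          where
          n = suc (toℕ i)
          n≤M : n ≤ M
          n≤M = Fin.toℕ<n i
          term : Fin Q → Carrier
          term r = τ (M ∸ n ℕ.+ toℕ r) * C r
          sum≈ : ∑F (λ a → T a ^ (M ∸ n) * ∑ Q (λ r → T a ^ toℕ r * C r)) ≈ ∑ Q term
          sum≈ = trans (∑F-cong (λ a → trans (∑-*ˡ Q (T a ^ (M ∸ n)) (λ r → T a ^ toℕ r * C r)) (∑-cong Q (λ r →
              trans (sym (*-assoc (T a ^ (M ∸ n)) (T a ^ toℕ r) (C r))) (*-congʳ (sym (^-homo-* (T a) (M ∸ n) (toℕ r))))))))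
            (trans (∑F-∑ Q (λ a r → T a ^ (M ∸ n ℕ.+ toℕ r) * C r)) (∑-cong Q (λ r → sym (∑F-*ʳ (λ a → T a ^ (M ∸ n ℕ.+ toℕ r)) (C r)))))
          s≼sum : s ≼ ∑ Q term
          s≼sum = ≼-cong sum≈ (≼-cong (sym (∑F≈∑ _)) (≼-∑ Q _ (λ j → ≼-* {0} {s} {T (from j) ^ (M ∸ n)} 0≼ (s≼ j))))
          others = ∑ M (λ j → term (punchIn (suc i) j))
          isolate : ∑ Q term + - 1# * others ≈ (M × 1#) * C (suc i)
          isolate = trans (+-congʳ (∑-remove M (suc i) term))
            (trans (solve 2 (λ t o → t :+ o :+ :- :1 :* o := t) refl (term (suc i)) others)
              (*-congʳ (trans (reflexive (≡.cong τ (ℕₚ.m∸n+n≡m n≤M))) (τ-∣ M (divides 1 (≡.sym (ℕₚ.*-identityˡ M)))))))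
          s≼others : ∀ j → s ≼ term (punchIn (suc i) j)
          s≼others j = other (punchIn (suc i) j) (Fin.punchInᵢ≢i (suc i) j)
            where
            other : ∀ r → ¬ r ≡ suc i → s ≼ term r
            -- For n = M this term carries `τ 0` = Q and need not vanish, which is why the bound for
            -- `C zero` is obtained first.
            other zero     _   = ≼-* {0} {s} 0≼ s≼C₀
            other (suc r) r≢i = ≼-zero (trans (*-congʳ (τ-∤ _ not-multiple)) (zeroˡ _))
              where
              -- The exponent lies strictly between 0 and 2 M, and it equals M only for r = i.
              not-multiple : ¬ M ∣ (M ∸ n ℕ.+ suc (toℕ r))
              not-multiple (divides zero eq) = ℕₚ.1+n≢0 (≡.trans (≡.sym (ℕₚ.+-suc (M ∸ n) (toℕ r))) eq)
              not-multiple (divides 1 eq) = r≢i (Fin.toℕ-injective (ℕₚ.+-cancelˡ-≡ (M ∸ n) _ _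
                (≡.trans eq (≡.trans (ℕₚ.*-identityˡ M) (≡.sym (ℕₚ.m∸n+n≡m n≤M))))))
              not-multiple (divides (suc (suc t)) eq) = ℕₚ.<⇒≱ (ℕₚ.+-mono-<-≤ (ℕₚ.∸-monoʳ-< z<s n≤M) (Fin.toℕ<n r))
                (≡.subst (M ℕ.+ M ≤_) (≡.sym eq) (ℕₚ.+-monoʳ-≤ M (ℕₚ.m≤m+n M (t ℕ.* M))))

-- Replacing exponent vectors by vectors in 𝒯 without raising the cost

module Combinatorics where

  open ℕ using (ℕ; zero; suc; NonTrivial; NonZero; _+_; _*_; _∸_; _^_; _<_; _≤_; s≤s; z≤n; z<s)
  open Support using (whenZero)
  open import Relation.Binary.PropositionalEquality

  open import Data.Fin.Base using (Fin; zero; suc; toℕ; fromℕ<; splitAt)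
  import Data.Fin.Properties as Fin
  open import Data.Nat.Divisibility using (_∣_; divides; ∣m+n∣m⇒∣n; ∣m∣n⇒∣m+n; ∣-trans; _∣0; ∣m⇒∣m*n; ∣n⇒∣m*n)
  open import Data.Nat.DivMod using (_%_; _/_; m≡m%n+[m/n]*n; m%n<n)
  open import Data.Nat.Properties
  open import Data.Nat.Solver using (module +-*-Solver)
  open import Data.Product.Base using (∃; _,_; proj₁; proj₂; _×_)
  open import Data.Sum.Base using (inj₁; inj₂; [_,_]′)
  open import Data.Vec.Base as Vec using (Vec; []; _∷_; lookup; insertAt)
  open import Data.Vec.Properties using (insertAt-lookup)
  open import Defs using (∣_∣₁)
  open import Relation.Nullary.Decidable using (_×-dec_; decidable-stable)
  open BigOperator +-0-commutativeMonoid renaming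
    (big to ∑; big-cong to ∑-cong; big-ε to ∑-zero; big-∙ to ∑-+; big-comm to ∑-comm; big-remove to ∑-remove)
  open +-*-Solver

  ∑-*ʳ : ∀ n f x → ∑ n f * x ≡ ∑ n (λ i → f i * x)
  ∑-*ʳ zero    f x = refl
  ∑-*ʳ (suc n) f x = trans (*-distribʳ-+ x (f zero) _) (cong (f zero * x +_) (∑-*ʳ n _ x))

  ∑-mono : ∀ n {f g : Fin n → ℕ} → (∀ i → f i ≤ g i) → ∑ n f ≤ ∑ n g
  ∑-mono zero    f≤g = z≤n
  ∑-mono (suc n) f≤g = +-mono-≤ (f≤g zero) (∑-mono n (λ i → f≤g (suc i)))

  term≤∑ : ∀ n (f : Fin n → ℕ) i → f i ≤ ∑ n f
  term≤∑ (suc n) f zero    = m≤m+n (f zero) _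
  term≤∑ (suc n) f (suc i) = ≤-trans (term≤∑ n (λ i → f (suc i)) i) (m≤n+m _ (f zero))

  positive-term : ∀ n (f : Fin n → ℕ) → 0 < ∑ n f → ∃ λ i → 0 < f i
  positive-term (suc n) f 0<∑ with f zero in eq
  ... | suc _ = zero , subst (0 <_) (sym eq) z<s
  ... | zero  with positive-term n (λ i → f (suc i)) 0<∑
  ...   | i , 0<f = suc i , 0<f

  ∑-single : ∀ n i (f : Fin n → ℕ) → (∀ j → ¬ j ≡ i → f j ≡ 0) → ∑ n f ≡ f i
  ∑-single (suc n) i f others = trans (∑-remove n i f)
    (trans (cong (f i +_) (∑-zero n (λ j → others _ (Fin.punchInᵢ≢i i j)))) (+-identityʳ (f i)))

  ∑-splitAt : ∀ m n (f : Fin m → ℕ) (g : Fin n → ℕ) → ∑ (m + n) (λ l → [ f , g ]′ (splitAt m l)) ≡ ∑ m f + ∑ n g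
  ∑-splitAt zero    n f g = refl
  ∑-splitAt (suc m) n f g = trans (cong (f zero +_) (trans (∑-cong (m + n) peel) (∑-splitAt m n (λ i → f (suc i)) g)))
    (sym (+-assoc (f zero) _ _))
    where
    peel : ∀ l → [ f , g ]′ (splitAt (suc m) (suc l)) ≡ [ (λ i → f (suc i)) , g ]′ (splitAt m l)
    peel l with splitAt m l
    ... | inj₁ _ = refl
    ... | inj₂ _ = refl

  ∣-∑ : ∀ {d} n {f : Fin n → ℕ} → (∀ i → d ∣ f i) → d ∣ ∑ n f
  ∣-∑ zero    d∣f = _ ∣0
  ∣-∑ (suc n) d∣f = ∣m∣n⇒∣m+n (d∣f zero) (∣-∑ n (λ i → d∣f (suc i)))

  lookup-head : ∀ {k} (v : Vec ℕ (suc k)) → lookup v zero ≡ Vec.head v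
  lookup-head (_ ∷ _) = refl

  lookup-tail : ∀ {k} (v : Vec ℕ (suc k)) i → lookup v (suc i) ≡ lookup (Vec.tail v) i
  lookup-tail (_ ∷ _) i = refl

  sum-head-tail : ∀ {k} (v : Vec ℕ (suc k)) → Vec.sum v ≡ Vec.head v + Vec.sum (Vec.tail v)
  sum-head-tail (_ ∷ _) = refl

  *-positive : ∀ {a b} → 0 < a * b → 0 < a × 0 < b
  *-positive {zero}          ()
  *-positive {suc a} {zero}  0<ab = contradiction (subst (0 <_) (*-zeroʳ a) 0<ab) λ ()
  *-positive {suc a} {suc b} _    = z<s , z<s

  module _ (M : ℕ) (0<M : 0 < M) where

    private instance
      M≢0 : NonZero M
      M≢0 = ℕ.>-nonZero 0<M

    infix 4 _≋_
    record _≋_ (x y : ℕ) : Set where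
      constructor congruent
      field
        a b : ℕ
        eq  : x + a * M ≡ y + b * M

    ≋-sum : ∀ n {u v : Fin n → ℕ} → (∀ l → u l ≋ v l) → ∑ n u ≋ ∑ n v
    ≋-sum zero    u≋v = congruent 0 0 refl
    ≋-sum (suc n) {u} {v} u≋v with u≋v zero | ≋-sum n (λ l → u≋v (suc l))
    ... | congruent a b eq | congruent a′ b′ eq′ = congruent (a + a′) (b + b′)
      (trans (solve 5 (λ x y a a′ m → x :+ y :+ (a :+ a′) :* m := (x :+ a :* m) :+ (y :+ a′ :* m)) refl (u zero) _ a a′ M)
        (trans (cong₂ _+_ eq eq′)
          (sym (solve 5 (λ x y a a′ m → x :+ y :+ (a :+ a′) :* m := (x :+ a :* m) :+ (y :+ a′ :* m)) refl (v zero) _ b b′ M))))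

    ≋-*ˡ : ∀ r {x y} → x ≋ y → r * x ≋ r * y
    ≋-*ˡ r {x} {y} (congruent a b eq) = congruent (r * a) (r * b)
      (trans (solve 4 (λ r x a m → r :* x :+ r :* a :* m := r :* (x :+ a :* m)) refl r x a M)
        (trans (cong (r *_) eq) (sym (solve 4 (λ r x a m → r :* x :+ r :* a :* m := r :* (x :+ a :* m)) refl r y b M))))

    ≋-∣ : ∀ {d x y} → d ∣ M → x ≋ y → d ∣ y → d ∣ x
    ≋-∣ {d} d∣M (congruent a b eq) d∣y = ∣m+n∣m⇒∣n
      (subst (d ∣_) (trans (sym eq) (+-comm _ (a * M))) (∣m∣n⇒∣m+n d∣y (∣n⇒∣m*n b d∣M))) (∣n⇒∣m*n a d∣M)

    -- Representative in [1 , M], except that 0 represents itself.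
    ρ excess : ℕ → ℕ
    ρ zero         = 0
    ρ (suc n)      = suc (n % M)
    excess zero    = 0
    excess (suc n) = n / M

    ρ-excess : ∀ n → ρ n + excess n * M ≡ n
    ρ-excess zero    = refl
    ρ-excess (suc n) = cong suc (sym (m≡m%n+[m/n]*n n M))

    ρ≤M : ∀ n → ρ n < suc M
    ρ≤M zero    = z<s
    ρ≤M (suc n) = s≤s (m%n<n n M)

    0<ρ : ∀ {n} → 0 < n → 0 < ρ n
    0<ρ {suc n} _ = z<s

    top : Fin (suc M)
    top = fromℕ< (n<1+n M)

    ρF : ℕ → Fin (suc M)
    ρF n = fromℕ< (ρ≤M n)

    toℕ-ρF : ∀ n → toℕ (ρF n) ≡ ρ n
    toℕ-ρF n = Fin.toℕ-fromℕ< (ρ≤M n)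

    tops : ∀ k → ℕ → Vec (Fin (suc M)) k
    tops zero    c       = []
    tops (suc k) zero    = zero ∷ tops k zero
    tops (suc k) (suc c) = top ∷ tops k c

    sum-tops : ∀ k c → c ≤ k → ∣ tops k c ∣₁ ≡ c * M
    sum-tops zero    zero    _         = refl
    sum-tops (suc k) zero    _         = sum-tops k zero z≤n
    sum-tops (suc k) (suc c) (s≤s c≤k) = cong₂ _+_ (Fin.toℕ-fromℕ< (n<1+n M)) (sum-tops k c c≤k)

    M∣tops : ∀ k c i → M ∣ toℕ (lookup (tops k c) i)
    M∣tops (suc k) zero    zero    = M ∣0
    M∣tops (suc k) zero    (suc i) = M∣tops k zero i
    M∣tops (suc k) (suc c) zero    = divides 1 (trans (Fin.toℕ-fromℕ< (n<1+n M)) (sym (*-identityˡ M)))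
    M∣tops (suc k) (suc c) (suc i) = M∣tops k c i

    0<tops : ∀ k c i → k ≤ c → 0 < toℕ (lookup (tops k c) i)
    0<tops (suc k) (suc c) zero    _         = subst (0 <_) (sym (Fin.toℕ-fromℕ< (n<1+n M))) 0<M
    0<tops (suc k) (suc c) (suc i) (s≤s k≤c) = 0<tops k c i k≤c

    -- The multiples of M in n fill later coordinates, which are therefore 0 or M, and the first
    -- coordinate takes a number congruent to n. So only the first coordinate matters for
    -- divisibility by M.
    fill : ∀ k → ℕ → Vec (Fin (suc M)) (suc k)
    fill k n = ρF n ∷ tops k (excess n)

    excess≤ : ∀ k n → n ≤ suc k * M → excess n ≤ k
    excess≤ k zero    _  = z≤n
    excess≤ k (suc n) n≤ = ≤-pred (*-cancelʳ-< M (excess (suc n)) (suc k)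
      (<-≤-trans (s≤s (m≤n+m (n / M * M) (n % M))) (subst (_≤ suc k * M) (sym (ρ-excess (suc n))) n≤)))

    sum-fill : ∀ k n → n ≤ suc k * M → ∣ fill k n ∣₁ ≡ n
    sum-fill k n n≤ = trans (cong₂ _+_ (toℕ-ρF n) (sum-tops k (excess n) (excess≤ k n n≤))) (ρ-excess n)

    -- From n > k M and `ρ n` ≤ M it follows that `excess n` ≥ k, enough to put M into each of the k
    -- later coordinates.
    0<fill : ∀ k n → k * M < n → ∀ i → 0 < toℕ (lookup (fill k n) i)
    0<fill k n kM<n zero    = subst (0 <_) (sym (toℕ-ρF n)) (0<ρ (≤-<-trans z≤n kM<n))
    0<fill k n kM<n (suc i) = 0<tops k (excess n) i (≤-pred (*-cancelʳ-< M k (suc (excess n))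
      (<-≤-trans kM<n (subst (_≤ suc (excess n) * M) (ρ-excess n) (+-monoˡ-≤ (excess n * M) (≤-pred (ρ≤M n)))))))

    ρ≋ : ∀ n → ρ n ≋ n
    ρ≋ n = congruent (excess n) 0 (trans (ρ-excess n) (sym (+-identityʳ n)))

    M∣∑-sum : ∀ {L} (r : Fin L → ℕ) k (t : Fin L → Vec ℕ k) →
      (∀ i → M ∣ ∑ L (λ l → r l * lookup (t l) i)) → M ∣ ∑ L (λ l → r l * Vec.sum (t l))
    M∣∑-sum {L} r zero    t _ = subst (M ∣_) (sym (∑-zero L (λ l → trans (cong (λ v → r l * Vec.sum v) (empty (t l))) (*-zeroʳ (r l))))) (M ∣0)
      where
      empty : ∀ (v : Vec ℕ 0) → v ≡ []
      empty [] = refl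
    M∣∑-sum {L} r (suc k) t M∣ = subst (M ∣_) (sym (trans (∑-cong L split) (∑-+ L _ _)))
      (∣m∣n⇒∣m+n (subst (M ∣_) (∑-cong L (λ l → cong (r l *_) (lookup-head (t l)))) (M∣ zero))
        (M∣∑-sum r k (λ l → Vec.tail (t l)) (λ i → subst (M ∣_) (∑-cong L (λ l → cong (r l *_) (lookup-tail (t l) i))) (M∣ (suc i)))))
      where
      split : ∀ l → r l * Vec.sum (t l) ≡ r l * Vec.head (t l) + r l * Vec.sum (Vec.tail (t l))
      split l = trans (cong (r l *_) (sum-head-tail (t l))) (*-distribˡ-+ (r l) _ _)

    -- Peel off one coordinate x, passing on j ≥ 0 surplus multiples of M.
    coordinate carry : ℕ → ℕ → ℕ
    coordinate zero    zero    = 0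
    coordinate zero    (suc j) = M
    coordinate (suc x) j       = ρ (suc x)
    carry zero    zero    = 0
    carry zero    (suc j) = j
    carry (suc x) j       = j + excess (suc x)

    coordinate-carry : ∀ x j → coordinate x j + carry x j * M ≡ x + j * M
    coordinate-carry zero    zero    = refl
    coordinate-carry zero    (suc j) = refl
    coordinate-carry (suc x) j       =
      trans (solve 4 (λ r j e m → r :+ (j :+ e) :* m := (r :+ e :* m) :+ j :* m) refl (ρ (suc x)) j (excess (suc x)) M)
        (cong (_+ j * M) (ρ-excess (suc x)))

    coordinate≤M : ∀ x j → coordinate x j < suc M
    coordinate≤M zero    zero    = z<s
    coordinate≤M zero    (suc j) = n<1+n M
    coordinate≤M (suc x) j       = ρ≤M (suc x)

    0<coordinate : ∀ {x} j → 0 < x → 0 < coordinate x j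
    0<coordinate {suc x} j _ = 0<ρ {suc x} z<s

    coordinate≋ : ∀ x j → coordinate x j ≋ x
    coordinate≋ x j = congruent (carry x j) j (coordinate-carry x j)

    -- j l counts the multiples of M split off from coordinates already treated and still to be
    -- placed; it starts at 0. The size is prescribed only for r l > 0, since the other terms
    -- contribute nothing.
    record Lift {L} k (r j : Fin L → ℕ) (t : Fin L → Vec ℕ k) : Set where
      field
        t′        : Fin L → Vec (Fin (suc M)) k
        size      : ∀ l → 0 < r l → ∣ t′ l ∣₁ ≡ Vec.sum (t l) + j l * M
        divisible : ∀ i → M ∣ ∑ L (λ l → r l * toℕ (lookup (t′ l) i))
        positive  : ∀ i → 0 < ∑ L (λ l → r l * toℕ (lookup (t′ l) i))

    -- Exponents reduced modulo M leave surplus multiples of M, which are put into vanishing coordinates.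
    -- If these do not suffice for some term, the remaining coordinates of all terms are merged into
    -- one coordinate, and for that term the surplus makes every one of them positive.
    lift : ∀ {L} k (r j : Fin L → ℕ) (t : Fin L → Vec ℕ k) →
      (∀ l → 0 < r l → Vec.sum (t l) + j l * M ≤ k * M) →
      (∀ i → M ∣ ∑ L (λ l → r l * lookup (t l) i)) →
      (∀ i → 0 < ∑ L (λ l → r l * lookup (t l) i)) →
      Lift k r j t
    lift zero r j t fits M∣ 0< = record
      { t′        = λ l → []
      ; size      = λ l 0<r → sym (n≤0⇒n≡0 (fits l 0<r))
      ; divisible = λ ()
      ; positive  = λ ()
      }
    lift {L} (suc k) r j t fits M∣ 0< = cases (Fin.any? (λ l → (0 <? r l) ×-dec ¬? (rest l ≤? k * M)))
      where
      x : Fin L → ℕ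
      x l = Vec.head (t l)
      j′ rest n : Fin L → ℕ
      j′ l   = carry (x l) (j l)
      rest l = Vec.sum (Vec.tail (t l)) + j′ l * M
      n l    = Vec.sum (t l) + j l * M
      n≡ : ∀ l → coordinate (x l) (j l) + rest l ≡ n l
      n≡ l = trans (solve 4 (λ c s j m → c :+ (s :+ j :* m) := (c :+ j :* m) :+ s) refl (coordinate (x l) (j l)) (Vec.sum (Vec.tail (t l))) (j′ l) M)
        (trans (cong (_+ Vec.sum (Vec.tail (t l))) (coordinate-carry (x l) (j l)))
        (trans (solve 4 (λ x s j m → (x :+ j :* m) :+ s := (x :+ s) :+ j :* m) refl (x l) (Vec.sum (Vec.tail (t l))) (j l) M)
          (cong (_+ j l * M) (sym (sum-head-tail (t l))))))
      cases : Dec (∃ λ l → 0 < r l × ¬ rest l ≤ k * M) → Lift (suc k) r j t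
      cases (no ¬overfull) = record
        { t′        = λ l → c l ∷ Lift.t′ lifted l
        ; size      = λ l 0<r → trans (cong₂ _+_ (toℕ-c l) (Lift.size lifted l 0<r)) (n≡ l)
        ; divisible = λ { zero → ≋-∣ (divides 1 (sym (*-identityˡ M))) (≋-sum L λ l → ≋-*ˡ (r l)
                            (subst₂ _≋_ (sym (toℕ-c l)) (sym (lookup-head (t l))) (coordinate≋ (x l) (j l)))) (M∣ zero)
                        ; (suc i) → Lift.divisible lifted i }
        ; positive  = λ { zero → positive₀ (positive-term L _ (0< zero)) ; (suc i) → Lift.positive lifted i }
        }
        where
        c : Fin L → Fin (suc M)
        c l = fromℕ< (coordinate≤M (x l) (j l))
        toℕ-c : ∀ l → toℕ (c l) ≡ coordinate (x l) (j l)
        toℕ-c l = Fin.toℕ-fromℕ< (coordinate≤M (x l) (j l))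
        lifted : Lift k r j′ (λ l → Vec.tail (t l))
        lifted = lift k r j′ (λ l → Vec.tail (t l))
          (λ l 0<r → decidable-stable (rest l ≤? k * M) (λ overfull → ¬overfull (l , 0<r , overfull)))
          (λ i → subst (M ∣_) (∑-cong L (λ l → cong (r l *_) (lookup-tail (t l) i))) (M∣ (suc i)))
          (λ i → subst (0 <_) (∑-cong L (λ l → cong (r l *_) (lookup-tail (t l) i))) (0< (suc i)))
        positive₀ : (∃ λ l → 0 < r l * lookup (t l) zero) → 0 < ∑ L (λ l → r l * toℕ (c l))
        positive₀ (l , 0<rx) with *-positive {r l} 0<rx
        ... | 0<r , 0<x = <-≤-trans (*-mono-< 0<r (subst (0 <_) (sym (toℕ-c l)) (0<coordinate (j l) (subst (0 <_) (lookup-head (t l)) 0<x))))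
          (term≤∑ L (λ l → r l * toℕ (c l)) l)
      cases (yes (l , 0<r , overfull)) = record
        { t′        = λ l → fill k (n l)
        ; size      = λ l 0<r → sum-fill k (n l) (fits l 0<r)
        ; divisible = λ { zero → ≋-∣ (divides 1 (sym (*-identityˡ M))) (≋-sum L λ l → ≋-*ˡ (r l) (subst (_≋ n l) (sym (toℕ-ρF (n l))) (ρ≋ (n l)))) M∣∑n
                        ; (suc i) → M∣∑tops i }
        ; positive  = λ i → <-≤-trans (*-mono-< 0<r (0<fill k (n l) kM<n i)) (term≤∑ L (λ l → r l * toℕ (lookup (fill k (n l)) i)) l)
        }
        where
        kM<n : k * M < n l
        kM<n = <-≤-trans (≰⇒> overfull) (subst (rest l ≤_) (n≡ l) (m≤n+m (rest l) (coordinate (x l) (j l))))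
        -- n l is congruent to the total degree of t l, and the weighted sum of total degrees is the
        -- sum over all coordinates of quantities divisible by M.
        M∣∑n : M ∣ ∑ L (λ l → r l * n l)
        M∣∑n = ≋-∣ (divides 1 (sym (*-identityˡ M))) (≋-sum L λ l → ≋-*ˡ (r l) (congruent 0 (j l) (+-identityʳ (n l)))) (M∣∑-sum r (suc k) t M∣)
        M∣∑tops : ∀ i → M ∣ ∑ L (λ l → r l * toℕ (lookup (tops k (excess (n l))) i))
        M∣∑tops i = ∣-∑ L (λ l → ∣n⇒∣m*n (r l) (M∣tops k (excess (n l)) i))

    sum-insertAt : ∀ {k} (v : Vec (Fin (suc M)) k) i x → ∣ insertAt v i x ∣₁ ≡ toℕ x + ∣ v ∣₁
    sum-insertAt v       zero    x = refl
    sum-insertAt (y ∷ v) (suc i) x = trans (cong (toℕ y +_) (sum-insertAt v i x))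
      (solve 3 (λ x y s → y :+ (x :+ s) := x :+ (y :+ s)) refl (toℕ x) (toℕ y) ∣ v ∣₁)

    with-positive : ∀ {k} n → 0 < n → n ≤ k * M → (i : Fin k) →
      ∃ λ (t : Vec (Fin (suc M)) k) → ∣ t ∣₁ ≡ n × 0 < toℕ (lookup t i)
    with-positive {suc k} n 0<n n≤ i = insertAt (tops k (excess n)) i (ρF n) ,
      trans (sum-insertAt (tops k (excess n)) i (ρF n)) (sum-fill k n n≤) ,
      subst (0 <_) (sym (trans (cong toℕ (insertAt-lookup (tops k (excess n)) i (ρF n))) (toℕ-ρF n))) (0<ρ 0<n)

    module Merge (p : ℕ) .{{nt : NonTrivial p}} (E : ℕ) (Q≡p^E : suc M ≡ p ^ E) {d} (d∣M : d ∣ M)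
      {k n} (τ : Fin n → Vec (Fin (suc M)) k) where

      open DigitSum p using (S; S-0; S-+; reduce; S-max)

      record Valid (r : Fin n → Fin (suc M)) : Set where
        field
          total      : d ∣ ∑ n (λ j → toℕ (r j))
          coordinates : ∀ i → 0 < ∑ n (λ j → toℕ (r j) * toℕ (lookup (τ j) i)) ×
                             M ∣ ∑ n (λ j → toℕ (r j) * toℕ (lookup (τ j) i))

      costs : (Fin n → Fin (suc M)) → ℕ
      costs r = ∑ n (λ j → S (toℕ (r j)))

      S-∑ : ∀ L (f : Fin L → ℕ) → S (∑ L f) ≤ ∑ L (λ l → S (f l))
      S-∑ zero    f = ≤-reflexive S-0
      S-∑ (suc L) f = ≤-trans (S-+ (f zero) _) (+-monoʳ-≤ (S (f zero)) (S-∑ L _))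

      pick : ∀ {a} {A : Set a} → Dec A → ℕ → ℕ
      pick (yes _) x = x
      pick (no _)  x = 0

      ∑-pick : ∀ i x → ∑ n (λ j → pick (i Fin.≟ j) x) ≡ x
      ∑-pick i x = trans (∑-single n i _ (λ j j≢i → unpicked j j≢i)) picked
        where
        unpicked : ∀ j → ¬ j ≡ i → pick (i Fin.≟ j) x ≡ 0
        unpicked j j≢i with i Fin.≟ j
        ... | yes i≡j = contradiction (sym i≡j) j≢i
        ... | no _    = refl
        picked : pick (i Fin.≟ i) x ≡ x
        picked with i Fin.≟ i
        ... | yes _  = refl
        ... | no i≢i = contradiction refl i≢i

      -- Several terms may land on the same position of the list τ. Their r are added and the sum is
      -- brought back into [0, M] by `reduce`, modulo M; neither step raises digit sums, and
      -- positive values stay positive, so that no coordinate sum becomes zero.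
      merge : ∀ {L} (r : Fin L → ℕ) (t : Fin L → Vec (Fin (suc M)) k) (idx : Fin L → Fin n) →
        (∀ l → 0 < r l → τ (idx l) ≡ t l) →
        d ∣ ∑ L r →
        (∀ i → M ∣ ∑ L (λ l → r l * toℕ (lookup (t l) i))) →
        (∀ i → 0 < ∑ L (λ l → r l * toℕ (lookup (t l) i))) →
        ∃ λ r′ → Valid r′ × costs r′ ≤ ∑ L (λ l → S (r l))
      merge {L} r t idx τ∘idx d∣total M∣ 0< = r′ , record
        { total      = ≋-∣ d∣M (≋-sum n r′≋R) (subst (d ∣_) (sym ∑R≡) d∣total)
        ; coordinates = λ i → positive i (positive-term L _ (0< i)) ,
            ≋-∣ (divides 1 (sym (*-identityˡ M))) (≋-sum n (λ j → subst₂ _≋_ (*-comm (toℕ (lookup (τ j) i)) _) (*-comm (toℕ (lookup (τ j) i)) _)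
              (≋-*ˡ (toℕ (lookup (τ j) i)) (r′≋R j)))) (subst (M ∣_) (sym (weighted≡ i)) (M∣ i))
        } , ≤-trans (∑-mono n S-r′≤) (≤-trans (∑-mono n (λ j → S-∑ L (part j))) (≤-reflexive S-parts))
        where
        part : Fin n → Fin L → ℕ
        part j l = pick (idx l Fin.≟ j) (r l)
        R : Fin n → ℕ
        R j = ∑ L (part j)
        ∑R≡ : ∑ n R ≡ ∑ L r
        ∑R≡ = trans (∑-comm n L part) (∑-cong L (λ l → ∑-pick (idx l) (r l)))
        reduced : ∀ j → ∃ λ x → x < suc M × S x ≤ S (R j) × (0 < R j → 0 < x) × (∃ λ c → R j ≡ x + c * M)
        reduced j = reduce E Q≡p^E 0<M (R j)
        r′ : Fin n → Fin (suc M)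
        r′ j = fromℕ< (proj₁ (proj₂ (reduced j)))
        toℕ-r′ : ∀ j → toℕ (r′ j) ≡ proj₁ (reduced j)
        toℕ-r′ j = Fin.toℕ-fromℕ< (proj₁ (proj₂ (reduced j)))
        S-r′≤ : ∀ j → S (toℕ (r′ j)) ≤ S (R j)
        S-r′≤ j = subst (λ x → S x ≤ S (R j)) (sym (toℕ-r′ j)) (proj₁ (proj₂ (proj₂ (reduced j))))
        r′≋R : ∀ j → toℕ (r′ j) ≋ R j
        r′≋R j = subst (_≋ R j) (sym (toℕ-r′ j)) (let c , eq = proj₂ (proj₂ (proj₂ (proj₂ (reduced j)))) in
          congruent c 0 (trans (sym eq) (sym (+-identityʳ (R j)))))
        0<r′ : ∀ j → 0 < R j → 0 < toℕ (r′ j)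
        0<r′ j 0<R = subst (0 <_) (sym (toℕ-r′ j)) (proj₁ (proj₂ (proj₂ (proj₂ (reduced j)))) 0<R)
        pick-map : ∀ {a} {A : Set a} (A? : Dec A) (f : ℕ → ℕ) → f 0 ≡ 0 → ∀ x → f (pick A? x) ≡ pick A? (f x)
        pick-map (yes _) f f0 x = refl
        pick-map (no _)  f f0 x = f0
        S-parts : ∑ n (λ j → ∑ L (λ l → S (part j l))) ≡ ∑ L (λ l → S (r l))
        S-parts = trans (∑-comm n L (λ j l → S (part j l))) (∑-cong L (λ l →
          trans (∑-cong n (λ j → pick-map (idx l Fin.≟ j) S S-0 (r l))) (∑-pick (idx l) (S (r l)))))
        entry : ∀ l i → r l * toℕ (lookup (τ (idx l)) i) ≡ r l * toℕ (lookup (t l) i)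
        entry l i with 0 <? r l
        ... | yes 0<r = cong (λ v → r l * toℕ (lookup v i)) (τ∘idx l 0<r)
        ... | no r≯0  = trans (cong (_* toℕ (lookup (τ (idx l)) i)) r≡0) (sym (cong (_* toℕ (lookup (t l) i)) r≡0))
          where
          r≡0 : r l ≡ 0
          r≡0 = n≤0⇒n≡0 (≮⇒≥ r≯0)
        moved : ∀ i l j → part j l * toℕ (lookup (τ j) i) ≡ pick (idx l Fin.≟ j) (r l * toℕ (lookup (t l) i))
        moved i l j with idx l Fin.≟ j
        ... | yes refl = entry l i
        ... | no _     = refl
        weighted≡ : ∀ i → ∑ n (λ j → R j * toℕ (lookup (τ j) i)) ≡ ∑ L (λ l → r l * toℕ (lookup (t l) i))
        weighted≡ i = trans (∑-cong n (λ j → ∑-*ʳ L (part j) (toℕ (lookup (τ j) i))))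
          (trans (∑-comm n L (λ j l → part j l * toℕ (lookup (τ j) i)))
            (∑-cong L (λ l → trans (∑-cong n (moved i l)) (∑-pick (idx l) _))))
        positive : ∀ i → (∃ λ l → 0 < r l * toℕ (lookup (t l) i)) → 0 < ∑ n (λ j → toℕ (r′ j) * toℕ (lookup (τ j) i))
        positive i (l , 0<rt) = <-≤-trans (*-mono-< (0<r′ (idx l) 0<R) (subst (λ v → 0 < toℕ (lookup v i)) (sym (τ∘idx l 0<r)) (proj₂ (*-positive {r l} 0<rt))))
          (term≤∑ n (λ j → toℕ (r′ j) * toℕ (lookup (τ j) i)) (idx l))
          where
          0<r = proj₁ (*-positive {r l} 0<rt)
          own : part (idx l) l ≡ r l
          own with idx l Fin.≟ idx l
          ... | yes _  = refl
          ... | no neq = contradiction refl neq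
          0<R : 0 < R (idx l)
          0<R = <-≤-trans (subst (0 <_) (sym own) 0<r) (term≤∑ L (part (idx l)) l)

      -- The factor Q from a coordinate whose degree vanishes pays for an additional term with r = M.
      module _ (D : ℕ → Set) (index : ∀ t → D ∣ t ∣₁ → ∃ λ j → τ j ≡ t) (D≤ : ∀ {x} → D x → x ≤ k * M)
        (δ : ℕ) (0<δ : 0 < δ) (Dδ : D δ) where

        private
          deficit : ℕ → ℕ
          deficit = whenZero (E * (p ∸ 1))

          filler : ∀ i → ∃ λ (t : Vec (Fin (suc M)) k) → ∣ t ∣₁ ≡ δ × 0 < toℕ (lookup t i)
          filler = with-positive δ 0<δ (D≤ Dδ)

          extra : ℕ → ℕ
          extra zero    = M
          extra (suc _) = 0

          -- M has E digits, all equal to p - 1, so a filler term costs exactly the valuation of the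
          -- factor Q that pays for it.
          S-extra : ∀ x → S (extra x) ≡ deficit x
          S-extra zero    = trans (cong (λ q → S (q ∸ 1)) Q≡p^E) (S-max E)
          S-extra (suc _) = S-0

        bound : ∀ {L} (r : Fin L → ℕ) (t : Fin L → Vec ℕ k) → (∀ l → D (Vec.sum (t l))) → Fin k →
          d ∣ ∑ L r → (∀ i → M ∣ ∑ L (λ l → r l * lookup (t l) i)) →
          ∃ λ r′ → Valid r′ × costs r′ ≤ ∑ L (λ l → S (r l)) + ∑ k (λ i → whenZero (E * (p ∸ 1)) (∑ L (λ l → r l * lookup (t l) i)))
        bound {L} r t Dt i₀ d∣ M∣ = finish (merge r⁺ t′ idx τ∘idx d∣⁺ (Lift.divisible lifted) (Lift.positive lifted))
          where
          degree : Fin k → ℕ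
          degree i = ∑ L (λ l → r l * lookup (t l) i)
          rᵉ : Fin k → ℕ
          rᵉ i = extra (degree i)
          tᵉ : Fin k → Vec ℕ k
          tᵉ i = Vec.map toℕ (proj₁ (filler i))
          r⁺ : Fin (L + k) → ℕ
          r⁺ l = [ r , rᵉ ]′ (splitAt L l)
          t⁺ : Fin (L + k) → Vec ℕ k
          t⁺ l = [ t , tᵉ ]′ (splitAt L l)
          Dt⁺ : ∀ l → D (Vec.sum (t⁺ l))
          Dt⁺ l with splitAt L l
          ... | inj₁ l = Dt l
          ... | inj₂ i = subst D (sym (proj₁ (proj₂ (filler i)))) Dδ
          ∑⁺ : ∀ i → ∑ (L + k) (λ l → r⁺ l * lookup (t⁺ l) i) ≡ degree i + ∑ k (λ i′ → rᵉ i′ * lookup (tᵉ i′) i)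
          ∑⁺ i = trans (∑-cong (L + k) distribute) (∑-splitAt L k (λ l → r l * lookup (t l) i) (λ i′ → rᵉ i′ * lookup (tᵉ i′) i))
            where
            distribute : ∀ l → r⁺ l * lookup (t⁺ l) i ≡ [ (λ l → r l * lookup (t l) i) , (λ i′ → rᵉ i′ * lookup (tᵉ i′) i) ]′ (splitAt L l)
            distribute l with splitAt L l
            ... | inj₁ _ = refl
            ... | inj₂ _ = refl
          M∣extra : ∀ x → M ∣ extra x
          M∣extra zero    = divides 1 (sym (*-identityˡ M))
          M∣extra (suc _) = M ∣0
          M∣⁺ : ∀ i → M ∣ ∑ (L + k) (λ l → r⁺ l * lookup (t⁺ l) i)
          M∣⁺ i = subst (M ∣_) (sym (∑⁺ i)) (∣m∣n⇒∣m+n (M∣ i) (∣-∑ k (λ i′ → ∣m⇒∣m*n (lookup (tᵉ i′) i) (M∣extra (degree i′)))))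
          d∣⁺ : d ∣ ∑ (L + k) r⁺
          d∣⁺ = subst (d ∣_) (sym (∑-splitAt L k r rᵉ)) (∣m∣n⇒∣m+n d∣ (∣-∑ k (λ i → ∣-trans d∣M (M∣extra (degree i)))))
          0<⁺ : ∀ i → 0 < ∑ (L + k) (λ l → r⁺ l * lookup (t⁺ l) i)
          0<⁺ i = subst (0 <_) (sym (∑⁺ i)) (by-degree (degree i) refl)
            where
            by-degree : ∀ x → degree i ≡ x → 0 < degree i + ∑ k (λ i′ → rᵉ i′ * lookup (tᵉ i′) i)
            by-degree (suc x) eq = <-≤-trans (subst (0 <_) (sym eq) z<s) (m≤m+n (degree i) _)
            by-degree zero    eq = <-≤-trans (*-mono-< (subst (0 <_) (sym (cong extra eq)) 0<M) (subst (0 <_) (sym (lookup-map i toℕ (proj₁ (filler i)))) (proj₂ (proj₂ (filler i)))))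
              (≤-trans (term≤∑ k (λ i′ → rᵉ i′ * lookup (tᵉ i′) i) i) (m≤n+m _ (degree i)))
              where open import Data.Vec.Properties using (lookup-map)
          lifted : Lift k r⁺ (λ _ → 0) t⁺
          lifted = lift k r⁺ (λ _ → 0) t⁺ (λ l _ → subst (_≤ k * M) (sym (+-identityʳ _)) (D≤ (Dt⁺ l))) M∣⁺ 0<⁺
          t′ = Lift.t′ lifted
          -- A term with r = 0 has no prescribed exponent vector, but still has to be assigned a
          -- position; the one of the filler for `i₀` serves as a default.
          choose : ∀ l → Dec (0 < r⁺ l) → ∃ λ j → 0 < r⁺ l → τ j ≡ t′ l
          choose l (yes 0<r) with index (t′ l) (subst D (sym (trans (Lift.size lifted l 0<r) (+-identityʳ _))) (Dt⁺ l))
          ... | j , eq = j , λ _ → eq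
          choose l (no r≯0) = proj₁ (index (proj₁ (filler i₀)) (subst D (sym (proj₁ (proj₂ (filler i₀)))) Dδ)) , λ 0<r → contradiction 0<r r≯0
          idx : Fin (L + k) → Fin n
          idx l = proj₁ (choose l (0 <? r⁺ l))
          τ∘idx : ∀ l → 0 < r⁺ l → τ (idx l) ≡ t′ l
          τ∘idx l = proj₂ (choose l (0 <? r⁺ l))
          S⁺ : ∑ (L + k) (λ l → S (r⁺ l)) ≡ ∑ L (λ l → S (r l)) + ∑ k (λ i → deficit (degree i))
          S⁺ = trans (∑-cong (L + k) distribute) (∑-splitAt L k (λ l → S (r l)) (λ i → deficit (degree i)))
            where
            distribute : ∀ l → S (r⁺ l) ≡ [ (λ l → S (r l)) , (λ i → deficit (degree i)) ]′ (splitAt L l)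
            distribute l with splitAt L l
            ... | inj₁ _ = refl
            ... | inj₂ i = S-extra (degree i)
          finish : (∃ λ r′ → Valid r′ × costs r′ ≤ ∑ (L + k) (λ l → S (r⁺ l))) →
            ∃ λ r′ → Valid r′ × costs r′ ≤ ∑ L (λ l → S (r l)) + ∑ k (λ i → deficit (degree i))
          finish (r′ , valid , cost≤) = r′ , valid , ≤-trans cost≤ (≤-reflexive S⁺)

-- The minimum and its comparison with the number of points

module Main {c ℓ M} (F : FiniteField (ℕ.suc M) c ℓ) (p : ℕ.ℕ) (pr : Prime p) (e m k : ℕ.ℕ)
  (1≤m : 1 ℕ.≤ m) (1≤k : 1 ℕ.≤ k) (Q≡q^m : ℕ.suc M ≡ (p ℕ.^ e) ℕ.^ m)
  (D : Subset (ℕ.suc (k ℕ.* M))) (D-nonempty : Nonempty D) (D≢0 : D ≢ ⁅ Data.Fin.Base.zero ⁆)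
  (V : Valuation.RamifiedRing F p) where

  open import Defs
  open import Algebra.Bundles using (CommutativeRing)
  open import Defs
  open import Data.Fin.Subset using (Subset; Nonempty; ⁅_⁆)
  open import Data.Nat.Primality using (Prime; prime⇒nonTrivial)
  open import Relation.Binary.PropositionalEquality as ≡ using (_≡_; _≢_; refl)

  open import Data.Fin.Base using (Fin; zero; suc; toℕ; fromℕ<)
  import Data.Fin.Properties as Fin
  open import Data.Empty using (⊥; ⊥-elim)
  open import Data.Integer.Base using (+_)
  open import Data.List.Base as List using (List; []; _∷_; length; allFin)
  open import Data.List.Membership.Propositional using (_∈_)
  open import Data.List.Membership.Propositional.Properties using (∈-filter⁺; ∈-allFin; ∈-cartesianProductWith⁺; ∈-lookup)
  open import Data.List.Relation.Unary.All as All using (All; []; _∷_)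
  open import Data.List.Relation.Unary.All.Properties using (all-filter)
  open import Data.List.Relation.Unary.Any as Any using (here)
  open import Data.List.Relation.Unary.Any.Properties using (lookup-index)
  open ℕ using (ℕ; zero; suc; NonZero; _<_; _≤_; _∸_)
  open import Data.Nat.Divisibility using (_∣_; _∤_; _∣?_; divides; ∣-trans; ∣m+n∣m⇒∣n; n∣m*n)
  import Data.Nat.Properties as ℕₚ
  open import Data.Product.Base using (∃; _×_; _,_; proj₁; proj₂)
  open import Data.Rational.Base as ℚ using (ℚ; _/_)
  open import Data.Vec.Base as Vec using (Vec; []; _∷_; lookup)
  open import Data.Vec.Properties using (lookup∘tabulate; lookup-map; tabulate-cong; tabulate∘lookup)
  open import Function.Bundles using (Inverse)
  open import Relation.Binary.Construct.Add.Supremum.NonStrict ℚ._≤_ using (_≤⁺_; _≤⊤⁺; [_])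
  open import Relation.Nullary.Construct.Add.Supremum using () renaming ([_] to [_]⁺)
  open import Relation.Nullary.Decidable using (_×-dec_; decidable-stable)
  open import Relation.Unary using (_⊆_)

  private
    q = p ℕ.^ e
    E = e ℕ.* m
    instance
      p-nonTrivial = prime⇒nonTrivial pr

  open Inverse (FiniteField.enumeration F) using (from)
  open DigitSum p using (S; S-∣; 1<p; p≢0)
  open FieldTheory F using (0<M)

  Q≡p^E : suc M ≡ p ℕ.^ E
  Q≡p^E = ≡.trans Q≡q^m (ℕₚ.^-*-assoc p e m)

  instance
    q≢0 : NonZero q
    q≢0 = ℕₚ.m^n≢0 p e

    p∸1≢0 : NonZero (p ∸ 1)
    p∸1≢0 = ℕ.>-nonZero (ℕₚ.m<n⇒0<n∸m 1<p)

  open Support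
  open Optimisation q (suc M) k D
  open Counting F k
  open Cleanup F k using (restrictᴰ; eval-restrictᴰ; restrictᴰ-∈; Deg-⊆; N-cong)
  open BigOperator ℕₚ.+-0-commutativeMonoid using () renaming (big to ∑; big≡sum to ∑≡sum; big-cong to ∑-cong)

  private
    module V = Valuation.RamifiedRing V
  open Valuation.Valuations F p pr E Q≡p^E V
  open Sums V.O using (×1-homo-*; ×-congˡ) renaming (_×_ to _·_)
  open CommutativeRing V.O using () renaming (1# to V-1#; sym to V-sym; trans to V-trans)

  n = length 𝒯

  τ : Fin n → Vec (Fin (suc M)) k
  τ = List.lookup 𝒯

  q-1∣M : (q ∸ 1) ∣ M
  q-1∣M = ≡.subst (λ Q → (q ∸ 1) ∣ (Q ∸ 1)) (≡.sym Q≡q^m) (pred∣pred^ q m)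

  open Combinatorics.Merge M 0<M p E Q≡p^E q-1∣M τ

  index : ∀ t → ⟦ D ⟧ ∣ t ∣₁ → ∃ λ j → τ j ≡ t
  index t t∈D = Any.index t∈𝒯 , ≡.sym (lookup-index t∈𝒯)
    where
    ∈-tuples : ∀ {a} {A : Set a} {xs : List A} → (∀ x → x ∈ xs) → ∀ k (v : Vec A k) → v ∈ tuples xs k
    ∈-tuples ∈xs zero    []      = here refl
    ∈-tuples ∈xs (suc k) (x ∷ v) = ∈-cartesianProductWith⁺ _∷_ (∈xs x) (∈-tuples ∈xs k v)
    t∈𝒯 : t ∈ 𝒯
    t∈𝒯 = ∈-filter⁺ (λ t → ∣ t ∣₁ ∈⟦ D ⟧?) (∈-tuples ∈-allFin k t) t∈D

  τ∈D : ∀ j → ⟦ D ⟧ ∣ τ j ∣₁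
  τ∈D j = All.lookup (all-filter (λ t → ∣ t ∣₁ ∈⟦ D ⟧?) (tuples (allFin (suc M)) k)) (∈-lookup {xs = 𝒯} j)

  D≤ : ∀ {x} → ⟦ D ⟧ x → x ≤ k ℕ.* M
  D≤ (i , _ , refl) = ℕₚ.≤-pred (Fin.toℕ<n i)

  δ : ∃ λ d → 0 < d × ⟦ D ⟧ d
  δ = nonzero-member D D-nonempty D≢0

  i₀ : Fin k
  i₀ = fromℕ< 1≤k

  bounded-below : ∀ {L} (r : Fin L → ℕ) (t : Fin L → Vec ℕ k) → (∀ l → ⟦ D ⟧ (Vec.sum (t l))) →
    (q ∸ 1) ∣ ∑ L r → (∀ i → M ∣ ∑ L (λ l → r l ℕ.* lookup (t l) i)) →
    ∃ λ r′ → Valid r′ × costs r′ ≤ ∑ L (λ l → S (r l)) ℕ.+ ∑ k (λ i → whenZero (E ℕ.* (p ∸ 1)) (∑ L (λ l → r l ℕ.* lookup (t l) i)))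
  bounded-below r t t∈D = bound ⟦ D ⟧ index D≤ (proj₁ δ) (proj₁ (proj₂ δ)) (proj₂ (proj₂ δ)) r t t∈D i₀

  Valid? : ∀ r → Dec (Valid r)
  Valid? r with (q ∸ 1) ∣? ∑ n (λ j → toℕ (r j)) | Fin.all? (λ i → (0 ℕₚ.<? ∑ n (λ j → toℕ (r j) ℕ.* toℕ (lookup (τ j) i))) ×-dec (M ∣? ∑ n (λ j → toℕ (r j) ℕ.* toℕ (lookup (τ j) i))))
  ... | yes total | yes coords = yes (record { total = total ; coordinates = coords })
  ... | no ¬total | _          = no λ valid → ¬total (Valid.total valid)
  ... | yes _     | no ¬coords = no λ valid → ¬coords (Valid.coordinates valid)

  Valid-resp : ∀ {r r′} → (∀ j → r j ≡ r′ j) → Valid r → Valid r′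
  Valid-resp eq valid = record
    { total       = ≡.subst ((q ∸ 1) ∣_) (∑-cong n (λ j → ≡.cong toℕ (eq j))) (Valid.total valid)
    ; coordinates = λ i → let same = ∑-cong n (λ j → ≡.cong (λ x → toℕ x ℕ.* toℕ (lookup (τ j) i)) (eq j)) in
        ≡.subst (0 <_) same (proj₁ (Valid.coordinates valid i)) , ≡.subst (M ∣_) same (proj₂ (Valid.coordinates valid i))
    }

  minimum : ∃ λ r → Valid r × (∀ r′ → Valid r′ → costs r ≤ costs r′)
  minimum = argmin-function Valid? Valid-resp costs (λ eq → ∑-cong n (λ j → ≡.cong (λ x → S (toℕ x)) (eq j)))
    -- For the empty family all coordinate sums vanish, so the fillers alone produce an admissible
    -- family.
    (some (bounded-below {0} (λ ()) (λ ()) (λ ()) (divides 0 refl) (λ i → divides 0 refl)))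
    where
    some : ∀ {x} → (∃ λ r′ → Valid r′ × costs r′ ≤ x) → ∃ Valid
    some (r′ , valid , _) = r′ , valid

  r* : Fin n → Fin (suc M)
  r* = proj₁ minimum

  r*-valid : Valid r*
  r*-valid = proj₁ (proj₂ minimum)

  K : ℕ
  K = costs r*

  -- S r ≡ r modulo p − 1, and p − 1 divides q − 1.
  p-1∣K : (p ∸ 1) ∣ K
  p-1∣K = ∣m+n∣m⇒∣n (≡.subst ((p ∸ 1) ∣_) (≡.trans total≡ (ℕₚ.+-comm K _)) (∣-trans (pred∣pred^ p e) (Valid.total r*-valid))) (n∣m*n (proj₁ quotients))
    where
    sums : ∀ L (r : Fin L → ℕ) → ∃ λ h → ∑ L r ≡ ∑ L (λ l → S (r l)) ℕ.+ h ℕ.* (p ∸ 1)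
    sums zero    r = 0 , refl
    sums (suc L) r with S-∣ (r zero) | sums L (λ l → r (suc l))
    ... | a , eq | b , eq′ = a ℕ.+ b , ≡.trans (≡.cong₂ ℕ._+_ eq eq′)
      (solve 5 (λ s t a b x → (s :+ a :* x) :+ (t :+ b :* x) := (s :+ t) :+ (a :+ b) :* x) refl (S (r zero)) (∑ L (λ l → S (r (suc l)))) a b (p ∸ 1))
      where
      open import Data.Nat.Solver using (module +-*-Solver)
      open +-*-Solver
    quotients = sums n (λ j → toℕ (r* j))
    total≡ : ∑ n (λ j → toℕ (r* j)) ≡ K ℕ.+ proj₁ quotients ℕ.* (p ∸ 1)
    total≡ = proj₂ quotients

  C : ℕ
  C = _∣_.quotient p-1∣K

  K≡ : K ≡ C ℕ.* (p ∸ 1)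
  K≡ = _∣_.equality p-1∣K

  μ : ℚ
  μ = cost p r*

  cost≡ : ∀ r → cost p r ≡ + costs r / (p ∸ 1)
  cost≡ r = ≡.cong (λ x → + x / (p ∸ 1)) (≡.sym (∑≡sum n (λ j → S (toℕ (r j)))))

  μ≡C : μ ≡ + C / 1
  μ≡C = ≡.trans (cost≡ r*) (≡.trans (≡.cong (λ x → + x / (p ∸ 1)) K≡) (/-exact C (p ∸ 1)))

  isMinimum : IsMinimum Admissible (cost p) μ
  isMinimum = record
    { attained   = r* , record
      { total      = ≡.subst ((q ∸ 1) ∣_) (∑≡sum n (λ j → toℕ (r* j))) (Valid.total r*-valid)
      ; coordinate = λ i → ≡.subst (λ x → 0 < x × M ∣ x) (∑≡sum n (λ j → toℕ (r* j) ℕ.* toℕ (lookup (τ j) i))) (Valid.coordinates r*-valid i)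
      } , refl
    ; lowerBound = λ r admissible → ≡.subst₂ ℚ._≤_ (≡.sym (cost≡ r*)) (≡.sym (cost≡ r)) (/-mono (p ∸ 1) (proj₂ (proj₂ minimum) r record
      { total       = ≡.subst ((q ∸ 1) ∣_) (≡.sym (∑≡sum n (λ j → toℕ (r j)))) (Admissible.total admissible)
      ; coordinates = λ i → ≡.subst (λ x → 0 < x × M ∣ x) (≡.sym (∑≡sum n (λ j → toℕ (r j) ℕ.* toℕ (lookup (τ j) i)))) (Admissible.coordinate admissible i)
      }))
    }

  private module X = Expansion F p pr e m Q≡q^m Q≡p^E 1≤m V

  count-≼ : ∀ {L} as (ts : Vec (Vec ℕ k) L) → (∀ l → ⟦ D ⟧ (Vec.sum (lookup ts l))) → K ≼ N q (X.polynomial k as ts) · V-1#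
  count-≼ {L} as ts ts∈D = X.count-≼ k K as ts λ r q-1∣ M∣ → least (bounded-below (λ l → toℕ (lookup r l)) (lookup ts) ts∈D q-1∣ M∣)
    where
    least : ∀ {x} → (∃ λ r′ → Valid r′ × costs r′ ≤ x) → K ≤ x
    least (r′ , valid , cost≤) = ℕₚ.≤-trans (proj₂ (proj₂ minimum) r′ valid) cost≤

  -- Both numbers are compared π-adically, where p^v has valuation v (p - 1) and K = C (p - 1); then
  -- p - 1 cancels.
  C≤exponent : ∀ {N′ v} → 0 < N′ → p ℕ.^ v ∣ N′ → p ℕ.^ suc v ∤ N′ → K ≼ N′ · V-1# → C ≤ v
  C≤exponent {N′} {v} 0<N p^v∣ p^∤ K≼ = ℕₚ.*-cancelʳ-≤ C v (p ∸ 1)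
    (≡.subst (_≤ v ℕ.* (p ∸ 1)) K≡ (≐-≼⇒≤ (≐-ℕ {v} {N′} p^v∣ p^∤) K≼))

  μ≤ν : ∀ N′ → K ≼ N′ · V-1# → [ μ ]⁺ ≤⁺ toℚ⁺ (ν p N′)
  μ≤ν N′ K≼ = cases (N′ ℕₚ.≟ 0)
    where
    at-exponent : 0 < N′ → (∃ λ v → p ℕ.^ v ∣ N′ × p ℕ.^ suc v ∤ N′) → [ μ ]⁺ ≤⁺ toℚ⁺ (ν p N′)
    at-exponent 0<N (v , p^v∣ , p^∤) = ≡.subst₂ (λ x y → [ x ]⁺ ≤⁺ toℚ⁺ y) (≡.sym μ≡C) (≡.sym (ν-unique 1<p {N′} {v} 0<N p^v∣ p^∤))
      [ /-mono {C} {v} 1 (C≤exponent {N′} {v} 0<N p^v∣ p^∤ K≼) ]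
    cases : Dec (N′ ≡ 0) → [ μ ]⁺ ≤⁺ toℚ⁺ (ν p N′)
    cases (yes N≡0) = ≡.subst (λ N′ → [ μ ]⁺ ≤⁺ toℚ⁺ (ν p N′)) (≡.sym N≡0) ([ μ ]⁺ ≤⊤⁺)
    cases (no N≢0)  = at-exponent 0<N (exponent 1<p N′ 0<N)
      where
      0<N = ℕₚ.n≢0⇒n>0 N≢0

  lower : ∀ f → Deg f ⊆ ⟦ D ⟧ → [ μ ]⁺ ≤⁺ toℚ⁺ (ν p (N q f))
  lower f Deg⊆D = ≡.subst (λ N′ → [ μ ]⁺ ≤⁺ toℚ⁺ (ν p N′)) (≡.sym (≡.trans
      (N-cong q f g (eval-restrictᴰ (_∈⟦ D ⟧?) f Deg⊆D)) (≡.cong (N q) (≡.sym (X.polynomial-list k g)))))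
    (μ≤ν (N q (X.polynomial k as ts)) (count-≼ as ts (λ l → ≡.subst (λ t → ⟦ D ⟧ (Vec.sum t)) (≡.sym (lookup-map l proj₂ (Vec.fromList g))) (lookup-All (restrictᴰ-∈ (_∈⟦ D ⟧?) f) l))))
    where
    g = restrictᴰ (_∈⟦ D ⟧?) f
    as = Vec.map proj₁ (Vec.fromList g)
    ts = Vec.map proj₂ (Vec.fromList g)
    lookup-All : ∀ {a b} {A : Set a} {P : A → Set b} {xs : List A} → All P xs → ∀ l → P (lookup (Vec.fromList xs) l)
    lookup-All (px ∷ _)   zero    = px
    lookup-All (_ ∷ pxs) (suc l) = lookup-All pxs l

  exponents : Vec (Vec ℕ k) n
  exponents = Vec.tabulate (λ j → Vec.map toℕ (τ j))

  exponents∈D : ∀ j → ⟦ D ⟧ (Vec.sum (lookup exponents j))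
  exponents∈D j = ≡.subst (λ t → ⟦ D ⟧ (Vec.sum t)) (≡.sym (lookup∘tabulate (λ j → Vec.map toℕ (τ j)) j)) (τ∈D j)

  -- One term for each element of `𝒯`. The coefficients are given by their indices in the field, so
  -- that they range over a finite set of functions that can be searched.
  family : (Fin n → Fin (suc M)) → Poly
  family a = X.polynomial k (Vec.map from (Vec.tabulate a)) exponents

  family-Deg : ∀ a → Deg (family a) ⊆ ⟦ D ⟧
  family-Deg a = Deg-⊆ (_∈⟦ D ⟧?) (family a) (all-terms (Vec.map from (Vec.tabulate a)) exponents exponents∈D)
    where
    all-terms : ∀ {L} as (ts : Vec (Vec ℕ k) L) → (∀ l → ⟦ D ⟧ (Vec.sum (lookup ts l))) → All (λ (_ , t) → ⟦ D ⟧ (Vec.sum t)) (X.polynomial k as ts)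
    all-terms []       []       _    = []
    all-terms (_ ∷ as) (_ ∷ ts) ts∈D = ts∈D zero ∷ all-terms as ts (λ l → ts∈D (suc l))

  -- One more factor p raises the valuation by p - 1 ≥ 1, hence beyond K.
  multiple-≼ : ∀ N′ → p ℕ.^ suc C ∣ N′ → suc K ≼ N′ · V-1#
  multiple-≼ N′ (divides j eq) = ≼-mono (≡.subst (suc K ≤_) (≡.cong (p ∸ 1 ℕ.+_) K≡) (ℕₚ.+-monoˡ-≤ K (ℕₚ.m<n⇒0<n∸m 1<p)))
    (≼-cong (V-trans (V-sym (×1-homo-* j (p ℕ.^ suc C))) (×-congˡ (≡.sym eq))) (≼-* {0} 0≼ (≐⇒≼ (≐-p^ (suc C)))))

  module _ (all-divisible : ∀ a → p ℕ.^ suc C ∣ N q (family a)) where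

    private
      r : Vec (Fin (suc M)) n
      r = Vec.tabulate r*

      lookup-r : ∀ j → lookup r j ≡ r* j
      lookup-r = lookup∘tabulate r*

    total≡ : X.total k r ≡ ∑ n (λ j → toℕ (r* j))
    total≡ = ∑-cong n (λ j → ≡.cong toℕ (lookup-r j))

    cost-r≡ : X.cost k r ≡ K
    cost-r≡ = ∑-cong n (λ j → ≡.cong (λ x → S (toℕ x)) (lookup-r j))

    degree≡ : ∀ i → X.degree k r exponents i ≡ ∑ n (λ j → toℕ (r* j) ℕ.* toℕ (lookup (τ j) i))
    degree≡ i = ∑-cong n (λ j → ≡.cong₂ (λ x y → toℕ x ℕ.* y) (lookup-r j)
      (≡.trans (≡.cong (λ t → lookup t i) (lookup∘tabulate (λ j → Vec.map toℕ (τ j)) j)) (lookup-map i toℕ (τ j))))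

    coordinates : ∀ i → 0 < X.degree k r exponents i × M ∣ X.degree k r exponents i
    coordinates i = ≡.subst (λ x → 0 < x × M ∣ x) (≡.sym (degree≡ i)) (Valid.coordinates r*-valid i)

    -- Excludes σ 0, which counts the subfield of order q and is not a unit. A positive coordinate
    -- sum, which exists as k ≥ 1, contains a term with r > 0.
    0<total : 0 < X.total k r
    0<total = positive (Combinatorics.positive-term n _ (proj₁ (coordinates i₀)))
      where
      positive : (∃ λ j → 0 < toℕ (lookup r j) ℕ.* lookup (lookup exponents j) i₀) → 0 < X.total k r
      positive (j , 0<) = ℕₚ.<-≤-trans (proj₁ (Combinatorics.*-positive {toℕ (lookup r j)} 0<)) (Combinatorics.term≤∑ n (λ j → toℕ (lookup r j)) j)

    exact-weight : K ≐ X.weight k exponents r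
    exact-weight = ≡.subst (_≐ X.weight k exponents r) cost-r≡ (X.weight-≐ k exponents r 0<total
      (≡.subst ((q ∸ 1) ∣_) (≡.sym total≡) (Valid.total r*-valid)) coordinates)

    -- If all choices of coefficients gave a valuation above K, interpolation would give every
    -- single `weight` a valuation above K, whereas that of the minimal family is exactly K.
    impossible : ⊥
    impossible = ≐-⋠ exact-weight (X.extract k n (X.weight k exponents) (λ is → ≼-cong (X.count-expansion k (Vec.map from is) exponents)
      (≼-* {0} 0≼ (≡.subst (λ as → suc K ≼ N q (X.polynomial k (Vec.map from as) exponents) · V-1#) (tabulate∘lookup is) (multiple-≼ _ (all-divisible (lookup is)))))) r)

  -- Exhaustive search over the coefficients, with `impossible` excluding failure, produces an
  -- actual polynomial rather than a double negation.
  tight : ∃ λ f → Deg f ⊆ ⟦ D ⟧ × toℚ⁺ (ν p (N q f)) ≡ [ μ ]⁺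
  tight = found (search (λ a → ¬? (p ℕ.^ suc C ∣? N q (family a))) (λ eq h → ≡.subst (λ v → p ℕ.^ suc C ∤ N q (X.polynomial k (Vec.map from v) exponents)) (tabulate-cong eq) h))
    where
    found : Dec (∃ λ a → p ℕ.^ suc C ∤ N q (family a)) → ∃ λ f → Deg f ⊆ ⟦ D ⟧ × toℚ⁺ (ν p (N q f)) ≡ [ μ ]⁺
    found (no none) = ⊥-elim (impossible λ a → decidable-stable (p ℕ.^ suc C ∣? N q (family a)) (λ h → none (a , h)))
    found (yes (a , p^∤)) = family a , family-Deg a , value (exponent 1<p (N q (family a)) 0<N)
      where
      0<N : 0 < N q (family a)
      0<N = ℕₚ.n≢0⇒n>0 λ N≡0 → p^∤ (≡.subst (p ℕ.^ suc C ∣_) (≡.sym N≡0) (divides 0 refl))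
      value : (∃ λ v → p ℕ.^ v ∣ N q (family a) × p ℕ.^ suc v ∤ N q (family a)) → toℚ⁺ (ν p (N q (family a))) ≡ [ μ ]⁺
      value (v , p^v∣ , p^1+v∤) = ≡.trans (≡.cong toℚ⁺ (≡.trans (ν-unique 1<p {N q (family a)} {v} 0<N p^v∣ p^1+v∤) (≡.cong [_]⁺ v≡C))) (≡.cong [_]⁺ (≡.sym μ≡C))
        where
        v≡C : v ≡ C
        v≡C = ℕₚ.≤-antisym (ℕₚ.≮⇒≥ λ C<v → p^∤ (∣-trans (divides (p ℕ.^ (v ∸ suc C))
            (≡.trans (≡.cong (p ℕ.^_) (≡.sym (ℕₚ.m∸n+n≡m C<v))) (ℕₚ.^-distribˡ-+-* p (v ∸ suc C) (suc C)))) p^v∣))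
          (C≤exponent {N q (family a)} {v} 0<N p^v∣ p^1+v∤ (count-≼ (Vec.map from (Vec.tabulate a)) exponents exponents∈D))

open import Data.Fin.Base using (zero)
open import Data.Nat.Base using (ℕ; suc; _≤_; _^_; _*_; _∸_)
import Data.Nat.Properties as ℕ
open import Data.Product.Base using (∃; _×_; _,_)
open import Data.Rational.Base as ℚ using (ℚ)
open import Defs
open import Relation.Binary.Construct.Add.Supremum.NonStrict ℚ._≤_ using (_≤⁺_)
open import Relation.Nullary.Construct.Add.Supremum using ([_])
open import Relation.Unary using (_⊆_)

-- Q is a variable tied to the power by an equation, so that it can be matched with `suc M`, the
-- form in which the field theory takes the cardinality.
theorem-cardinality : ∀ {c ℓ} (p : ℕ) (isPrime : Prime p) (e m k : ℕ) →
  1 ≤ m → 1 ≤ k → ∀ Q → Q ≡ (p ^ e) ^ m →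
  (D : Subset (suc (k * (Q ∸ 1)))) → Nonempty D → D ≢ ⁅ zero ⁆ →
  (F : FiniteField Q c ℓ) →
  let open Optimisation (p ^ e) Q k D
      open Counting F k
  in
  ∃ λ (μ : ℚ) →
    IsMinimum Admissible (cost p {{prime⇒nonTrivial isPrime}}) μ ×
    (∀ f → Deg f ⊆ ⟦ D ⟧ → [ μ ] ≤⁺ toℚ⁺ (ν p (N (p ^ e) f))) ×
    (∃ λ f → Deg f ⊆ ⟦ D ⟧ × toℚ⁺ (ν p (N (p ^ e) f)) ≡ [ μ ])
theorem-cardinality p pr e m k _ _ ℕ.zero Q≡q^m =
  contradiction (≡.sym Q≡q^m) (ℕ.≢-nonZero⁻¹ _ {{ℕ.m^n≢0 (p ^ e) m {{ℕ.m^n≢0 p e {{prime⇒nonZero pr}}}}}})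
theorem-cardinality p pr e m k 1≤m 1≤k (suc M) Q≡q^m D D-nonempty D≢0 F = μ , isMinimum , lower , tight
  where
  open Main F p pr e m k 1≤m 1≤k Q≡q^m D D-nonempty D≢0
    (Valuation.ramifiedRing F p pr (e * m) (≡.trans Q≡q^m (ℕ.^-*-assoc p e m)))

theorem5p1 : ∀ {c ℓ} (p : ℕ) (isPrime : Prime p) (e m k : ℕ) →
    1 ≤ e → 1 ≤ m → 1 ≤ k →
    let q = p ^ e
        Q = q ^ m
    in
    (D : Subset (suc (k * (Q ∸ 1)))) → Nonempty D → D ≢ ⁅ zero ⁆ →
    (F : FiniteField Q c ℓ) →
    let open Optimisation q Q k D
        open Counting F k
    in
    ∃ λ (μ : ℚ) →
      IsMinimum Admissible (cost p {{prime⇒nonTrivial isPrime}}) μ ×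
      (∀ f → Deg f ⊆ ⟦ D ⟧ → [ μ ] ≤⁺ toℚ⁺ (ν p (N q f))) ×
      (∃ λ f → Deg f ⊆ ⟦ D ⟧ × toℚ⁺ (ν p (N q f)) ≡ [ μ ])
theorem5p1 p isPrime e m k _ 1≤m 1≤k = theorem-cardinality p isPrime e m k 1≤m 1≤k ((p ^ e) ^ m) ≡.refl
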